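{- Let $p\neq q$ be odd primes, $r,l\ge 1$ integers, $n=p^rq^l$ and $m=\phi(n)$. Then $$\mathrm{Cond}(V_{\Phi_n})\le 2\,\phi(\mathrm{rad}(n))\,m^2.$$
   Context: $\phi$ is Euler's totient, $\mathrm{rad}(n)$ is the product of the distinct primes dividing $n$, $\Phi_n$ is the $n$-th cyclotomic polynomial, of degree $m=\phi(n)$, and $\zeta_1,\dots,\zeta_m\in\mathbb{C}$ are the primitive $n$-th roots of unity (in any fixed order). $V_{\Phi_n}$ is the $m\times m$ Vandermonde matrix whose $(i,j)$ entry is $\zeta_i^{\,j-1}$, $1\le i,j\le m$. For a complex matrix $A=(a_{ij})$, $\|A\|=\sqrt{\sum_{i,j}|a_{ij}|^2}$ is the Frobenius norm, and for invertible $A$, $\mathrm{Cond}(A)=\|A\|\,\|A^{ -1}\|$. -}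

module Defs where

open import Algebra.Bundles.Raw using (RawSemiring)
import Algebra.Definitions.RawSemiring as RawSemiringDefs
open import Data.Bool.Base using (if_then_else_)
open import Data.Fin.Base using (Fin; toℕ)
import Data.Fin.Properties as Fin
open import Data.Integer.Base as ℤ using (ℤ; +_)
import Data.Integer.DivMod as ℤ
import Data.Integer.Properties as ℤ
open import Data.List.Base using (filter; length; upTo; map)
open import Data.Nat.Base as ℕ using (ℕ; zero; suc)
open import Data.Nat.Coprimality using (coprime?)
open import Data.Nat.Divisibility using (_∣?_)
open import Data.Nat.ListAction using (product)
open import Data.Nat.Primality using (prime?)
import Data.Nat.Properties as ℕ
open import Data.Product.Base using (∃-syntax; _×_; _,_; proj₁; proj₂)
open import Data.Rational.Base as ℚ using (ℚ; 0ℚ; 1ℚ; ½)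
import Data.Rational.Properties as ℚ
import Data.Rational.Unnormalised.Base as ℚᵘ
import Data.Rational.Unnormalised.Properties as ℚᵘ
open import Data.Rational.Solver using (module +-*-Solver)
open import Data.Sum.Base using (inj₁; inj₂)
open import Function.Definitions using (Injective)
open import Level using (0ℓ)
open import Relation.Binary.PropositionalEquality
  using (_≡_; refl; sym; trans; cong; cong₂; subst; subst₂; module ≡-Reasoning)
open import Relation.Nullary.Decidable.Core using (does; yes; no; _×-dec_)
open import Relation.Nullary.Negation.Core using (¬_; contradiction)

-- Counts the k with 1 ≤ k ≤ n coprime to n.
φ : ℕ → ℕ
φ n = length (filter (λ k → coprime? k n) (map suc (upTo n)))

rad : ℕ → ℕ
rad n = product (filter (λ p → prime? p ×-dec p ∣? n) (upTo (suc n)))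

module ℚ-Aux where

  ι : ℕ → ℚ
  ι n = + n ℚ./ 1

  toℚᵘ-/ : ∀ a d → ℚ.toℚᵘ (a ℚ./ suc d) ℚᵘ.≃ ℚᵘ.mkℚᵘ a d
  toℚᵘ-/ a d = ℚ.toℚᵘ-fromℚᵘ (ℚᵘ.mkℚᵘ a d)

  toℚᵘ-ι : ∀ n → ℚ.toℚᵘ (ι n) ℚᵘ.≃ ℚᵘ.mkℚᵘ (+ n) 0
  toℚᵘ-ι n = toℚᵘ-/ (+ n) 0

  ι-+ : ∀ a b → ι (a ℕ.+ b) ≡ ι a ℚ.+ ι b
  ι-+ a b = ℚ.toℚᵘ-injective (begin
    ℚ.toℚᵘ (ι (a ℕ.+ b))                        ≈⟨ toℚᵘ-ι (a ℕ.+ b) ⟩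
    ℚᵘ.mkℚᵘ (+ (a ℕ.+ b)) 0                     ≈⟨ ℚᵘ.*≡* (cong (ℤ._* + 1) (cong₂ ℤ._+_ (sym (ℤ.*-identityʳ (+ a))) (sym (ℤ.*-identityʳ (+ b))))) ⟩
    ℚᵘ.mkℚᵘ (+ a) 0 ℚᵘ.+ ℚᵘ.mkℚᵘ (+ b) 0        ≈⟨ ℚᵘ.+-cong (toℚᵘ-ι a) (toℚᵘ-ι b) ⟨
    ℚ.toℚᵘ (ι a) ℚᵘ.+ ℚ.toℚᵘ (ι b)              ≈⟨ ℚ.toℚᵘ-homo-+ (ι a) (ι b) ⟨
    ℚ.toℚᵘ (ι a ℚ.+ ι b)                        ∎)
    where open ℚᵘ.≃-Reasoning

  ι-* : ∀ a b → ι (a ℕ.* b) ≡ ι a ℚ.* ι b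
  ι-* a b = ℚ.toℚᵘ-injective (begin
    ℚ.toℚᵘ (ι (a ℕ.* b))                        ≈⟨ toℚᵘ-ι (a ℕ.* b) ⟩
    ℚᵘ.mkℚᵘ (+ (a ℕ.* b)) 0                     ≈⟨ ℚᵘ.*≡* (cong (ℤ._* + 1) (ℤ.pos-* a b)) ⟩
    ℚᵘ.mkℚᵘ (+ a) 0 ℚᵘ.* ℚᵘ.mkℚᵘ (+ b) 0        ≈⟨ ℚᵘ.*-cong (toℚᵘ-ι a) (toℚᵘ-ι b) ⟨
    ℚ.toℚᵘ (ι a) ℚᵘ.* ℚ.toℚᵘ (ι b)              ≈⟨ ℚ.toℚᵘ-homo-* (ι a) (ι b) ⟨
    ℚ.toℚᵘ (ι a ℚ.* ι b)                        ∎)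
    where open ℚᵘ.≃-Reasoning

  ι-mono-≤ : ∀ {a b} → a ℕ.≤ b → ι a ℚ.≤ ι b
  ι-mono-≤ {a} {b} a≤b = ℚ.toℚᵘ-cancel-≤ (begin
    ℚ.toℚᵘ (ι a)     ≃⟨ toℚᵘ-ι a ⟩
    ℚᵘ.mkℚᵘ (+ a) 0  ≤⟨ ℚᵘ.*≤* (ℤ.*-monoʳ-≤-nonNeg (+ 1) (ℤ.+≤+ a≤b)) ⟩
    ℚᵘ.mkℚᵘ (+ b) 0  ≃⟨ toℚᵘ-ι b ⟨
    ℚ.toℚᵘ (ι b)     ∎)
    where open ℚᵘ.≤-Reasoning

  0≤/suc : ∀ a d → 0ℚ ℚ.≤ + a ℚ./ suc d
  0≤/suc a d = ℚ.toℚᵘ-cancel-≤ (begin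
    ℚ.toℚᵘ 0ℚ               ≤⟨ ℚᵘ.*≤* (ℤ.≤-trans (ℤ.≤-reflexive (ℤ.*-zeroˡ (+ suc d))) (ℤ.≤-trans (ℤ.+≤+ ℕ.z≤n) (ℤ.≤-reflexive (sym (ℤ.*-identityʳ (+ a)))))) ⟩
    ℚᵘ.mkℚᵘ (+ a) d         ≃⟨ toℚᵘ-/ (+ a) d ⟨
    ℚ.toℚᵘ (+ a ℚ./ suc d)  ∎)
    where open ℚᵘ.≤-Reasoning

  /-* : ∀ a d → (+ a ℚ./ suc d) ℚ.* ι (suc d) ≡ ι a
  /-* a d = ℚ.toℚᵘ-injective (begin
    ℚ.toℚᵘ ((+ a ℚ./ suc d) ℚ.* ι (suc d))             ≈⟨ ℚ.toℚᵘ-homo-* (+ a ℚ./ suc d) (ι (suc d)) ⟩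
    ℚ.toℚᵘ (+ a ℚ./ suc d) ℚᵘ.* ℚ.toℚᵘ (ι (suc d))     ≈⟨ ℚᵘ.*-cong (toℚᵘ-/ (+ a) d) (toℚᵘ-ι (suc d)) ⟩
    ℚᵘ.mkℚᵘ (+ a) d ℚᵘ.* ℚᵘ.mkℚᵘ (+ suc d) 0           ≈⟨ ℚᵘ.*≡* (trans (ℤ.*-identityʳ _) (cong (λ z → + a ℤ.* (+ z)) (sym (ℕ.*-identityʳ (suc d))))) ⟩
    ℚᵘ.mkℚᵘ (+ a) 0                                    ≈⟨ toℚᵘ-ι a ⟨
    ℚ.toℚᵘ (ι a)                                       ∎)
    where open ℚᵘ.≃-Reasoning

  floor-bounds : ∀ q → 0ℚ ℚ.≤ q →
                 ι ℤ.∣ ℚ.floor q ∣ ℚ.≤ q × q ℚ.< ι (suc ℤ.∣ ℚ.floor q ∣)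
  floor-bounds q@(ℚ.mkℚ a d c) (ℚ.*≤* 0≤a) = lower , upper
    where
    0≤a′ : ℤ.0ℤ ℤ.≤ a
    0≤a′ = subst₂ ℤ._≤_ (ℤ.*-zeroˡ (+ suc d)) (ℤ.*-identityʳ a) 0≤a
    f = ℚ.floor q
    f≡ : + ℤ.∣ f ∣ ≡ f
    f≡ = ℤ.0≤i⇒+∣i∣≡i (ℤ.0≤n⇒0≤n/d a (+ suc d) 0≤a′ (ℤ.+≤+ ℕ.z≤n))
    lower : ι ℤ.∣ f ∣ ℚ.≤ q
    lower = ℚ.toℚᵘ-cancel-≤ (begin
      ℚ.toℚᵘ (ι ℤ.∣ f ∣)    ≃⟨ toℚᵘ-ι ℤ.∣ f ∣ ⟩
      ℚᵘ.mkℚᵘ (+ ℤ.∣ f ∣) 0 ≤⟨ ℚᵘ.*≤* (subst₂ ℤ._≤_ (cong (ℤ._* + suc d) (sym f≡)) (sym (ℤ.*-identityʳ a)) (ℤ.[n/d]*d≤n a (+ suc d))) ⟩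
      ℚ.toℚᵘ q              ∎)
      where open ℚᵘ.≤-Reasoning
    upper : q ℚ.< ι (suc ℤ.∣ f ∣)
    upper = ℚ.toℚᵘ-cancel-< (begin-strict
      ℚ.toℚᵘ q                     <⟨ ℚᵘ.*<* (subst₂ ℤ._<_ (sym (ℤ.*-identityʳ a))
          (cong (λ z → ℤ.suc z ℤ.* + suc d) (trans (sym (ℤ.div-pos-is-/ℕ a (suc d))) (sym f≡))) (ℤ.n<s[n/ℕd]*d a (suc d))) ⟩
      ℚᵘ.mkℚᵘ (+ suc ℤ.∣ f ∣) 0    ≃⟨ toℚᵘ-ι (suc ℤ.∣ f ∣) ⟨
      ℚ.toℚᵘ (ι (suc ℤ.∣ f ∣))     ∎)
      where open ℚᵘ.≤-Reasoning

  0<½* : ∀ {ε} → 0ℚ ℚ.< ε → 0ℚ ℚ.< ½ ℚ.* ε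
  0<½* {ε} 0<ε = subst (ℚ._< ½ ℚ.* ε) (ℚ.*-zeroʳ ½) (ℚ.*-monoʳ-<-pos ½ 0<ε)

  ½+½ : ∀ ε → ½ ℚ.* ε ℚ.+ ½ ℚ.* ε ≡ ε
  ½+½ ε = trans (sym (ℚ.*-distribʳ-+ ε ½ ½)) (ℚ.*-identityˡ ε)

  +-- : ∀ a b c d → (a ℚ.+ b) ℚ.- (c ℚ.+ d) ≡ (a ℚ.- c) ℚ.+ (b ℚ.- d)
  +-- = solve 4 (λ a b c d → (a :+ b) :- (c :+ d) := (a :- c) :+ (b :- d)) refl
    where open +-*-Solver

  *-- : ∀ a b c d → a ℚ.* b ℚ.- c ℚ.* d ≡ a ℚ.* (b ℚ.- d) ℚ.+ (a ℚ.- c) ℚ.* d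
  *-- = solve 4 (λ a b c d → (a :* b) :- (c :* d) := (a :* (b :- d)) :+ ((a :- c) :* d)) refl
    where open +-*-Solver

  p≡q+[p-q] : ∀ p q → p ≡ q ℚ.+ (p ℚ.- q)
  p≡q+[p-q] = solve 2 (λ p q → p := q :+ (p :- q)) refl
    where open +-*-Solver

  scale : ∀ a b c e → a ℚ.* (c ℚ.* e) ℚ.+ (c ℚ.* e) ℚ.* b ≡ (a ℚ.+ b) ℚ.* c ℚ.* e
  scale = solve 4 (λ a b c e → (a :* (c :* e)) :+ ((c :* e) :* b) := ((a :+ b) :* c) :* e) refl
    where open +-*-Solver

  sq-* : ∀ x d → (x ℚ.* x) ℚ.* (d ℚ.* d) ≡ (x ℚ.* d) ℚ.* (x ℚ.* d)
  sq-* = solve 2 (λ x d → (x :* x) :* (d :* d) := (x :* d) :* (x :* d)) refl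
    where open +-*-Solver

  sq-+ : ∀ t d → t ℚ.* t ℚ.+ d ℚ.* d ℚ.+ (t ℚ.* d ℚ.+ t ℚ.* d) ≡ (t ℚ.+ d) ℚ.* (t ℚ.+ d)
  sq-+ = solve 2 (λ t d → (t :* t :+ d :* d) :+ (t :* d :+ t :* d) := (t :+ d) :* (t :+ d)) refl
    where open +-*-Solver

  sq-+′ : ∀ s e → (s ℚ.+ e) ℚ.* (s ℚ.+ e) ≡ s ℚ.* s ℚ.+ (s ℚ.+ s ℚ.+ e) ℚ.* e
  sq-+′ = solve 2 (λ s e → (s :+ e) :* (s :+ e) := s :* s :+ (s :+ s :+ e) :* e) refl
    where open +-*-Solver

  ∣-∣⇒≤ : ∀ a b {ε} → ℚ.∣ a ℚ.- b ∣ ℚ.≤ ε → a ℚ.≤ b ℚ.+ ε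
  ∣-∣⇒≤ a b {ε} h = begin
    a                        ≡⟨ p≡q+[p-q] a b ⟩
    b ℚ.+ (a ℚ.- b)          ≤⟨ ℚ.+-monoʳ-≤ b (p≤∣p∣ (a ℚ.- b)) ⟩
    b ℚ.+ ℚ.∣ a ℚ.- b ∣      ≤⟨ ℚ.+-monoʳ-≤ b h ⟩
    b ℚ.+ ε                  ∎
    where
    open ℚ.≤-Reasoning
    p≤∣p∣ : ∀ p → p ℚ.≤ ℚ.∣ p ∣
    p≤∣p∣ p with ℚ.≤-total 0ℚ p
    ... | inj₁ 0≤p = ℚ.≤-reflexive (sym (ℚ.0≤p⇒∣p∣≡p 0≤p))
    ... | inj₂ p≤0 = ℚ.≤-trans p≤0 (ℚ.0≤∣p∣ p)

  ≤⇒∣-∣ : ∀ a b {ε} → a ℚ.≤ b ℚ.+ ε → b ℚ.≤ a ℚ.+ ε → ℚ.∣ a ℚ.- b ∣ ℚ.≤ ε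
  ≤⇒∣-∣ a b {ε} a≤ b≤ with ℚ.∣p∣≡p∨∣p∣≡-p (a ℚ.- b)
  ... | inj₁ eq = ℚ.≤-trans (ℚ.≤-reflexive eq) (subst (a ℚ.- b ℚ.≤_)
          (solve 2 (λ b e → b :+ e :- b := e) refl b ε) (ℚ.+-monoˡ-≤ (ℚ.- b) a≤))
    where open +-*-Solver
  ... | inj₂ eq = ℚ.≤-trans (ℚ.≤-reflexive (trans eq (solve 2 (λ a b → :- (a :- b) := b :- a) refl a b)))
          (subst (b ℚ.- a ℚ.≤_)
          (solve 2 (λ b e → b :+ e :- b := e) refl a ε) (ℚ.+-monoˡ-≤ (ℚ.- a) b≤))
    where open +-*-Solver

  *-mono-≤-nonNeg : ∀ {a b c d} → 0ℚ ℚ.≤ c → 0ℚ ℚ.≤ b → a ℚ.≤ b → c ℚ.≤ d → a ℚ.* c ℚ.≤ b ℚ.* d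
  *-mono-≤-nonNeg {a} {b} {c} {d} 0≤c 0≤b a≤b c≤d =
    ℚ.≤-trans (ℚ.*-monoʳ-≤-nonNeg c {{ℚ.nonNegative 0≤c}} a≤b) (ℚ.*-monoˡ-≤-nonNeg b {{ℚ.nonNegative 0≤b}} c≤d)

  small : ∀ ε → 0ℚ ℚ.< ε → ∃[ N ] (∀ n → N ℕ.≤ n → + 1 ℚ./ suc n ℚ.≤ ε)
  small ε@(ℚ.mkℚ (+ zero) d c) (ℚ.*<* h) = contradiction (subst₂ ℤ._<_ (ℤ.*-zeroˡ (+ suc d)) (ℤ.*-identityʳ (+ 0)) h) (ℤ.<-irrefl refl)
  small ε@(ℚ.mkℚ (ℤ.-[1+ a ]) d c) (ℚ.*<* h) with () ← subst₂ ℤ._<_ (ℤ.*-zeroˡ (+ suc d)) (ℤ.*-identityʳ ℤ.-[1+ a ]) h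
  small ε@(ℚ.mkℚ (+ suc a) d c) _ = d , λ n d≤n → ℚ.toℚᵘ-cancel-≤ (begin
    ℚ.toℚᵘ (+ 1 ℚ./ suc n)   ≃⟨ toℚᵘ-/ (+ 1) n ⟩
    ℚᵘ.mkℚᵘ (+ 1) n          ≤⟨ ℚᵘ.*≤* (ℤ.+≤+ (ℕ.*-mono-≤ (ℕ.s≤s (ℕ.z≤n {a})) (ℕ.s≤s d≤n))) ⟩
    ℚᵘ.mkℚᵘ (+ suc a) d      ∎)
    where open ℚᵘ.≤-Reasoning

  0≤+ : ∀ {a b} → 0ℚ ℚ.≤ a → 0ℚ ℚ.≤ b → 0ℚ ℚ.≤ a ℚ.+ b
  0≤+ {a} {b} 0≤a 0≤b = subst (ℚ._≤ a ℚ.+ b) (ℚ.+-identityˡ 0ℚ) (ℚ.+-mono-≤ 0≤a 0≤b)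

  0≤* : ∀ {a b} → 0ℚ ℚ.≤ a → 0ℚ ℚ.≤ b → 0ℚ ℚ.≤ a ℚ.* b
  0≤* {a} {b} 0≤a 0≤b = subst (ℚ._≤ a ℚ.* b) (ℚ.*-zeroˡ b) (ℚ.*-monoʳ-≤-nonNeg b {{ℚ.nonNegative 0≤b}} 0≤a)

  sq-cancel-< : ∀ {a b} → 0ℚ ℚ.≤ b → a ℚ.* a ℚ.< b ℚ.* b → a ℚ.< b
  sq-cancel-< {a} {b} 0≤b h = ℚ.≰⇒> λ b≤a →
    ℚ.<-irrefl refl (ℚ.<-≤-trans h (*-mono-≤-nonNeg 0≤b (ℚ.≤-trans 0≤b b≤a) b≤a b≤a))

open ℚ-Aux

-- isqrt n = ⌊√n⌋
isqrt : ℕ → ℕ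
isqrt zero = zero
isqrt (suc n) with suc (isqrt n) ℕ.* suc (isqrt n) ℕ.≤? suc n
... | yes _ = suc (isqrt n)
... | no  _ = isqrt n

isqrt-lower : ∀ n → isqrt n ℕ.* isqrt n ℕ.≤ n
isqrt-lower zero = ℕ.z≤n
isqrt-lower (suc n) with suc (isqrt n) ℕ.* suc (isqrt n) ℕ.≤? suc n
... | yes p = p
... | no  _ = ℕ.m≤n⇒m≤1+n (isqrt-lower n)

isqrt-upper : ∀ n → n ℕ.< suc (isqrt n) ℕ.* suc (isqrt n)
isqrt-upper zero = ℕ.s≤s ℕ.z≤n
isqrt-upper (suc n) with suc (isqrt n) ℕ.* suc (isqrt n) ℕ.≤? suc n
... | yes _ = ℕ.≤-<-trans (isqrt-upper n)
  (ℕ.*-mono-< (ℕ.n<1+n (suc (isqrt n))) (ℕ.n<1+n (suc (isqrt n))))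
... | no ¬p = ℕ.≰⇒> ¬p

-- The largest multiple s of 1/(n+1) with s² ≤ max q 0.
√ℚ : ℕ → ℚ → ℚ
√ℚ n q = + isqrt ℤ.∣ ℚ.floor ((q ℚ.⊔ 0ℚ) ℚ.* (+ (suc n ℕ.* suc n) ℚ./ 1)) ∣ ℚ./ suc n

0≤√ℚ : ∀ n q → 0ℚ ℚ.≤ √ℚ n q
0≤√ℚ n q = 0≤/suc (isqrt ℤ.∣ ℚ.floor ((q ℚ.⊔ 0ℚ) ℚ.* (+ (suc n ℕ.* suc n) ℚ./ 1)) ∣) n

√ℚ-bounds : ∀ n q → let s = √ℚ n q; t = s ℚ.+ + 1 ℚ./ suc n in
            s ℚ.* s ℚ.≤ q ℚ.⊔ 0ℚ × q ℚ.⊔ 0ℚ ℚ.< t ℚ.* t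
√ℚ-bounds n q = lower , upper
  where
  Q = q ℚ.⊔ 0ℚ
  D = ι (suc n)
  X = Q ℚ.* ι (suc n ℕ.* suc n)
  f = ℤ.∣ ℚ.floor X ∣
  k = isqrt f
  s = + k ℚ./ suc n
  e = + 1 ℚ./ suc n
  t = s ℚ.+ e
  0<D : 0ℚ ℚ.< D
  0<D = ℚ.<-≤-trans (ℚ.*<* (ℤ.+<+ (ℕ.s≤s ℕ.z≤n))) (ι-mono-≤ {1} {suc n} (ℕ.s≤s ℕ.z≤n))
  instance
    posD : ℚ.Positive D
    posD = ℚ.positive 0<D
    posD² : ℚ.Positive (D ℚ.* D)
    posD² = ℚ.pos*pos⇒pos D D
  X≡ : X ≡ Q ℚ.* (D ℚ.* D)
  X≡ = cong (Q ℚ.*_) (ι-* (suc n) (suc n))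
  0≤X : 0ℚ ℚ.≤ X
  0≤X = subst₂ ℚ._≤_ (ℚ.*-zeroˡ (D ℚ.* D)) (sym X≡)
          (ℚ.*-monoʳ-≤-nonNeg (D ℚ.* D) {{ℚ.pos⇒nonNeg (D ℚ.* D)}} (ℚ.p≤q⊔p q 0ℚ))
  bounds = floor-bounds X 0≤X
  tD : t ℚ.* D ≡ ι (suc k)
  tD = begin
    t ℚ.* D              ≡⟨ ℚ.*-distribʳ-+ D s e ⟩
    s ℚ.* D ℚ.+ e ℚ.* D  ≡⟨ cong₂ ℚ._+_ (/-* k n) (/-* 1 n) ⟩
    ι k ℚ.+ ι 1          ≡⟨ ι-+ k 1 ⟨
    ι (k ℕ.+ 1)          ≡⟨ cong ι (ℕ.+-comm k 1) ⟩
    ι (suc k)            ∎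
    where open ≡-Reasoning
  lower : s ℚ.* s ℚ.≤ Q
  lower = ℚ.*-cancelʳ-≤-pos (D ℚ.* D) (begin
    (s ℚ.* s) ℚ.* (D ℚ.* D)  ≡⟨ sq-* s D ⟩
    (s ℚ.* D) ℚ.* (s ℚ.* D)  ≡⟨ cong₂ ℚ._*_ (/-* k n) (/-* k n) ⟩
    ι k ℚ.* ι k              ≡⟨ ι-* k k ⟨
    ι (k ℕ.* k)              ≤⟨ ι-mono-≤ (isqrt-lower f) ⟩
    ι f                      ≤⟨ proj₁ bounds ⟩
    X                        ≡⟨ X≡ ⟩
    Q ℚ.* (D ℚ.* D)          ∎)
    where open ℚ.≤-Reasoning
  upper : Q ℚ.< t ℚ.* t
  upper = ℚ.*-cancelʳ-<-nonNeg (D ℚ.* D) {{ℚ.pos⇒nonNeg (D ℚ.* D)}} (begin-strict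
    Q ℚ.* (D ℚ.* D)          ≡⟨ X≡ ⟨
    X                        <⟨ proj₂ bounds ⟩
    ι (suc f)                ≤⟨ ι-mono-≤ (isqrt-upper f) ⟩
    ι (suc k ℕ.* suc k)      ≡⟨ ι-* (suc k) (suc k) ⟩
    ι (suc k) ℚ.* ι (suc k)  ≡⟨ cong₂ ℚ._*_ tD tD ⟨
    (t ℚ.* D) ℚ.* (t ℚ.* D)  ≡⟨ sq-* t D ⟨
    (t ℚ.* t) ℚ.* (D ℚ.* D)  ∎)
    where open ℚ.≤-Reasoning

-- A real is a Cauchy sequence of rationals; _≈ʳ_ plays the role of the
-- equality of the quotient, and every statement about reals is up to _≈ʳ_.

IsCauchy : (ℕ → ℚ) → Set
IsCauchy s = ∀ ε → 0ℚ ℚ.< ε →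
  ∃[ N ] (∀ m n → N ℕ.≤ m → N ℕ.≤ n → ℚ.∣ s m ℚ.- s n ∣ ℚ.≤ ε)

record ℝ : Set where
  constructor mkℝ
  field
    seq    : ℕ → ℚ
    cauchy : IsCauchy seq

open ℝ public

infix 4 _≈ʳ_ _≤ʳ_

_≈ʳ_ : ℝ → ℝ → Set
x ≈ʳ y = ∀ ε → 0ℚ ℚ.< ε → ∃[ N ] (∀ n → N ℕ.≤ n → ℚ.∣ seq x n ℚ.- seq y n ∣ ℚ.≤ ε)

_≤ʳ_ : ℝ → ℝ → Set
x ≤ʳ y = ∀ ε → 0ℚ ℚ.< ε → ∃[ N ] (∀ n → N ℕ.≤ n → seq x n ℚ.≤ seq y n ℚ.+ ε)

fromℚ : ℚ → ℝ
fromℚ q = mkℝ (λ _ → q) λ ε 0<ε → 0 , λ _ _ _ _ →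
  subst (λ z → ℚ.∣ z ∣ ℚ.≤ ε) (sym (ℚ.+-inverseʳ q)) (ℚ.<⇒≤ 0<ε)

fromℕ : ℕ → ℝ
fromℕ n = fromℚ (+ n ℚ./ 1)

module Cauchy-Aux where

  +-cauchy : ∀ x y → IsCauchy (λ n → seq x n ℚ.+ seq y n)
  +-cauchy x y ε 0<ε = M ℕ.⊔ N , close
    where
    hx = cauchy x (½ ℚ.* ε) (0<½* 0<ε)
    hy = cauchy y (½ ℚ.* ε) (0<½* 0<ε)
    M = proj₁ hx
    N = proj₁ hy
    close : ∀ m n → M ℕ.⊔ N ℕ.≤ m → M ℕ.⊔ N ℕ.≤ n →
            ℚ.∣ (seq x m ℚ.+ seq y m) ℚ.- (seq x n ℚ.+ seq y n) ∣ ℚ.≤ ε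
    close m n ≤m ≤n = begin
      ℚ.∣ (a ℚ.+ b) ℚ.- (c ℚ.+ d) ∣      ≡⟨ cong ℚ.∣_∣ (+-- a b c d) ⟩
      ℚ.∣ (a ℚ.- c) ℚ.+ (b ℚ.- d) ∣      ≤⟨ ℚ.∣p+q∣≤∣p∣+∣q∣ (a ℚ.- c) (b ℚ.- d) ⟩
      ℚ.∣ a ℚ.- c ∣ ℚ.+ ℚ.∣ b ℚ.- d ∣    ≤⟨ ℚ.+-mono-≤
                                              (proj₂ hx m n (ℕ.m⊔n≤o⇒m≤o M N ≤m) (ℕ.m⊔n≤o⇒m≤o M N ≤n))
                                              (proj₂ hy m n (ℕ.m⊔n≤o⇒n≤o M N ≤m) (ℕ.m⊔n≤o⇒n≤o M N ≤n)) ⟩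
      ½ ℚ.* ε ℚ.+ ½ ℚ.* ε                ≡⟨ ½+½ ε ⟩
      ε                                  ∎
      where
      open ℚ.≤-Reasoning
      a = seq x m
      b = seq y m
      c = seq x n
      d = seq y n

  neg-cauchy : ∀ x → IsCauchy (λ n → ℚ.- seq x n)
  neg-cauchy x ε 0<ε = proj₁ hx , λ m n ≤m ≤n →
    subst (ℚ._≤ ε) (trans (sym (ℚ.∣-p∣≡∣p∣ (seq x m ℚ.- seq x n)))
      (cong ℚ.∣_∣ (ℚ.neg-distrib-+ (seq x m) (ℚ.- seq x n)))) (proj₂ hx m n ≤m ≤n)
    where hx = cauchy x ε 0<ε

  bounded : ∀ x → ∃[ N ] ∃[ B ] (0ℚ ℚ.< B × (∀ n → N ℕ.≤ n → ℚ.∣ seq x n ∣ ℚ.≤ B))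
  bounded x = N , ℚ.∣ c ∣ ℚ.+ 1ℚ , ℚ.+-mono-≤-< (ℚ.0≤∣p∣ c) (ℚ.positive⁻¹ 1ℚ) , bound
    where
    h = cauchy x 1ℚ (ℚ.positive⁻¹ 1ℚ)
    N = proj₁ h
    c = seq x N
    bound : ∀ n → N ℕ.≤ n → ℚ.∣ seq x n ∣ ℚ.≤ ℚ.∣ c ∣ ℚ.+ 1ℚ
    bound n ≤n = begin
      ℚ.∣ a ∣                        ≡⟨ cong ℚ.∣_∣ (p≡q+[p-q] a c) ⟩
      ℚ.∣ c ℚ.+ (a ℚ.- c) ∣          ≤⟨ ℚ.∣p+q∣≤∣p∣+∣q∣ c (a ℚ.- c) ⟩
      ℚ.∣ c ∣ ℚ.+ ℚ.∣ a ℚ.- c ∣      ≤⟨ ℚ.+-monoʳ-≤ ℚ.∣ c ∣ (proj₂ h n N ≤n ℕ.≤-refl) ⟩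
      ℚ.∣ c ∣ ℚ.+ 1ℚ                 ∎
      where
      open ℚ.≤-Reasoning
      a = seq x n

  ratio : ∀ C ε → 0ℚ ℚ.< C → 0ℚ ℚ.< ε → ∃[ c ] (C ℚ.* c ≡ 1ℚ × 0ℚ ℚ.< c ℚ.* ε)
  ratio C ε 0<C 0<ε = ℚ.1/ C , ℚ.*-inverseʳ C
    , subst (ℚ._< ℚ.1/ C ℚ.* ε) (ℚ.*-zeroʳ (ℚ.1/ C)) (ℚ.*-monoʳ-<-pos (ℚ.1/ C) 0<ε)
    where
    instance
      C≢0 : ℚ.NonZero C
      C≢0 = ℚ.>-nonZero 0<C
      C⁻¹>0 : ℚ.Positive (ℚ.1/ C)
      C⁻¹>0 = ℚ.1/pos⇒pos C {{ℚ.positive 0<C}}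

  *-close : ∀ x y ε K L M N A B κ → 0ℚ ℚ.< A →
    (∀ n → K ℕ.≤ n → ℚ.∣ seq x n ∣ ℚ.≤ A) →
    (∀ n → L ℕ.≤ n → ℚ.∣ seq y n ∣ ℚ.≤ B) →
    (A ℚ.+ B) ℚ.* κ ≡ 1ℚ → 0ℚ ℚ.< κ ℚ.* ε →
    (∀ m n → M ℕ.≤ m → M ℕ.≤ n → ℚ.∣ seq x m ℚ.- seq x n ∣ ℚ.≤ κ ℚ.* ε) →
    (∀ m n → N ℕ.≤ m → N ℕ.≤ n → ℚ.∣ seq y m ℚ.- seq y n ∣ ℚ.≤ κ ℚ.* ε) →
    ∀ m n → (K ℕ.⊔ L) ℕ.⊔ (M ℕ.⊔ N) ℕ.≤ m → (K ℕ.⊔ L) ℕ.⊔ (M ℕ.⊔ N) ℕ.≤ n →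
    ℚ.∣ seq x m ℚ.* seq y m ℚ.- seq x n ℚ.* seq y n ∣ ℚ.≤ ε
  *-close x y ε K L M N A B κ 0<A hA hB Cκ≡1 0<δ hx hy m n ≤m ≤n = begin
    ℚ.∣ a ℚ.* b ℚ.- c ℚ.* d ∣                                ≡⟨ cong ℚ.∣_∣ (*-- a b c d) ⟩
    ℚ.∣ a ℚ.* (b ℚ.- d) ℚ.+ (a ℚ.- c) ℚ.* d ∣                ≤⟨ ℚ.∣p+q∣≤∣p∣+∣q∣ (a ℚ.* (b ℚ.- d)) ((a ℚ.- c) ℚ.* d) ⟩
    ℚ.∣ a ℚ.* (b ℚ.- d) ∣ ℚ.+ ℚ.∣ (a ℚ.- c) ℚ.* d ∣          ≡⟨ cong₂ ℚ._+_ (ℚ.∣p*q∣≡∣p∣*∣q∣ a (b ℚ.- d)) (ℚ.∣p*q∣≡∣p∣*∣q∣ (a ℚ.- c) d) ⟩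
    ℚ.∣ a ∣ ℚ.* ℚ.∣ b ℚ.- d ∣ ℚ.+ ℚ.∣ a ℚ.- c ∣ ℚ.* ℚ.∣ d ∣  ≤⟨ ℚ.+-mono-≤
                                                                 (*-mono-≤-nonNeg (ℚ.0≤∣p∣ (b ℚ.- d)) (ℚ.<⇒≤ 0<A) a≤ b-d≤)
                                                                 (*-mono-≤-nonNeg (ℚ.0≤∣p∣ d) (ℚ.<⇒≤ 0<δ) a-c≤ d≤) ⟩
    A ℚ.* δ ℚ.+ δ ℚ.* B                                      ≡⟨ scale A B κ ε ⟩
    (A ℚ.+ B) ℚ.* κ ℚ.* ε                                    ≡⟨ cong (ℚ._* ε) Cκ≡1 ⟩
    1ℚ ℚ.* ε                                                 ≡⟨ ℚ.*-identityˡ ε ⟩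
    ε                                                        ∎
    where
    open ℚ.≤-Reasoning
    δ = κ ℚ.* ε
    KL = K ℕ.⊔ L
    MN = M ℕ.⊔ N
    a = seq x m
    b = seq y m
    c = seq x n
    d = seq y n
    a≤ = hA m (ℕ.m⊔n≤o⇒m≤o K L (ℕ.m⊔n≤o⇒m≤o KL MN ≤m))
    d≤ = hB n (ℕ.m⊔n≤o⇒n≤o K L (ℕ.m⊔n≤o⇒m≤o KL MN ≤n))
    a-c≤ = hx m n (ℕ.m⊔n≤o⇒m≤o M N (ℕ.m⊔n≤o⇒n≤o KL MN ≤m)) (ℕ.m⊔n≤o⇒m≤o M N (ℕ.m⊔n≤o⇒n≤o KL MN ≤n))
    b-d≤ = hy m n (ℕ.m⊔n≤o⇒n≤o M N (ℕ.m⊔n≤o⇒n≤o KL MN ≤m)) (ℕ.m⊔n≤o⇒n≤o M N (ℕ.m⊔n≤o⇒n≤o KL MN ≤n))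

  *-cauchy : ∀ x y → IsCauchy (λ n → seq x n ℚ.* seq y n)
  *-cauchy x y ε 0<ε =
    let (K , A , 0<A , hA) = bounded x
        (L , B , 0<B , hB) = bounded y
        (κ , Cκ≡1 , 0<δ)   = ratio (A ℚ.+ B) ε (ℚ.+-mono-< 0<A 0<B) 0<ε
        (M , hx)           = cauchy x (κ ℚ.* ε) 0<δ
        (N , hy)           = cauchy y (κ ℚ.* ε) 0<δ
    in (K ℕ.⊔ L) ℕ.⊔ (M ℕ.⊔ N) , *-close x y ε K L M N A B κ 0<A hA hB Cκ≡1 0<δ hx hy

  √-step : ∀ p q s u e δ →
    s ℚ.* s ℚ.≤ p ℚ.⊔ 0ℚ → q ℚ.⊔ 0ℚ ℚ.< (u ℚ.+ e) ℚ.* (u ℚ.+ e) →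
    0ℚ ℚ.≤ u → 0ℚ ℚ.≤ e → 0ℚ ℚ.≤ δ → ℚ.∣ p ℚ.- q ∣ ℚ.≤ δ ℚ.* δ → e ℚ.≤ δ →
    s ℚ.≤ u ℚ.+ (δ ℚ.+ δ)
  √-step p q s u e δ s²≤p q<t² 0≤u 0≤e 0≤δ close e≤δ = ℚ.<⇒≤ (ℚ.<-≤-trans s<t+δ (begin
      t ℚ.+ δ          ≤⟨ ℚ.+-monoˡ-≤ δ (ℚ.+-monoʳ-≤ u e≤δ) ⟩
      u ℚ.+ δ ℚ.+ δ    ≡⟨ ℚ.+-assoc u δ δ ⟩
      u ℚ.+ (δ ℚ.+ δ)  ∎))
    where
    open ℚ.≤-Reasoning
    t = u ℚ.+ e
    0≤t : 0ℚ ℚ.≤ t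
    0≤t = 0≤+ 0≤u 0≤e
    p≤ : p ℚ.⊔ 0ℚ ℚ.≤ q ℚ.⊔ 0ℚ ℚ.+ δ ℚ.* δ
    p≤ = ℚ.⊔-lub
      (ℚ.≤-trans (∣-∣⇒≤ p q close) (ℚ.+-monoˡ-≤ (δ ℚ.* δ) (ℚ.p≤p⊔q q 0ℚ)))
      (0≤+ (ℚ.p≤q⊔p q 0ℚ) (0≤* 0≤δ 0≤δ))
    s<t+δ : s ℚ.< t ℚ.+ δ
    s<t+δ = sq-cancel-< (0≤+ 0≤t 0≤δ) (begin-strict
      s ℚ.* s                                          ≤⟨ s²≤p ⟩
      p ℚ.⊔ 0ℚ                                         ≤⟨ p≤ ⟩
      q ℚ.⊔ 0ℚ ℚ.+ δ ℚ.* δ                             <⟨ ℚ.+-monoˡ-< (δ ℚ.* δ) q<t² ⟩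
      t ℚ.* t ℚ.+ δ ℚ.* δ                              ≡⟨ ℚ.+-identityʳ (t ℚ.* t ℚ.+ δ ℚ.* δ) ⟨
      t ℚ.* t ℚ.+ δ ℚ.* δ ℚ.+ 0ℚ                       ≤⟨ ℚ.+-monoʳ-≤ (t ℚ.* t ℚ.+ δ ℚ.* δ) (0≤+ (0≤* 0≤t 0≤δ) (0≤* 0≤t 0≤δ)) ⟩
      t ℚ.* t ℚ.+ δ ℚ.* δ ℚ.+ (t ℚ.* δ ℚ.+ t ℚ.* δ)    ≡⟨ sq-+ t δ ⟩
      (t ℚ.+ δ) ℚ.* (t ℚ.+ δ)                          ∎)

  √-cauchy : ∀ x → IsCauchy (λ n → √ℚ n (seq x n))
  √-cauchy x ε 0<ε = M ℕ.⊔ N , λ m n ≤m ≤n →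
    ≤⇒∣-∣ (√ℚ m (seq x m)) (√ℚ n (seq x n)) (step m n ≤m ≤n) (step n m ≤n ≤m)
    where
    δ = ½ ℚ.* ε
    0<δ = 0<½* 0<ε
    0<δδ : 0ℚ ℚ.< δ ℚ.* δ
    0<δδ = ℚ.positive⁻¹ (δ ℚ.* δ) {{ℚ.pos*pos⇒pos δ {{ℚ.positive 0<δ}} δ {{ℚ.positive 0<δ}}}}
    hx = cauchy x (δ ℚ.* δ) 0<δδ
    he = small δ 0<δ
    M = proj₁ hx
    N = proj₁ he
    step : ∀ m n → M ℕ.⊔ N ℕ.≤ m → M ℕ.⊔ N ℕ.≤ n →
           √ℚ m (seq x m) ℚ.≤ √ℚ n (seq x n) ℚ.+ ε
    step m n ≤m ≤n = subst (λ z → √ℚ m (seq x m) ℚ.≤ √ℚ n (seq x n) ℚ.+ z) (½+½ ε)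
      (√-step (seq x m) (seq x n) (√ℚ m (seq x m)) (√ℚ n (seq x n)) (+ 1 ℚ./ suc n) δ
        (proj₁ (√ℚ-bounds m (seq x m))) (proj₂ (√ℚ-bounds n (seq x n)))
        (0≤√ℚ n (seq x n)) (0≤/suc 1 n) (ℚ.<⇒≤ 0<δ)
        (proj₂ hx m n (ℕ.m⊔n≤o⇒m≤o M N ≤m) (ℕ.m⊔n≤o⇒m≤o M N ≤n))
        (proj₂ he n (ℕ.m⊔n≤o⇒n≤o M N ≤n)))

open Cauchy-Aux

infixl 6 _+ʳ_ _-ʳ_
infixl 7 _*ʳ_
infix  8 -ʳ_

_+ʳ_ : ℝ → ℝ → ℝ
x +ʳ y = mkℝ (λ n → seq x n ℚ.+ seq y n) (+-cauchy x y)

_*ʳ_ : ℝ → ℝ → ℝ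
x *ʳ y = mkℝ (λ n → seq x n ℚ.* seq y n) (*-cauchy x y)

-ʳ_ : ℝ → ℝ
-ʳ x = mkℝ (λ n → ℚ.- seq x n) (neg-cauchy x)

_-ʳ_ : ℝ → ℝ → ℝ
x -ʳ y = x +ʳ (-ʳ y)

-- Total; for a negative argument the value is 0.
√ : ℝ → ℝ
√ x = mkℝ (λ n → √ℚ n (seq x n)) (√-cauchy x)

0≤√ : ∀ x → fromℕ 0 ≤ʳ √ x
0≤√ x ε 0<ε = 0 , λ n _ → 0≤+ {√ℚ n (seq x n)} {ε} (0≤√ℚ n (seq x n)) (ℚ.<⇒≤ 0<ε)

module √-Aux where

  √-close : ∀ x ε K L M N B κ → 0ℚ ℚ.< ε → 0ℚ ℚ.< B →
    (∀ n → K ℕ.≤ n → ℚ.∣ √ℚ n (seq x n) ∣ ℚ.≤ B) →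
    (∀ n → N ℕ.≤ n → 0ℚ ℚ.≤ seq x n ℚ.+ ε) →
    (B ℚ.+ B ℚ.+ 1ℚ) ℚ.* κ ≡ 1ℚ →
    (∀ n → M ℕ.≤ n → + 1 ℚ./ suc n ℚ.≤ 1ℚ) →
    (∀ n → L ℕ.≤ n → + 1 ℚ./ suc n ℚ.≤ κ ℚ.* ε) →
    ∀ n → (K ℕ.⊔ L) ℕ.⊔ (M ℕ.⊔ N) ℕ.≤ n →
    ℚ.∣ √ℚ n (seq x n) ℚ.* √ℚ n (seq x n) ℚ.- seq x n ∣ ℚ.≤ ε
  √-close x ε K L M N B κ 0<ε 0<B hB hx Cκ≡1 e≤1 e≤δ n ≤n = ≤⇒∣-∣ (√ℚ n (seq x n) ℚ.* √ℚ n (seq x n)) (seq x n)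
    (ℚ.≤-trans (proj₁ (√ℚ-bounds n (seq x n))) (ℚ.⊔-lub q≤q+ε (hx n (ℕ.m⊔n≤o⇒n≤o M N (ℕ.m⊔n≤o⇒n≤o KL MN ≤n)))))
    (main (seq x n) (√ℚ n (seq x n)) (+ 1 ℚ./ suc n) (ℚ.<⇒≤ (proj₂ (√ℚ-bounds n (seq x n)))) (0≤/suc 1 n)
      (subst (ℚ._≤ B) (ℚ.0≤p⇒∣p∣≡p (0≤√ℚ n (seq x n))) (hB n (ℕ.m⊔n≤o⇒m≤o K L (ℕ.m⊔n≤o⇒m≤o KL MN ≤n))))
      (e≤1 n (ℕ.m⊔n≤o⇒m≤o M N (ℕ.m⊔n≤o⇒n≤o KL MN ≤n)))
      (e≤δ n (ℕ.m⊔n≤o⇒n≤o K L (ℕ.m⊔n≤o⇒m≤o KL MN ≤n))))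
    where
    KL = K ℕ.⊔ L
    MN = M ℕ.⊔ N
    C = B ℚ.+ B ℚ.+ 1ℚ
    0≤C : 0ℚ ℚ.≤ C
    0≤C = 0≤+ (0≤+ (ℚ.<⇒≤ 0<B) (ℚ.<⇒≤ 0<B)) (ℚ.nonNegative⁻¹ 1ℚ)
    main : ∀ q s e → q ℚ.⊔ 0ℚ ℚ.≤ (s ℚ.+ e) ℚ.* (s ℚ.+ e) → 0ℚ ℚ.≤ e → s ℚ.≤ B → e ℚ.≤ 1ℚ → e ℚ.≤ κ ℚ.* ε →
           q ℚ.≤ s ℚ.* s ℚ.+ ε
    main q s e h 0≤e s≤B e≤1 e≤δ = begin
      q                                      ≤⟨ ℚ.p≤p⊔q q 0ℚ ⟩
      q ℚ.⊔ 0ℚ                               ≤⟨ h ⟩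
      (s ℚ.+ e) ℚ.* (s ℚ.+ e)                ≡⟨ sq-+′ s e ⟩
      s ℚ.* s ℚ.+ (s ℚ.+ s ℚ.+ e) ℚ.* e      ≤⟨ ℚ.+-monoʳ-≤ (s ℚ.* s) (*-mono-≤-nonNeg 0≤e 0≤C
                                                  (ℚ.+-mono-≤ (ℚ.+-mono-≤ s≤B s≤B) e≤1) e≤δ) ⟩
      s ℚ.* s ℚ.+ C ℚ.* (κ ℚ.* ε)            ≡⟨ cong (s ℚ.* s ℚ.+_) (sym (ℚ.*-assoc C κ ε)) ⟩
      s ℚ.* s ℚ.+ C ℚ.* κ ℚ.* ε              ≡⟨ cong (λ z → s ℚ.* s ℚ.+ z ℚ.* ε) Cκ≡1 ⟩
      s ℚ.* s ℚ.+ 1ℚ ℚ.* ε                   ≡⟨ cong (s ℚ.* s ℚ.+_) (ℚ.*-identityˡ ε) ⟩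
      s ℚ.* s ℚ.+ ε                          ∎
      where open ℚ.≤-Reasoning
    q≤q+ε : seq x n ℚ.≤ seq x n ℚ.+ ε
    q≤q+ε = subst (ℚ._≤ seq x n ℚ.+ ε) (ℚ.+-identityʳ (seq x n)) (ℚ.+-monoʳ-≤ (seq x n) (ℚ.<⇒≤ 0<ε))

  √-limit : ∀ x ε → 0ℚ ℚ.< ε →
    ∃[ K ] ∃[ B ] (0ℚ ℚ.< B × (∀ n → K ℕ.≤ n → ℚ.∣ √ℚ n (seq x n) ∣ ℚ.≤ B)) →
    ∃[ N ] (∀ n → N ℕ.≤ n → 0ℚ ℚ.≤ seq x n ℚ.+ ε) →
    ∃[ N ] (∀ n → N ℕ.≤ n → ℚ.∣ √ℚ n (seq x n) ℚ.* √ℚ n (seq x n) ℚ.- seq x n ∣ ℚ.≤ ε)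
  √-limit x ε 0<ε (K , B , 0<B , hB) (N , hx) =
    let (κ , Cκ≡1 , 0<δ) = ratio (B ℚ.+ B ℚ.+ 1ℚ) ε (ℚ.+-mono-< (ℚ.+-mono-< 0<B 0<B) (ℚ.positive⁻¹ 1ℚ)) 0<ε
        (L , e≤δ)        = small (κ ℚ.* ε) 0<δ
        (M , e≤1)        = small 1ℚ (ℚ.positive⁻¹ 1ℚ)
    in (K ℕ.⊔ L) ℕ.⊔ (M ℕ.⊔ N) , √-close x ε K L M N B κ 0<ε 0<B hB hx Cκ≡1 e≤1 e≤δ

open √-Aux

√*√ : ∀ x → fromℕ 0 ≤ʳ x → √ x *ʳ √ x ≈ʳ x
√*√ x 0≤x ε 0<ε = √-limit x ε 0<ε (bounded (√ x)) (0≤x ε 0<ε)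

ℝ-rawSemiring : RawSemiring 0ℓ 0ℓ
ℝ-rawSemiring = record
  { Carrier = ℝ
  ; _≈_     = _≈ʳ_
  ; _+_     = _+ʳ_
  ; _*_     = _*ʳ_
  ; 0#      = fromℕ 0
  ; 1#      = fromℕ 1
  }

record ℂ : Set where
  constructor _+i_
  field
    re im : ℝ

open ℂ public

infix 4 _≈ᶜ_

_≈ᶜ_ : ℂ → ℂ → Set
z ≈ᶜ w = re z ≈ʳ re w × im z ≈ʳ im w

infixl 6 _+ᶜ_
infixl 7 _*ᶜ_

_+ᶜ_ : ℂ → ℂ → ℂ
z +ᶜ w = (re z +ʳ re w) +i (im z +ʳ im w)

_*ᶜ_ : ℂ → ℂ → ℂ
z *ᶜ w = (re z *ʳ re w -ʳ im z *ʳ im w) +i (re z *ʳ im w +ʳ im z *ʳ re w)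

0ᶜ 1ᶜ : ℂ
0ᶜ = fromℕ 0 +i fromℕ 0
1ᶜ = fromℕ 1 +i fromℕ 0

∣_∣ᶜ : ℂ → ℝ
∣ z ∣ᶜ = √ (re z *ʳ re z +ʳ im z *ʳ im z)

ℂ-rawSemiring : RawSemiring 0ℓ 0ℓ
ℂ-rawSemiring = record
  { Carrier = ℂ
  ; _≈_     = _≈ᶜ_
  ; _+_     = _+ᶜ_
  ; _*_     = _*ᶜ_
  ; 0#      = 0ᶜ
  ; 1#      = 1ᶜ
  }

open RawSemiringDefs ℝ-rawSemiring public using () renaming (sum to ∑ʳ)
open RawSemiringDefs ℂ-rawSemiring public using () renaming (sum to ∑ᶜ; _^_ to _^ᶜ_)

Matrix : ℕ → ℕ → Set
Matrix k l = Fin k → Fin l → ℂ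

infix 4 _≈ᴹ_

_≈ᴹ_ : ∀ {k l} → Matrix k l → Matrix k l → Set
A ≈ᴹ B = ∀ i j → A i j ≈ᶜ B i j

infixl 7 _*ᴹ_

_*ᴹ_ : ∀ {k l m} → Matrix k l → Matrix l m → Matrix k m
(A *ᴹ B) i j = ∑ᶜ λ k → A i k *ᶜ B k j

1ᴹ : ∀ {m} → Matrix m m
1ᴹ i j = if does (i Fin.≟ j) then 1ᶜ else 0ᶜ

IsInverse : ∀ {m} → Matrix m m → Matrix m m → Set
IsInverse A B = A *ᴹ B ≈ᴹ 1ᴹ × B *ᴹ A ≈ᴹ 1ᴹ

Invertible : ∀ {m} → Matrix m m → Set
Invertible A = ∃[ B ] IsInverse A B

‖_‖ : ∀ {k l} → Matrix k l → ℝ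
‖ A ‖ = √ (∑ʳ λ i → ∑ʳ λ j → ∣ A i j ∣ᶜ *ʳ ∣ A i j ∣ᶜ)

Cond : ∀ {m} (A : Matrix m m) → Invertible A → ℝ
Cond A inv = ‖ A ‖ *ʳ ‖ proj₁ inv ‖

-- Columns are numbered from 0, so column j holds the j-th powers.
Vandermonde : ∀ {m} → (Fin m → ℂ) → Matrix m m
Vandermonde ζ i j = ζ i ^ᶜ toℕ j

IsPrimitiveRoot : ℕ → ℂ → Set
IsPrimitiveRoot n z = z ^ᶜ n ≈ᶜ 1ᶜ × (∀ k → 0 ℕ.< k → k ℕ.< n → ¬ z ^ᶜ k ≈ᶜ 1ᶜ)

-- ζ lists each of the primitive n-th roots of unity, i.e. the complex roots
-- of the n-th cyclotomic polynomial, exactly once.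
EnumeratesPrimitiveRoots : (n : ℕ) → (Fin (φ n) → ℂ) → Set
EnumeratesPrimitiveRoots n ζ =
  (∀ i → IsPrimitiveRoot n (ζ i)) ×
  Injective _≡_ _≈ᶜ_ ζ ×
  (∀ z → IsPrimitiveRoot n z → ∃[ i ] ζ i ≈ᶜ z)

module Submission where

open import Defs
open import Algebra.Bundles using (CommutativeSemiring; CommutativeRing)
open import Algebra.Bundles.Raw using (RawMonoid)
import Algebra.Definitions.RawMonoid as RawMonoidDefs
open import Algebra.Structures using (IsCommutativeRing)
open import Data.Bool.Base using (Bool; true; false; if_then_else_; not; _∨_; T)
open import Data.Fin.Base using (Fin; toℕ; zero; suc)
import Data.Fin.Properties as Fin
import Data.Integer.Base as ℤ
open import Data.List.Base using (filter; length; upTo; applyUpTo)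
open import Data.List.Membership.Propositional.Properties using (∈-filter⁺; ∈-upTo⁺)
open import Data.List.Properties using (map-upTo)
import Data.List.Relation.Unary.All as All
open import Data.List.Relation.Unary.All.Properties using (all-filter)
open import Data.Nat.Base as ℕ using (ℕ; zero; suc; _≤_; _<_; s≤s; z≤n; s<s; z<s; _∸_; NonZero)
open import Data.Nat.Coprimality as Coprime using (Coprime; coprime?; coprime-divisor; coprime-Bézout)
open import Data.Nat.Divisibility
open import Data.Nat.DivMod
open import Data.Nat.GCD using (module Bézout)
open import Data.Nat.ListAction.Properties using (∈⇒≤product)
open import Data.Nat.Primality using (Prime; prime?; prime⇒irreducible; prime⇒nonZero; ¬prime[0]; ¬prime[1])
import Data.Nat.Properties as ℕ
open import Data.Nat.Tactic.RingSolver using (solve-∀)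
open import Data.Product.Base using (_×_; _,_; proj₁; proj₂; ∃-syntax; Σ-syntax)
open import Data.Rational.Base as ℚ using (ℚ; 0ℚ; 1ℚ; ½)
import Data.Rational.Properties as ℚ
open import Data.Rational.Solver using (module +-*-Solver)
open import Data.Sum.Base using (_⊎_; inj₁; inj₂)
open import Function.Base using (_∘_)
open import Level using (Level; 0ℓ)
open import Relation.Binary.PropositionalEquality as ≡ using (_≡_; _≢_)
open import Relation.Nullary using (¬_; Dec; does; yes; no; contradiction; _×-dec_)
open import Relation.Nullary.Decidable using (dec-true; dec-false; toWitness)
open import Relation.Unary using (Pred; Decidable)

-- The inverse of V comes from Lagrange interpolation at all n-th roots of unity: the
-- polynomial n⁻¹ Σ_{a<n} ζᵢ⁻ᵃ xᵃ is 1 at ζᵢ and 0 at every other root. Expanding each power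
-- ζᵃ in 1, ζ, …, ζ^{m-1}, with coefficients ρ(a,j) that do not depend on the primitive root ζ,
-- gives (V⁻¹)ⱼᵢ = n⁻¹ Σ_a ζᵢ⁻ᵃ ρ(a,j), so |(V⁻¹)ⱼᵢ| is at most the largest |ρ(a,j)|. It suffices to
-- show |ρ| ≤ 4 ≤ 2 φ(rad n): then ‖V‖ = m and ‖V⁻¹‖ ≤ 4 m.
--
-- With h = n / pq and y = ζʰ, only powers of y below pq need expanding, in powers below
-- d = (p-1)(q-1). Let g be the indicator function of the gaps of the numerical semigroup ⟨p, q⟩,
-- which are all less than d, and put D_c = Σ_{j<d} g(j+c) yʲ. Then D_c = g(c) + y D_{c+1}, and
-- (1 - y) D₀ = 1 because Φ_pq(y) = 0. The recurrences for g give, for 0 < c < p + q,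
--   y⁻ᶜ = D_c + D₀ - D_{c∸p} - D_{c∸q},
-- whose coefficients are signed sums of four bits.

-- Finite sums and roots of unity in a commutative ring

-- The series of ⟨p, q⟩ is Φ_pq(x) / (1 - x), so its gap polynomial is (1 - Φ_pq(x)) / (1 - x),
-- which equals 1 / (1 - y) at a root y of Φ_pq. This is the source of (1 - y) D₀ = 1. No cyclotomic
-- polynomial is formed, however: y is known only through y^p ≠ 1, y^q ≠ 1 and y^(pq) = 1. The range
-- 0 < c < p + q is what has to be covered because p + q + d = pq + 1: the exponents a with d ≤ a <
-- pq are exactly the numbers pq - c. The constant 4 counts four terms of modulus at most 1 whatever
-- their signs, and 4 ≤ 2 φ(rad n) holds because rad n ≥ p ≥ 3. Inverting a number constructively
-- takes apartness from 0, while distinctness and primitivity give only negated equalities.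
-- Divisions by 1 - y^p or ζₖ - ζᵢ therefore become cancellations in a ring without zero divisors,
-- and most identities are kept free of subtraction so that a semiring solver settles them. Bounds
-- on moduli are proved for the squared modulus, which is polynomial in the real and imaginary
-- parts.

module Sums {c ℓ : Level} (S : CommutativeSemiring c ℓ) where

  open CommutativeSemiring S hiding (zero)
  open import Algebra.Properties.Semiring.Sum semiring
  open import Relation.Binary.Reasoning.Setoid setoid

  ∑< : ℕ → (ℕ → Carrier) → Carrier
  ∑< n f = sum {n} (λ i → f (toℕ i))

  ∑<-cong : ∀ n {f g} → (∀ k → k < n → f k ≈ g k) → ∑< n f ≈ ∑< n g
  ∑<-cong n f≈g = sum-cong-≋ {n} (λ i → f≈g (toℕ i) (Fin.toℕ<n i))

  ∑<-zero : ∀ n {f} → (∀ k → k < n → f k ≈ 0#) → ∑< n f ≈ 0#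
  ∑<-zero n f≈0 = trans (∑<-cong n f≈0) (sum-replicate-zero n)

  ∑<-+ : ∀ n f g → ∑< n (λ k → f k + g k) ≈ ∑< n f + ∑< n g
  ∑<-+ n f g = ∑-distrib-+ {n} (f ∘ toℕ) (g ∘ toℕ)

  *-∑< : ∀ n x f → x * ∑< n f ≈ ∑< n (λ k → x * f k)
  *-∑< n x f = *-distribˡ-sum {n} x (f ∘ toℕ)

  ∑<-split : ∀ m n f → ∑< (m ℕ.+ n) f ≈ ∑< m f + ∑< n (λ k → f (m ℕ.+ k))
  ∑<-split zero    n f = sym (+-identityˡ _)
  ∑<-split (suc m) n f = trans (+-congˡ (∑<-split m n (f ∘ suc))) (sym (+-assoc _ _ _))

  ∑<-last : ∀ n f → ∑< (suc n) f ≈ ∑< n f + f n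
  ∑<-last zero    f = +-comm _ _
  ∑<-last (suc n) f = trans (+-congˡ (∑<-last n (f ∘ suc))) (sym (+-assoc _ _ _))

  -- Trades the range 1, ..., n, over which `φ` counts, for 0, ..., n-1, over which sums split into
  -- blocks.
  ∑<-rotate : ∀ n f → f 0 ≈ f n → ∑< n (f ∘ suc) ≈ ∑< n f
  ∑<-rotate zero    f eq = refl
  ∑<-rotate (suc n) f eq = begin
    ∑< (suc n) (f ∘ suc)         ≈⟨ ∑<-last n (f ∘ suc) ⟩
    ∑< n (f ∘ suc) + f (suc n)   ≈⟨ +-comm _ _ ⟩
    f (suc n) + ∑< n (f ∘ suc)   ≈⟨ +-congʳ eq ⟨
    ∑< (suc n) f                 ∎

  ∑<-block : ∀ b c f → ∑< (b ℕ.* c) f ≈ ∑< b (λ j → ∑< c (λ i → f (i ℕ.+ j ℕ.* c)))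
  ∑<-block zero    c f = refl
  ∑<-block (suc b) c f = begin
    ∑< (c ℕ.+ b ℕ.* c) f
      ≈⟨ ∑<-split c (b ℕ.* c) f ⟩
    ∑< c f + ∑< (b ℕ.* c) (λ k → f (c ℕ.+ k))
      ≈⟨ +-cong (∑<-cong c λ i _ → reflexive (≡.cong f (≡.sym (ℕ.+-identityʳ i))))
                (trans (∑<-block b c (λ k → f (c ℕ.+ k)))
                       (∑<-cong b λ j _ → ∑<-cong c λ i _ → reflexive (≡.cong f (swap i j)))) ⟩
    ∑< (suc b) (λ j → ∑< c (λ i → f (i ℕ.+ j ℕ.* c)))
      ∎
    where
    swap : ∀ i j → c ℕ.+ (i ℕ.+ j ℕ.* c) ≡ i ℕ.+ (c ℕ.+ j ℕ.* c)
    swap i j = ≡.trans (≡.sym (ℕ.+-assoc c i _)) (≡.trans (≡.cong (ℕ._+ j ℕ.* c) (ℕ.+-comm c i)) (ℕ.+-assoc i c _))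

  ∑<-single : ∀ n f a → a < n → (∀ k → k ≢ a → f k ≈ 0#) → ∑< n f ≈ f a
  ∑<-single (suc n) f zero    _         f≈0 = begin
    f 0 + ∑< n (f ∘ suc)  ≈⟨ +-congˡ (∑<-zero n λ k _ → f≈0 (suc k) λ ()) ⟩
    f 0 + 0#              ≈⟨ +-identityʳ _ ⟩
    f 0                   ∎
  ∑<-single (suc n) f (suc a) (s<s a<n) f≈0 = begin
    f 0 + ∑< n (f ∘ suc)  ≈⟨ +-cong (f≈0 0 λ ()) (∑<-single n (f ∘ suc) a a<n λ k k≢a → f≈0 (suc k) (k≢a ∘ ℕ.suc-injective)) ⟩
    0# + f (suc a)        ≈⟨ +-identityˡ _ ⟩
    f (suc a)             ∎

  ⟦_⟧ : Bool → Carrier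
  ⟦ b ⟧ = if b then 1# else 0#

  -- In each block of length c only the term of remainder 0 survives.
  ∑<-multiples : ∀ b c (f : ℕ → Carrier) → 0 < c → ∑< (b ℕ.* c) (λ k → ⟦ does (c ∣? k) ⟧ * f k) ≈ ∑< b (λ j → f (j ℕ.* c))
  ∑<-multiples b c f 0<c = trans (∑<-block b c g) (∑<-cong b λ j _ → begin
    ∑< c (λ i → g (i ℕ.+ j ℕ.* c))   ≈⟨ ∑<-cong c (λ i i<c → step i j i<c) ⟩
    ∑< c (λ i → ⟦ does (i ℕ.≟ 0) ⟧ * f (j ℕ.* c)) ≈⟨ ∑<-single c _ 0 0<c vanish ⟩
    1# * f (j ℕ.* c)                 ≈⟨ *-identityˡ _ ⟩
    f (j ℕ.* c)                      ∎)
    where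
    g : ℕ → Carrier
    g k = ⟦ does (c ∣? k) ⟧ * f k
    vanish : ∀ {x} k → k ≢ 0 → ⟦ does (k ℕ.≟ 0) ⟧ * x ≈ 0#
    vanish zero    k≢0 = contradiction ≡.refl k≢0
    vanish (suc k) _   = zeroˡ _
    step : ∀ i j → i < c → g (i ℕ.+ j ℕ.* c) ≈ ⟦ does (i ℕ.≟ 0) ⟧ * f (j ℕ.* c)
    step zero j _ with c ∣? j ℕ.* c
    ... | yes _ = refl
    ... | no  h = contradiction (n∣m*n j) h
    step (suc i) j i<c with c ∣? suc i ℕ.+ j ℕ.* c
    ... | no  _ = trans (zeroˡ _) (sym (zeroˡ _))
    ... | yes h = contradiction (∣m+n∣m⇒∣n (≡.subst (c ∣_) (ℕ.+-comm (suc i) (j ℕ.* c)) h) (n∣m*n j)) (>⇒∤ {n = suc i} i<c)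

<ᵇ-true : ∀ m n → (m ℕ.<ᵇ n) ≡ true → m < n
<ᵇ-true m n eq = ℕ.<ᵇ⇒< _ _ (≡.subst T (≡.sym eq) _)

<ᵇ-false : ∀ m n → (m ℕ.<ᵇ n) ≡ false → n ≤ m
<ᵇ-false m n eq = ℕ.≮⇒≥ (λ m<n → ≡.subst T eq (ℕ.<⇒<ᵇ m<n))

-- Used with s = p + q and n = pq: an exponent that is at least d falls short of pq by less than p +
-- q.
complement-< : ∀ {a b d s n} → s ℕ.+ d ≡ suc n → a ℕ.+ b ≡ n → d ≤ a → b < s
complement-< {a} {b} {d} {s} {n} s+d≡1+n a+b≡n d≤a = ℕ.+-cancelʳ-≤ d _ _ (begin
  suc b ℕ.+ d    ≡⟨ ℕ.+-comm (suc b) d ⟩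
  d ℕ.+ suc b    ≤⟨ ℕ.+-monoˡ-≤ (suc b) d≤a ⟩
  a ℕ.+ suc b    ≡⟨ ℕ.+-suc a b ⟩
  suc (a ℕ.+ b)  ≡⟨ ≡.cong suc a+b≡n ⟩
  suc n          ≡⟨ s+d≡1+n ⟨
  s ℕ.+ d        ∎)
  where open ℕ.≤-Reasoning

-- What the expansion needs of the semigroup ⟨p, q⟩. Below pq, the least element of each class
-- modulo p is the multiple of q in it. Hence adding p changes membership only when the result is a
-- multiple of q, and then from gap to element.
record Gaps (p q d : ℕ) : Set where
  field
    gap      : ℕ → Bool
    bounded  : ∀ k → d ≤ k → gap k ≡ false
    initial  : ∀ k → k < p → gap k ≡ not (does (q ∣? k))
    multiple : ∀ k → p ℕ.+ k < p ℕ.* q → q ∣ p ℕ.+ k → gap k ≡ true × gap (p ℕ.+ k) ≡ false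
    periodic : ∀ k → p ℕ.+ k < p ℕ.* q → ¬ q ∣ p ℕ.+ k → gap (p ℕ.+ k) ≡ gap k

-- Classically equivalent to the usual formulation; constructively it avoids apartness.
NoZeroDivisors : ∀ {c ℓ} → CommutativeRing c ℓ → Set _
NoZeroDivisors R = ∀ x y → x * y ≈ 0# → ¬ x ≈ 0# → y ≈ 0#
  where open CommutativeRing R

module Domain {c ℓ : Level} (R : CommutativeRing c ℓ) (noZeroDivisors : NoZeroDivisors R) where

  open CommutativeRing R hiding (zero)
  open Sums commutativeSemiring public
  open import Algebra.Properties.Semiring.Exp semiring
  open import Algebra.Properties.Semiring.Mult semiring using () renaming (_×_ to infixr 8 _·_)
  open import Algebra.Properties.Monoid.Sum +-monoid using (sum-replicate)
  open import Algebra.Properties.Ring ring using (x≈y⇒x∙y⁻¹≈ε; x∙y⁻¹≈ε⇒x≈y; x[y-z]≈xy-xz; [y-z]x≈yx-zx; +-cancelʳ; //-rightDividesˡ)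
  open import Algebra.Solver.Ring.NaturalCoefficients.Default commutativeSemiring
    using (solve; _:=_; _:+_; _:*_; con)
  open import Relation.Binary.Reasoning.Setoid setoid

  -- The formula for (x - 1) times the sum, with the negative terms moved across.
  ∑<-geometric : ∀ n x → ∑< n (x ^_) * x + 1# ≈ ∑< n (x ^_) + x ^ n
  ∑<-geometric zero    x = +-congʳ (zeroˡ x)
  ∑<-geometric (suc n) x = begin
    ∑< (suc n) (x ^_) * x + 1#             ≈⟨ +-congʳ (*-congʳ (∑<-last n (x ^_))) ⟩
    (∑< n (x ^_) + x ^ n) * x + 1#         ≈⟨ lemma (∑< n (x ^_)) (x ^ n) x ⟩
    (∑< n (x ^_) * x + 1#) + x * x ^ n     ≈⟨ +-congʳ (∑<-geometric n x) ⟩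
    ∑< n (x ^_) + x ^ n + x ^ suc n        ≈⟨ +-congʳ (∑<-last n (x ^_)) ⟨
    ∑< (suc n) (x ^_) + x ^ suc n          ∎
    where
    lemma : ∀ a b x → (a + b) * x + 1# ≈ (a * x + 1#) + x * b
    lemma = solve 3 (λ a b x → (a :+ b) :* x :+ con 1 := (a :* x :+ con 1) :+ x :* b) refl

  -- This is (x - y) S = y (xⁿ - yⁿ) without subtraction. The additional factor y arises because the
  -- exponents add up to n rather than n - 1, matching ζ⁻ᵃ written as ζ^(n ∸ a).
  ∑<-homogeneous : ∀ n x y → x * ∑< n (λ a → x ^ a * y ^ (n ∸ a)) + y * y ^ n ≈
                             y * ∑< n (λ a → x ^ a * y ^ (n ∸ a)) + y * x ^ n
  ∑<-homogeneous zero    x y = +-congʳ (trans (zeroʳ x) (sym (zeroʳ y)))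
  ∑<-homogeneous (suc n) x y = begin
    x * (1# * y ^ suc n + S′) + y * (y * y ^ n)    ≈⟨ +-congʳ (*-congˡ (+-congˡ S′≈)) ⟩
    x * (1# * (y * y ^ n) + x * S) + y * (y * y ^ n)  ≈⟨ lemma₁ x y (y ^ n) S ⟩
    x * (x * S + y * y ^ n) + y * (y * y ^ n)      ≈⟨ +-congʳ (*-congˡ (∑<-homogeneous n x y)) ⟩
    x * (y * S + y * x ^ n) + y * (y * y ^ n)      ≈⟨ lemma₂ x y (y ^ n) S (x ^ n) ⟩
    y * (1# * (y * y ^ n) + x * S) + y * (x * x ^ n)  ≈⟨ +-congʳ (*-congˡ (+-congˡ S′≈)) ⟨
    y * (1# * y ^ suc n + S′) + y * (x * x ^ n)    ∎
    where
    S = ∑< n (λ a → x ^ a * y ^ (n ∸ a))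
    S′ = ∑< n (λ a → x ^ suc a * y ^ (n ∸ a))
    S′≈ : S′ ≈ x * S
    S′≈ = trans (∑<-cong n (λ a _ → *-assoc x (x ^ a) (y ^ (n ∸ a))))
                (sym (*-∑< n x (λ a → x ^ a * y ^ (n ∸ a))))
    lemma₁ : ∀ x y b t → x * (1# * (y * b) + x * t) + y * (y * b) ≈ x * (x * t + y * b) + y * (y * b)
    lemma₁ = solve 4 (λ x y b t →
      x :* (con 1 :* (y :* b) :+ x :* t) :+ y :* (y :* b) := x :* (x :* t :+ y :* b) :+ y :* (y :* b)) refl
    lemma₂ : ∀ x y b t a → x * (y * t + y * a) + y * (y * b) ≈ y * (1# * (y * b) + x * t) + y * (x * a)
    lemma₂ = solve 5 (λ x y b t a →
      x :* (y :* t :+ y :* a) :+ y :* (y :* b) := y :* (con 1 :* (y :* b) :+ x :* t) :+ y :* (x :* a)) refl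

  ∑<-diagonal : ∀ n x y → x ≈ y → ∑< n (λ a → x ^ a * y ^ (n ∸ a)) ≈ n · x ^ n
  ∑<-diagonal n x y x≈y = trans (∑<-cong n λ a a<n → begin
    x ^ a * y ^ (n ∸ a)   ≈⟨ *-congˡ (^-congˡ (n ∸ a) x≈y) ⟨
    x ^ a * x ^ (n ∸ a)   ≈⟨ ^-homo-* x a (n ∸ a) ⟨
    x ^ (a ℕ.+ (n ∸ a))   ≡⟨ ≡.cong (x ^_) (ℕ.m+[n∸m]≡n (ℕ.<⇒≤ a<n)) ⟩
    x ^ n                 ∎)
    (sum-replicate n)

  cancel : ∀ x y z → x * z ≈ y * z → ¬ x ≈ y → z ≈ 0#
  cancel x y z eq x≉y = noZeroDivisors (x - y) z
    (trans ([y-z]x≈yx-zx z x y) (x≈y⇒x∙y⁻¹≈ε eq)) (x≉y ∘ x∙y⁻¹≈ε⇒x≈y x y)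

  *-cancelˡ : ∀ x y z → x * y ≈ x * z → ¬ x ≈ 0# → y ≈ z
  *-cancelˡ x y z eq x≉0 = x∙y⁻¹≈ε⇒x≈y y z (noZeroDivisors x (y - z) (trans (x[y-z]≈xy-xz x y z) (x≈y⇒x∙y⁻¹≈ε eq)) x≉0)

  -- The premise is (x - y) (a - b) = 0 multiplied out.
  crossCancel : ∀ x y a b → x * a + y * b ≈ x * b + y * a → ¬ x ≈ y → a ≈ b
  crossCancel x y a b eq x≉y = *-cancelˡ (x - y) a b (+-cancelʳ (y * a + y * b) _ _ (begin
    (x - y) * a + (y * a + y * b)  ≈⟨ expand a b ⟩
    x * a + y * b                  ≈⟨ eq ⟩
    x * b + y * a                  ≈⟨ expand b a ⟨
    (x - y) * b + (y * b + y * a)  ≈⟨ +-congˡ (+-comm _ _) ⟩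
    (x - y) * b + (y * a + y * b)  ∎)) (x≉y ∘ x∙y⁻¹≈ε⇒x≈y x y)
    where
    expand : ∀ a b → (x - y) * a + (y * a + y * b) ≈ x * a + y * b
    expand a b = begin
      (x - y) * a + (y * a + y * b)  ≈⟨ +-assoc _ _ _ ⟨
      (x - y) * a + y * a + y * b    ≈⟨ +-congʳ (distribʳ a (x - y) y) ⟨
      (x - y + y) * a + y * b        ≈⟨ +-congʳ (*-congʳ (//-rightDividesˡ y x)) ⟩
      x * a + y * b                  ∎

  ∑<-root-of-unity : ∀ n x → x ^ n ≈ 1# → ¬ x ≈ 1# → ∑< n (x ^_) ≈ 0#
  ∑<-root-of-unity n x xⁿ≈1 = cancel x 1# _ (+-cancelʳ 1# _ _ (begin
    x * ∑< n (x ^_) + 1#       ≈⟨ +-congʳ (*-comm x _) ⟩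
    ∑< n (x ^_) * x + 1#       ≈⟨ ∑<-geometric n x ⟩
    ∑< n (x ^_) + x ^ n        ≈⟨ +-cong (sym (*-identityˡ _)) xⁿ≈1 ⟩
    1# * ∑< n (x ^_) + 1#      ∎))

  ∑<-orthogonal : ∀ n x y → x ^ n ≈ y ^ n → ¬ x ≈ y → ∑< n (λ a → x ^ a * y ^ (n ∸ a)) ≈ 0#
  ∑<-orthogonal n x y eq = cancel x y _ (+-cancelʳ (y * y ^ n) _ _
    (trans (∑<-homogeneous n x y) (+-congˡ (*-congˡ eq))))

  -- Expanding every power of a root in powers below the degree

  module Reduction {p q d : ℕ} (G : Gaps p q d) where

    open Gaps G

    D : Carrier → ℕ → Carrier
    D y c = ∑< d (λ j → ⟦ gap (j ℕ.+ c) ⟧ * y ^ j)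

    gap₀ : ∀ k x → d ≤ k → ⟦ gap k ⟧ * x ≈ 0#
    gap₀ k _ d≤k = trans (*-congʳ (reflexive (≡.cong ⟦_⟧ (bounded k d≤k)))) (zeroˡ _)

    D-step : ∀ y c → D y c ≈ ⟦ gap c ⟧ + y * D y (suc c)
    D-step y c = begin
      D y c                                                  ≈⟨ +-identityʳ _ ⟨
      -- The term of index d is 0, since all gaps lie below d. Adding it allows the first term to be
      -- split off while d terms remain.
      D y c + 0#                                             ≈⟨ +-congˡ (gap₀ (d ℕ.+ c) (y ^ d) (ℕ.m≤m+n d c)) ⟨
      D y c + ⟦ gap (d ℕ.+ c) ⟧ * y ^ d                      ≈⟨ ∑<-last d (λ j → ⟦ gap (j ℕ.+ c) ⟧ * y ^ j) ⟨
      ⟦ gap c ⟧ * 1# + ∑< d (λ j → ⟦ gap (suc j ℕ.+ c) ⟧ * (y * y ^ j))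
        ≈⟨ +-cong (*-identityʳ _) (∑<-cong d λ j _ → trans (swap _ y (y ^ j))
             (*-congˡ (*-congʳ (reflexive (≡.cong (λ k → ⟦ gap k ⟧) (≡.sym (ℕ.+-suc j c))))))) ⟩
      ⟦ gap c ⟧ + ∑< d (λ j → y * (⟦ gap (j ℕ.+ suc c) ⟧ * y ^ j))  ≈⟨ +-congˡ (*-∑< d y (λ j → ⟦ gap (j ℕ.+ suc c) ⟧ * y ^ j)) ⟨
      ⟦ gap c ⟧ + y * D y (suc c)                            ∎
      where
      swap : ∀ a b c → a * (b * c) ≈ b * (a * c)
      swap = solve 3 (λ a b c → a :* (b :* c) := b :* (a :* c)) refl

    -- The gap polynomial at y. It is `D y 0` without the index `j + 0`, which does not reduce.
    Γ : Carrier → Carrier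
    Γ y = ∑< d (λ j → ⟦ gap j ⟧ * y ^ j)

    D₀≈Γ : ∀ y → D y 0 ≈ Γ y
    D₀≈Γ y = ∑<-cong d λ j _ → reflexive (≡.cong (λ k → ⟦ gap k ⟧ * y ^ j) (ℕ.+-identityʳ j))

    Γ-extend : ∀ y e → d ≤ e → ∑< e (λ j → ⟦ gap j ⟧ * y ^ j) ≈ Γ y
    Γ-extend y e d≤e = begin
      ∑< e f                                         ≡⟨ ≡.cong (λ e → ∑< e f) (≡.sym (ℕ.m+[n∸m]≡n d≤e)) ⟩
      ∑< (d ℕ.+ (e ∸ d)) f                           ≈⟨ ∑<-split d (e ∸ d) f ⟩
      Γ y + ∑< (e ∸ d) (λ j → f (d ℕ.+ j))
        ≈⟨ +-congˡ (∑<-zero (e ∸ d) λ j _ → gap₀ (d ℕ.+ j) (y ^ (d ℕ.+ j)) (ℕ.m≤m+n d j)) ⟩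
      Γ y + 0#                                       ≈⟨ +-identityʳ _ ⟩
      Γ y                                            ∎
      where
      f : ℕ → Carrier
      f j = ⟦ gap j ⟧ * y ^ j

    -- Whether the integer c - s is a gap, negative integers counting as gaps. This convention
    -- supplies the constant term 1 in D₀ = 1 + y D₀, which replaces the recurrence for D wherever
    -- `c ∸ s` is truncated to 0.
    gap⁺ : ℕ → ℕ → Bool
    gap⁺ s c = (c ℕ.<ᵇ s) ∨ gap (c ∸ s)

    gap-initial : ∀ k → k < p → ⟦ gap k ⟧ + ⟦ does (q ∣? k) ⟧ ≈ 1#
    gap-initial k k<p rewrite initial k k<p with does (q ∣? k)
    ... | true  = +-identityˡ _
    ... | false = +-identityʳ _

    gap-shift : ∀ k → p ℕ.+ k < p ℕ.* q → ⟦ gap (p ℕ.+ k) ⟧ + ⟦ does (q ∣? (p ℕ.+ k)) ⟧ ≈ ⟦ gap k ⟧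
    gap-shift k k<pq with q ∣? (p ℕ.+ k)
    ... | yes q∣ rewrite proj₁ (multiple k k<pq q∣) | proj₂ (multiple k k<pq q∣) = +-identityˡ _
    ... | no  q∤ rewrite periodic k k<pq q∤ = +-identityʳ _

    -- The coefficients of y⁻ᶜ, for 0 < c < p + q; gap (j + 0) belongs to D₀.
    tailCoeff : ℕ → ℕ → Carrier
    tailCoeff c j = (⟦ gap (j ℕ.+ c) ⟧ + ⟦ gap (j ℕ.+ 0) ⟧) - (⟦ gap (j ℕ.+ (c ∸ p)) ⟧ + ⟦ gap (j ℕ.+ (c ∸ q)) ⟧)

    coeff : ℕ → ℕ → Carrier
    coeff a j with a ℕ.<? d
    ... | yes _ = ⟦ does (j ℕ.≟ a) ⟧
    ... | no  _ = tailCoeff (p ℕ.* q ∸ a) j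

    -- With y = z^h, z^a = z^(a % h) y^(a / h). Expanding the second factor in powers of y brings in
    -- only exponents congruent to a modulo h.
    blockCoeff : ∀ h .{{_ : NonZero h}} → ℕ → ℕ → Carrier
    blockCoeff h a j = if does (j % h ℕ.≟ a % h) then coeff (a / h) (j / h) else 0#

    module _ {ℓ′ : Level} (P : Carrier → Set ℓ′) (bit : ∀ b → P ⟦ b ⟧)
             (bits : ∀ b₁ b₂ b₃ b₄ → P ((⟦ b₁ ⟧ + ⟦ b₂ ⟧) - (⟦ b₃ ⟧ + ⟦ b₄ ⟧))) where

      -- All that the norm bound has to know about the coefficients: each is one bit or a signed sum
      -- of four.
      coeff-elim : ∀ a j → P (coeff a j)
      coeff-elim a j with a ℕ.<? d
      ... | yes _ = bit (does (j ℕ.≟ a))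
      ... | no  _ = bits (gap (j ℕ.+ b)) (gap (j ℕ.+ 0)) (gap (j ℕ.+ (b ∸ p))) (gap (j ℕ.+ (b ∸ q)))
        where b = p ℕ.* q ∸ a

      blockCoeff-elim : ∀ h .{{_ : NonZero h}} a j → P (blockCoeff h a j)
      blockCoeff-elim h a j with does (j % h ℕ.≟ a % h)
      ... | true  = coeff-elim (a / h) (j / h)
      ... | false = bit false

    module _ (y : Carrier) (0<p : 0 < p) (0<q : 0 < q) (1+d+[p+q] : p ℕ.+ q ℕ.+ d ≡ suc (p ℕ.* q))
             (yᵖ≉1 : ¬ y ^ p ≈ 1#) (y^q≉1 : ¬ y ^ q ≈ 1#) (y^pq≈1 : y ^ (p ℕ.* q) ≈ 1#) where

      e : ℕ
      e = p ℕ.* q ∸ p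

      p+e : p ℕ.+ e ≡ p ℕ.* q
      p+e = ℕ.m+[n∸m]≡n (ℕ.m≤m*n p q {{ℕ.>-nonZero 0<q}})

      d≤e : d ≤ e
      d≤e = ℕ.+-cancelˡ-≤ p d e (ℕ.≤-pred (≡.subst₂ _≤_ eq₁ eq₂ (ℕ.+-monoˡ-≤ d (ℕ.+-monoʳ-≤ p 0<q))))
        where
        eq₁ : p ℕ.+ 1 ℕ.+ d ≡ suc (p ℕ.+ d)
        eq₁ = ≡.cong (ℕ._+ d) (ℕ.+-comm p 1)
        eq₂ : p ℕ.+ q ℕ.+ d ≡ suc (p ℕ.+ e)
        eq₂ = ≡.trans 1+d+[p+q] (≡.cong suc (≡.sym p+e))

      -- The sum is geometric in y^q, a p-th root of unity other than 1.
      multiples≈0 : ∑< (p ℕ.* q) (λ k → ⟦ does (q ∣? k) ⟧ * y ^ k) ≈ 0#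
      multiples≈0 = begin
        ∑< (p ℕ.* q) (λ k → ⟦ does (q ∣? k) ⟧ * y ^ k)  ≈⟨ ∑<-multiples p q (y ^_) 0<q ⟩
        ∑< p (λ j → y ^ (j ℕ.* q))
          ≈⟨ ∑<-cong p (λ j _ → trans (reflexive (≡.cong (y ^_) (ℕ.*-comm j q))) (sym (^-assocʳ y q j))) ⟩
        ∑< p ((y ^ q) ^_)
          ≈⟨ ∑<-root-of-unity p (y ^ q) (trans (^-assocʳ y q p) (trans (reflexive (≡.cong (y ^_) (ℕ.*-comm q p))) y^pq≈1)) y^q≉1 ⟩
        0#                                              ∎

      -- Add the vanishing sum over the multiples of q to the gap polynomial. Below p the two bits
      -- at k add up to 1; from p onwards they add up to the gap bit at k - p.
      Γ-period : Γ y ≈ ∑< p (y ^_) + y ^ p * Γ y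
      Γ-period = begin
        Γ y                                               ≈⟨ +-identityʳ _ ⟨
        Γ y + 0#
          ≈⟨ +-cong (Γ-extend y (p ℕ.* q) (≡.subst (d ≤_) p+e (ℕ.m≤n⇒m≤o+n p d≤e))) multiples≈0 ⟨
        ∑< (p ℕ.* q) f + ∑< (p ℕ.* q) g                   ≈⟨ ∑<-+ (p ℕ.* q) f g ⟨
        ∑< (p ℕ.* q) (λ k → f k + g k)                    ≡⟨ ≡.cong (λ n → ∑< n (λ k → f k + g k)) (≡.sym p+e) ⟩
        ∑< (p ℕ.+ e) (λ k → f k + g k)                    ≈⟨ ∑<-split p e (λ k → f k + g k) ⟩
        ∑< p (λ k → f k + g k) + ∑< e (λ k → f (p ℕ.+ k) + g (p ℕ.+ k))
          ≈⟨ +-cong (∑<-cong p λ k k<p → trans (sym (distribʳ (y ^ k) _ _)) (trans (*-congʳ (gap-initial k k<p)) (*-identityˡ _)))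
                    (∑<-cong e λ k k<e → trans (sym (distribʳ (y ^ (p ℕ.+ k)) _ _)) (trans
                      (*-cong (gap-shift k (≡.subst (p ℕ.+ k <_) p+e (ℕ.+-monoʳ-< p k<e))) (^-homo-* y p k)) (swap _ (y ^ p) (y ^ k)))) ⟩
        ∑< p (y ^_) + ∑< e (λ k → y ^ p * f k)            ≈⟨ +-congˡ (*-∑< e (y ^ p) f) ⟨
        ∑< p (y ^_) + y ^ p * ∑< e f                      ≈⟨ +-congˡ (*-congˡ (Γ-extend y e d≤e)) ⟩
        ∑< p (y ^_) + y ^ p * Γ y                         ∎
        where
        f g : ℕ → Carrier
        f k = ⟦ gap k ⟧ * y ^ k
        g k = ⟦ does (q ∣? k) ⟧ * y ^ k
        swap : ∀ a b c → a * (b * c) ≈ b * (a * c)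
        swap = solve 3 (λ a b c → a :* (b :* c) := b :* (a :* c)) refl

      -- Multiplying `Γ-period` by 1 - y turns the geometric sum into 1 - y^p, so (1 - y^p) (1 - y)
      -- D₀ = 1 - y^p, and 1 - y^p cancels.
      D-unit : D y 0 ≈ 1# + y * D y 0
      D-unit = crossCancel (y ^ p) 1# _ _ (begin
        P * D₀ + 1# * (1# + y * D₀)              ≈⟨ +-congˡ (*-congˡ (+-congˡ (*-congˡ D₀≈))) ⟩
        P * D₀ + 1# * (1# + y * (G′ + P * D₀))   ≈⟨ lemma₁ P D₀ y G′ ⟩
        P * (y * D₀) + P * D₀ + (G′ * y + 1#)    ≈⟨ +-congˡ (∑<-geometric p y) ⟩
        P * (y * D₀) + P * D₀ + (G′ + P)         ≈⟨ lemma₂ P D₀ y G′ ⟩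
        P * (1# + y * D₀) + 1# * (G′ + P * D₀)   ≈⟨ +-congˡ (*-congˡ D₀≈) ⟨
        P * (1# + y * D₀) + 1# * D₀              ∎) yᵖ≉1
        where
        P = y ^ p
        D₀ = D y 0
        G′ = ∑< p (y ^_)
        D₀≈ : D₀ ≈ G′ + P * D₀
        D₀≈ = trans (D₀≈Γ y) (trans Γ-period (+-congˡ (*-congˡ (sym (D₀≈Γ y)))))
        lemma₁ : ∀ P D y G → P * D + 1# * (1# + y * (G + P * D)) ≈ P * (y * D) + P * D + (G * y + 1#)
        lemma₁ = solve 4 (λ P D y G → P :* D :+ con 1 :* (con 1 :+ y :* (G :+ P :* D)) :=
                                      P :* (y :* D) :+ P :* D :+ (G :* y :+ con 1)) refl
        lemma₂ : ∀ P D y G → P * (y * D) + P * D + (G + P) ≈ P * (1# + y * D) + 1# * (G + P * D)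
        lemma₂ = solve 4 (λ P D y G → P :* (y :* D) :+ P :* D :+ (G :+ P) :=
                                      P :* (con 1 :+ y :* D) :+ con 1 :* (G :+ P :* D)) refl

      -- For c < s both truncated indices are 0 and the recurrence is `D-unit`; otherwise it is
      -- `D-step`.
      D-step⁺ : ∀ s c → D y (c ∸ s) ≈ ⟦ gap⁺ s c ⟧ + y * D y (suc c ∸ s)
      D-step⁺ s c with c ℕ.<ᵇ s in eq
      ... | true  rewrite ℕ.m≤n⇒m∸n≡0 (ℕ.<⇒≤ (<ᵇ-true c s eq)) | ℕ.m≤n⇒m∸n≡0 (<ᵇ-true c s eq) = D-unit
      ... | false rewrite ℕ.+-∸-assoc 1 (<ᵇ-false c s eq) = D-step y (c ∸ s)

      gap⁺-p : ∀ c → c < p ℕ.* q → ⟦ gap c ⟧ + ⟦ does (q ∣? c) ⟧ ≈ ⟦ gap⁺ p c ⟧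
      gap⁺-p c c<pq with c ℕ.<ᵇ p in eq
      ... | true  = gap-initial c (<ᵇ-true c p eq)
      ... | false = trans (reflexive (≡.cong (λ k → ⟦ gap k ⟧ + ⟦ does (q ∣? k) ⟧) c≡))
                          (gap-shift (c ∸ p) (≡.subst (_< p ℕ.* q) c≡ c<pq))
        where
        c≡ : c ≡ p ℕ.+ (c ∸ p)
        c≡ = ≡.sym (ℕ.m+[n∸m]≡n (<ᵇ-false c p eq))

      -- If 0 < c < q, then c - q is negative and q does not divide c. Otherwise c - q < p, and a
      -- number below p is a gap unless q divides it. Both ends of the range of c are used here.
      gap⁺-q : ∀ c → 0 < c → c < q ℕ.+ p → ⟦ gap⁺ q c ⟧ + ⟦ does (q ∣? c) ⟧ ≈ 1#
      gap⁺-q c 0<c c<q+p with c ℕ.<ᵇ q in eq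
      gap⁺-q c 0<c c<q+p | true with q ∣? c
      ... | no  _  = +-identityʳ _
      ... | yes q∣ = contradiction q∣ (>⇒∤ {{ℕ.>-nonZero 0<c}} (<ᵇ-true c q eq))
      gap⁺-q c 0<c c<q+p | false = trans (+-congˡ (reflexive (≡.cong ⟦_⟧ does≡))) (gap-initial k k<p)
        where
        k = c ∸ q
        c≡ : q ℕ.+ k ≡ c
        c≡ = ℕ.m+[n∸m]≡n (<ᵇ-false c q eq)
        k<p : k < p
        k<p = ℕ.+-cancelˡ-< q k p (≡.subst (_< q ℕ.+ p) (≡.sym c≡) c<q+p)
        does≡ : does (q ∣? c) ≡ does (q ∣? k)
        does≡ with q ∣? c | q ∣? k
        ... | yes _ | yes _ = ≡.refl
        ... | no  _ | no  _ = ≡.refl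
        ... | yes h | no ¬h = contradiction (∣m+n∣m⇒∣n (≡.subst (q ∣_) (≡.sym c≡) h) ∣-refl) ¬h
        ... | no ¬h | yes h = contradiction (≡.subst (q ∣_) c≡ (∣m∣n⇒∣m+n ∣-refl h)) ¬h

      U V : ℕ → Carrier
      U c = D y c + D y 0
      V c = D y (c ∸ p) + D y (c ∸ q)

      U-step : ∀ c → y * U (suc c) + (⟦ gap c ⟧ + 1#) ≈ U c
      U-step c = begin
        y * (D y (suc c) + D y 0) + (⟦ gap c ⟧ + 1#)          ≈⟨ lemma y (D y (suc c)) (D y 0) ⟦ gap c ⟧ 1# ⟩
        (⟦ gap c ⟧ + y * D y (suc c)) + (1# + y * D y 0)      ≈⟨ +-cong (D-step y c) D-unit ⟨
        U c                                                   ∎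
        where
        lemma : ∀ y a b g h → y * (a + b) + (g + h) ≈ (g + y * a) + (h + y * b)
        lemma = solve 5 (λ y a b g h → y :* (a :+ b) :+ (g :+ h) := (g :+ y :* a) :+ (h :+ y :* b)) refl

      V-step : ∀ c → y * V (suc c) + (⟦ gap⁺ p c ⟧ + ⟦ gap⁺ q c ⟧) ≈ V c
      V-step c = trans (lemma y (D y (suc c ∸ p)) (D y (suc c ∸ q)) ⟦ gap⁺ p c ⟧ ⟦ gap⁺ q c ⟧)
                       (sym (+-cong (D-step⁺ p c) (D-step⁺ q c)))
        where
        lemma : ∀ y a b g h → y * (a + b) + (g + h) ≈ (g + y * a) + (h + y * b)
        lemma = solve 5 (λ y a b g h → y :* (a :+ b) :+ (g :+ h) := (g :+ y :* a) :+ (h :+ y :* b)) refl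

      -- Eliminates the bit of q ∣ c between `gap⁺-p` and `gap⁺-q`. The constant terms of the
      -- recurrences for U and V then agree, so that U c - V c = y (U (c+1) - V (c+1)).
      balance : ∀ c → 0 < c → suc c < p ℕ.+ q → ⟦ gap c ⟧ + 1# ≈ ⟦ gap⁺ p c ⟧ + ⟦ gap⁺ q c ⟧
      balance c 0<c c<p+q = begin
        ⟦ gap c ⟧ + 1#
          ≈⟨ +-congˡ (gap⁺-q c 0<c (≡.subst (c <_) (ℕ.+-comm p q) (ℕ.<⇒≤ c<p+q))) ⟨
        ⟦ gap c ⟧ + (⟦ gap⁺ q c ⟧ + ⟦ does (q ∣? c) ⟧)        ≈⟨ +-congˡ (+-comm _ _) ⟩
        ⟦ gap c ⟧ + (⟦ does (q ∣? c) ⟧ + ⟦ gap⁺ q c ⟧)        ≈⟨ +-assoc _ _ _ ⟨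
        ⟦ gap c ⟧ + ⟦ does (q ∣? c) ⟧ + ⟦ gap⁺ q c ⟧          ≈⟨ +-congʳ (gap⁺-p c c<pq) ⟩
        ⟦ gap⁺ p c ⟧ + ⟦ gap⁺ q c ⟧                           ∎
        where
        c<pq : c < p ℕ.* q
        c<pq = ℕ.≤-pred (ℕ.≤-trans c<p+q (≡.subst (p ℕ.+ q ≤_) 1+d+[p+q] (ℕ.m≤m+n (p ℕ.+ q) d)))

      -- At index 0, U and V are both 2 D₀, but their constant terms there are 1 and 2, because 0 is
      -- not a gap while -p and -q count as gaps. This gives y (U 1 - V 1) = 1, and `balance`
      -- carries it to larger c.
      U≈1+V : ∀ c → suc c < p ℕ.+ q → y ^ suc c * U (suc c) ≈ 1# + y ^ suc c * V (suc c)
      U≈1+V zero    _ = +-cancelʳ 1# _ _ (begin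
        y * 1# * U 1 + 1#                              ≈⟨ lemma y (U 1) ⟩
        y * U 1 + (0# + 1#)                            ≈⟨ +-congˡ (+-congʳ (reflexive (≡.cong ⟦_⟧ gap₀≡))) ⟨
        y * U 1 + (⟦ gap 0 ⟧ + 1#)                     ≈⟨ U-step 0 ⟩
        D y 0 + D y 0
          ≈⟨ +-cong (reflexive (≡.cong (D y) (≡.sym (ℕ.0∸n≡0 p)))) (reflexive (≡.cong (D y) (≡.sym (ℕ.0∸n≡0 q)))) ⟩
        V 0                                            ≈⟨ V-step 0 ⟨
        y * V 1 + (⟦ gap⁺ p 0 ⟧ + ⟦ gap⁺ q 0 ⟧)
          ≈⟨ +-congˡ (+-cong (reflexive (≡.cong ⟦_⟧ (gap⁺₀ 0<p))) (reflexive (≡.cong ⟦_⟧ (gap⁺₀ 0<q)))) ⟩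
        y * V 1 + (1# + 1#)                            ≈⟨ lemma′ y (V 1) ⟩
        (1# + y * 1# * V 1) + 1#                       ∎)
        where
        gap₀≡ : gap 0 ≡ false
        gap₀≡ = ≡.trans (initial 0 0<p) (≡.cong not (dec-true (q ∣? 0) (q ∣0)))
        gap⁺₀ : ∀ {s} → 0 < s → gap⁺ s 0 ≡ true
        gap⁺₀ {suc s} _ = ≡.refl
        lemma : ∀ y u → y * 1# * u + 1# ≈ y * u + (0# + 1#)
        lemma = solve 2 (λ y u → y :* con 1 :* u :+ con 1 := y :* u :+ (con 0 :+ con 1)) refl
        lemma′ : ∀ y u → y * u + (1# + 1#) ≈ (1# + y * 1# * u) + 1#
        lemma′ = solve 2 (λ y u → y :* u :+ (con 1 :+ con 1) := (con 1 :+ y :* con 1 :* u) :+ con 1) refl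
      U≈1+V (suc c) c<p+q = +-cancelʳ (P * s) _ _ (begin
        y * P * U′ + P * s           ≈⟨ lemma y P U′ s ⟩
        P * (y * U′ + s)             ≈⟨ *-congˡ (U-step (suc c)) ⟩
        P * U (suc c)                ≈⟨ U≈1+V c (ℕ.<⇒≤ c<p+q) ⟩
        1# + P * V (suc c)           ≈⟨ +-congˡ (*-congˡ (V-step (suc c))) ⟨
        1# + P * (y * V′ + _)        ≈⟨ +-congˡ (*-congˡ (+-congˡ (balance (suc c) z<s c<p+q))) ⟨
        1# + P * (y * V′ + s)        ≈⟨ +-congˡ (lemma y P V′ s) ⟨
        1# + (y * P * V′ + P * s)    ≈⟨ +-assoc _ _ _ ⟨
        1# + y * P * V′ + P * s      ∎)
        where
        P = y ^ suc c
        U′ = U (suc (suc c))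
        V′ = V (suc (suc c))
        s = ⟦ gap (suc c) ⟧ + 1#
        lemma : ∀ y P u s → y * P * u + P * s ≈ P * (y * u + s)
        lemma = solve 4 (λ y P u s → y :* P :* u :+ P :* s := P :* (y :* u :+ s)) refl

      tail-expansion : ∀ c → suc c < p ℕ.+ q → y ^ suc c * ∑< d (λ j → tailCoeff (suc c) j * y ^ j) ≈ 1#
      tail-expansion c c<p+q = +-cancelʳ (y ^ suc c * V (suc c)) _ _ (begin
        y ^ suc c * S + y ^ suc c * V (suc c)     ≈⟨ distribˡ _ _ _ ⟨
        y ^ suc c * (S + V (suc c))               ≈⟨ *-congˡ S+V≈U ⟩
        y ^ suc c * U (suc c)                     ≈⟨ U≈1+V c c<p+q ⟩
        1# + y ^ suc c * V (suc c)                ∎)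
        where
        S = ∑< d (λ j → tailCoeff (suc c) j * y ^ j)
        f : ℕ → ℕ → Carrier
        f c j = ⟦ gap (j ℕ.+ c) ⟧ * y ^ j
        term : ∀ a b u v z → (a + b - (u + v)) * z + (u * z + v * z) ≈ a * z + b * z
        term a b u v z = begin
          (a + b - (u + v)) * z + (u * z + v * z)   ≈⟨ +-congˡ (distribʳ z u v) ⟨
          (a + b - (u + v)) * z + (u + v) * z       ≈⟨ distribʳ z _ _ ⟨
          (a + b - (u + v) + (u + v)) * z           ≈⟨ *-congʳ (//-rightDividesˡ (u + v) (a + b)) ⟩
          (a + b) * z                               ≈⟨ distribʳ z a b ⟩
          a * z + b * z                             ∎
        S+V≈U : S + V (suc c) ≈ U (suc c)
        S+V≈U = begin
          S + V (suc c)  ≈⟨ +-congˡ (∑<-+ d (f (suc c ∸ p)) (f (suc c ∸ q))) ⟨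
          S + ∑< d (λ j → f (suc c ∸ p) j + f (suc c ∸ q) j)
            ≈⟨ ∑<-+ d (λ j → tailCoeff (suc c) j * y ^ j) (λ j → f (suc c ∸ p) j + f (suc c ∸ q) j) ⟨
          ∑< d (λ j → tailCoeff (suc c) j * y ^ j + (f (suc c ∸ p) j + f (suc c ∸ q) j))
            ≈⟨ ∑<-cong d (λ j _ → term ⟦ gap (j ℕ.+ suc c) ⟧ ⟦ gap (j ℕ.+ 0) ⟧
                 ⟦ gap (j ℕ.+ (suc c ∸ p)) ⟧ ⟦ gap (j ℕ.+ (suc c ∸ q)) ⟧ (y ^ j)) ⟩
          ∑< d (λ j → f (suc c) j + f 0 j)  ≈⟨ ∑<-+ d (f (suc c)) (f 0) ⟩
          U (suc c)                         ∎

      expansion : ∀ a → a < p ℕ.* q → ∑< d (λ j → coeff a j * y ^ j) ≈ y ^ a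
      expansion a a<pq with a ℕ.<? d
      ... | yes a<d = trans (∑<-single d (λ j → ⟦ does (j ℕ.≟ a) ⟧ * y ^ j) a a<d
                        (λ j j≢a → trans (*-congʳ (reflexive (≡.cong ⟦_⟧ (dec-false (j ℕ.≟ a) j≢a)))) (zeroˡ _)))
                        (trans (*-congʳ (reflexive (≡.cong ⟦_⟧ (dec-true (a ℕ.≟ a) ≡.refl)))) (*-identityˡ _))
      ... | no  a≮d = begin
        S (p ℕ.* q ∸ a)                           ≡⟨ ≡.cong S b≡ ⟩
        S (suc b)                                 ≈⟨ *-identityˡ _ ⟨
        -- Here y^(pq) enters as 1 and is split as y^a times y^(pq - a); the latter cancels against
        -- the expansion of its inverse.
        1# * S (suc b)                            ≈⟨ *-congʳ y^pq≈1 ⟨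
        y ^ (p ℕ.* q) * S (suc b)                 ≡⟨ ≡.cong (λ k → y ^ k * S (suc b)) a+b ⟨
        y ^ (a ℕ.+ suc b) * S (suc b)             ≈⟨ *-congʳ (^-homo-* y a (suc b)) ⟩
        y ^ a * y ^ suc b * S (suc b)             ≈⟨ *-assoc _ _ _ ⟩
        y ^ a * (y ^ suc b * S (suc b))           ≈⟨ *-congˡ (tail-expansion b b<) ⟩
        y ^ a * 1#                                ≈⟨ *-identityʳ _ ⟩
        y ^ a                                     ∎
        where
        S : ℕ → Carrier
        S c = ∑< d (λ j → tailCoeff c j * y ^ j)
        b = ℕ.pred (p ℕ.* q ∸ a)
        b≡ : p ℕ.* q ∸ a ≡ suc b
        b≡ = ≡.sym (ℕ.suc-pred (p ℕ.* q ∸ a) {{ℕ.>-nonZero (ℕ.m<n⇒0<n∸m a<pq)}})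
        a+b : a ℕ.+ suc b ≡ p ℕ.* q
        a+b = ≡.trans (≡.cong (a ℕ.+_) (≡.sym b≡)) (ℕ.m+[n∸m]≡n (ℕ.<⇒≤ a<pq))
        b< : suc b < p ℕ.+ q
        b< = complement-< 1+d+[p+q] a+b (ℕ.≮⇒≥ a≮d)

    block-expansion : ∀ h .{{_ : NonZero h}} z → 0 < p → 0 < q → p ℕ.+ q ℕ.+ d ≡ suc (p ℕ.* q) →
      ¬ z ^ (h ℕ.* p) ≈ 1# → ¬ z ^ (h ℕ.* q) ≈ 1# → z ^ (h ℕ.* (p ℕ.* q)) ≈ 1# →
      ∀ a → a < h ℕ.* (p ℕ.* q) → ∑< (d ℕ.* h) (λ j → blockCoeff h a j * z ^ j) ≈ z ^ a
    block-expansion h z 0<p 0<q d≡ zᵖ≉1 z^q≉1 z^pq≈1 a a<n = begin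
      ∑< (d ℕ.* h) f                                        ≈⟨ ∑<-block d h f ⟩
      ∑< d (λ j → ∑< h (λ i → f (i ℕ.+ j ℕ.* h)))           ≈⟨ ∑<-cong d (λ j _ → block j) ⟩
      ∑< d (λ j → z ^ (a % h) * (coeff (a / h) j * y ^ j))  ≈⟨ *-∑< d (z ^ (a % h)) (λ j → coeff (a / h) j * y ^ j) ⟨
      z ^ (a % h) * ∑< d (λ j → coeff (a / h) j * y ^ j)
        ≈⟨ *-congˡ (expansion y 0<p 0<q d≡ (zᵖ≉1 ∘ trans (sym (^-assocʳ z h p))) (z^q≉1 ∘ trans (sym (^-assocʳ z h q)))
                      (trans (^-assocʳ z h (p ℕ.* q)) z^pq≈1) (a / h)
                      (m<n*o⇒m/o<n (≡.subst (a <_) (ℕ.*-comm h (p ℕ.* q)) a<n))) ⟩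
      z ^ (a % h) * y ^ (a / h)                             ≈⟨ *-congˡ (power (a / h)) ⟩
      z ^ (a % h) * z ^ (a / h ℕ.* h)                       ≈⟨ ^-homo-* z (a % h) (a / h ℕ.* h) ⟨
      z ^ (a % h ℕ.+ a / h ℕ.* h)                           ≡⟨ ≡.cong (z ^_) (m≡m%n+[m/n]*n a h) ⟨
      z ^ a                                                 ∎
      where
      y = z ^ h
      f : ℕ → Carrier
      f j = blockCoeff h a j * z ^ j
      power : ∀ j → y ^ j ≈ z ^ (j ℕ.* h)
      power j = trans (^-assocʳ z h j) (reflexive (≡.cong (z ^_) (ℕ.*-comm h j)))
      rem : ∀ i j → i < h → (i ℕ.+ j ℕ.* h) % h ≡ i
      rem i j i<h = ≡.trans ([m+kn]%n≡m%n i j h) (m<n⇒m%n≡m i<h)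
      quot : ∀ i j → i < h → (i ℕ.+ j ℕ.* h) / h ≡ j
      quot i j i<h = ≡.trans (+-distrib-/-∣ʳ i (n∣m*n j)) (≡.cong₂ ℕ._+_ (m<n⇒m/n≡0 i<h) (m*n/n≡m j h))
      g : ℕ → ℕ → Carrier
      g j i = (if does (i ℕ.≟ a % h) then coeff (a / h) j else 0#) * z ^ (i ℕ.+ j ℕ.* h)
      swap : ∀ a b c → a * (b * c) ≈ b * (a * c)
      swap = solve 3 (λ a b c → a :* (b :* c) := b :* (a :* c)) refl
      block : ∀ j → ∑< h (λ i → f (i ℕ.+ j ℕ.* h)) ≈ z ^ (a % h) * (coeff (a / h) j * y ^ j)
      block j = begin
        ∑< h (λ i → f (i ℕ.+ j ℕ.* h))
          ≈⟨ ∑<-cong h (λ i i<h → reflexive (≡.cong₂ (λ r s → (if does (r ℕ.≟ a % h) then coeff (a / h) s else 0#) * z ^ (i ℕ.+ j ℕ.* h)) (rem i j i<h) (quot i j i<h))) ⟩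
        ∑< h (g j)
          ≈⟨ ∑<-single h (g j) (a % h) (m%n<n a h) (λ i i≢ → trans (*-congʳ (reflexive (≡.cong (λ b → if b then coeff (a / h) j else 0#) (dec-false (i ℕ.≟ a % h) i≢)))) (zeroˡ _)) ⟩
        g j (a % h)
          ≈⟨ *-cong (reflexive (≡.cong (λ b → if b then coeff (a / h) j else 0#) (dec-true (a % h ℕ.≟ a % h) ≡.refl))) (trans (^-homo-* z (a % h) (j ℕ.* h)) (*-congˡ (sym (power j)))) ⟩
        coeff (a / h) j * (z ^ (a % h) * y ^ j)
          ≈⟨ swap _ _ _ ⟩
        z ^ (a % h) * (coeff (a / h) j * y ^ j)
          ∎

-- The two-sided inverse of the Vandermonde matrix

module Inverse {c ℓ : Level} (R : CommutativeRing c ℓ) (noZeroDivisors : NoZeroDivisors R) where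

  open CommutativeRing R hiding (zero)
  open Domain R noZeroDivisors
  open import Algebra.Properties.Semiring.Exp semiring
  open import Algebra.Properties.Semiring.Mult semiring using (×-congʳ) renaming (_×_ to infixr 8 _·_)
  open import Algebra.Properties.Semiring.Sum semiring
  open import Algebra.Properties.Ring ring using (x∙y⁻¹≈ε⇒x≈y; +-cancelʳ; //-rightDividesˡ)
  open import Algebra.Solver.Ring.NaturalCoefficients.Default commutativeSemiring
    using (solve; _:=_; _:+_; _:*_)
  open import Relation.Binary.Reasoning.Setoid setoid

  eval : ∀ {n} → (Fin n → Carrier) → Carrier → Carrier
  eval f x = sum (λ i → f i * x ^ toℕ i)

  eval-suc : ∀ {n} (f : Fin (suc n) → Carrier) x → eval f x ≈ f zero + x * eval (f ∘ suc) x
  eval-suc {n} f x = +-cong (*-identityʳ _) (begin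
    sum (λ i → f (suc i) * (x * x ^ toℕ i))  ≈⟨ sum-cong-≋ {n} (λ i → swap (f (suc i)) x (x ^ toℕ i)) ⟩
    sum (λ i → x * (f (suc i) * x ^ toℕ i))  ≈⟨ *-distribˡ-sum {n} x (λ i → f (suc i) * x ^ toℕ i) ⟨
    x * eval (f ∘ suc) x                     ∎)
    where
    swap : ∀ a b c → a * (b * c) ≈ b * (a * c)
    swap = solve 3 (λ a b c → a :* (b :* c) := b :* (a :* c)) refl

  -- The coefficients of (f(x) - f(y)) / (x - y) as a polynomial in x.
  deflate : ∀ {n} → Carrier → (Fin (suc n) → Carrier) → Fin n → Carrier
  deflate {suc n} y f zero    = eval (f ∘ suc) y
  deflate {suc n} y f (suc i) = deflate y (f ∘ suc) i

  -- The equation f(x) - f(y) = (x - y) g(x) with the negative terms moved across, by induction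
  -- along Horner's scheme.
  eval-deflate : ∀ {n} (f : Fin (suc n) → Carrier) x y →
                 eval f x + y * eval (deflate y f) x ≈ eval f y + x * eval (deflate y f) x
  eval-deflate {zero}  f x y = +-congˡ (trans (zeroʳ y) (sym (zeroʳ x)))
  eval-deflate {suc n} f x y = begin
    eval f x + y * eval (deflate y f) x       ≈⟨ +-cong (eval-suc f x) (*-congˡ (eval-suc (deflate y f) x)) ⟩
    (a + x * A x) + y * (A y + x * g x)       ≈⟨ lemma₁ a x (A x) y (A y) (g x) ⟩
    a + x * (A x + y * g x) + y * A y         ≈⟨ +-congʳ (+-congˡ (*-congˡ (eval-deflate (f ∘ suc) x y))) ⟩
    a + x * (A y + x * g x) + y * A y         ≈⟨ lemma₂ a x y (A y) (g x) ⟩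
    (a + y * A y) + x * (A y + x * g x)       ≈⟨ +-cong (eval-suc f y) (*-congˡ (eval-suc (deflate y f) x)) ⟨
    eval f y + x * eval (deflate y f) x       ∎
    where
    a = f zero
    A = eval (f ∘ suc)
    g = eval (deflate y (f ∘ suc))
    lemma₁ : ∀ a x b y c g → (a + x * b) + y * (c + x * g) ≈ a + x * (b + y * g) + y * c
    lemma₁ = solve 6 (λ a x b y c g → (a :+ x :* b) :+ y :* (c :+ x :* g) := a :+ x :* (b :+ y :* g) :+ y :* c) refl
    lemma₂ : ∀ a x y c g → a + x * (c + x * g) + y * c ≈ (a + y * c) + x * (c + x * g)
    lemma₂ = solve 5 (λ a x y c g → a :+ x :* (c :+ x :* g) :+ y :* c := (a :+ y :* c) :+ x :* (c :+ x :* g)) refl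

  -- The first coefficient of the quotient is the value at y of f without its constant term. When it
  -- vanishes, the constant term is f(y) = 0 and the remaining coefficients again have a root at y.
  deflate-zero : ∀ {n} (f : Fin (suc n) → Carrier) y →
                 (∀ i → deflate y f i ≈ 0#) → eval f y ≈ 0# → ∀ i → f i ≈ 0#
  deflate-zero {n} f y g≈0 fy≈0 zero = begin
    f zero                          ≈⟨ +-identityʳ _ ⟨
    f zero + 0#                     ≈⟨ +-congˡ (trans (*-congˡ (tail≈0 n f g≈0)) (zeroʳ y)) ⟨
    f zero + y * eval (f ∘ suc) y   ≈⟨ eval-suc f y ⟨
    eval f y                        ≈⟨ fy≈0 ⟩
    0#                              ∎
    where
    tail≈0 : ∀ n (f : Fin (suc n) → Carrier) → (∀ i → deflate y f i ≈ 0#) → eval (f ∘ suc) y ≈ 0#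
    tail≈0 zero    f g≈0 = refl
    tail≈0 (suc n) f g≈0 = g≈0 zero
  deflate-zero {suc n} f y g≈0 fy≈0 (suc i) = deflate-zero (f ∘ suc) y (g≈0 ∘ suc) (g≈0 zero) i

  -- A polynomial of degree below n has no n distinct roots unless it is 0. Dividing out one root
  -- leaves the others as roots of the quotient, since f(x) = f(y) = 0 gives x g(x) = y g(x) and x ≉
  -- y cancels.
  eval-injective : ∀ n (f ζ : Fin n → Carrier) → (∀ {i j} → ζ i ≈ ζ j → i ≡ j) →
                   (∀ i → eval f (ζ i) ≈ 0#) → ∀ i → f i ≈ 0#
  eval-injective (suc n) f ζ inj f≈0 = deflate-zero f y (eval-injective n g (ζ ∘ suc) (Fin.suc-injective ∘ inj) g≈0) (f≈0 zero)
    where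
    y = ζ zero
    g = deflate y f
    0≢suc : ∀ i → Fin.suc {n} i ≢ zero
    0≢suc i ()
    g≈0 : ∀ i → eval g (ζ (suc i)) ≈ 0#
    g≈0 i = cancel x y _ (sym (begin
      y * eval g x              ≈⟨ +-identityˡ _ ⟨
      0# + y * eval g x         ≈⟨ +-congʳ (f≈0 (suc i)) ⟨
      eval f x + y * eval g x   ≈⟨ eval-deflate f x y ⟩
      eval f y + x * eval g x   ≈⟨ +-congʳ (f≈0 zero) ⟩
      0# + x * eval g x         ≈⟨ +-identityˡ _ ⟩
      x * eval g x              ∎)) (0≢suc i ∘ inj)
      where x = ζ (suc i)

  δ : ∀ {m} → Fin m → Fin m → Carrier
  δ i j = if does (i Fin.≟ j) then 1# else 0#

  sum-δ : ∀ {m} (k : Fin m) (x : Fin m → Carrier) → sum (λ j → δ j k * x j) ≈ x k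
  sum-δ {suc m} zero x = begin
    1# * x zero + sum {m} (λ j → 0# * x (suc j))
      ≈⟨ +-cong (*-identityˡ _) (trans (sum-cong-≋ {m} λ j → zeroˡ _) (sum-replicate-zero m)) ⟩
    x zero + 0#                                    ≈⟨ +-identityʳ _ ⟩
    x zero                                         ∎
  sum-δ {suc m} (suc k) x = begin
    0# * x zero + sum {m} (λ j → δ j k * x (suc j))  ≈⟨ +-cong (zeroˡ _) (sum-δ k (x ∘ suc)) ⟩
    0# + x (suc k)                                   ≈⟨ +-identityˡ _ ⟩
    x (suc k)                                        ∎

  δ-sym : ∀ {m} (i j : Fin m) → δ i j ≡ δ j i
  δ-sym i j with i Fin.≟ j | j Fin.≟ i
  ... | yes _      | yes _ = ≡.refl
  ... | no  _      | no _  = ≡.refl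
  ... | yes ≡.refl | no h  = contradiction ≡.refl h
  ... | no h       | yes e = contradiction (≡.sym e) h

  module _ {m n : ℕ} (ζ : Fin m → Carrier) (inj : ∀ {i j} → ζ i ≈ ζ j → i ≡ j)
           (ν : Carrier) (ν≈1/n : ν * n · 1# ≈ 1#) (ζⁿ≈1 : ∀ i → ζ i ^ n ≈ 1#)
           (ρ : ℕ → ℕ → Carrier) (expand : ∀ i a → a < n → ∑< m (λ j → ρ a j * ζ i ^ j) ≈ ζ i ^ a)
           where

    V W : Fin m → Fin m → Carrier
    V i j = ζ i ^ toℕ j
    -- ζ i ^ (n ∸ a) stands for ζᵢ⁻ᵃ.
    W j i = ν * ∑< n (λ a → ζ i ^ (n ∸ a) * ρ a (toℕ j))

    -- Once the sums are exchanged, `expand` collects the coefficients into ζₖᵃ, leaving the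
    -- orthogonality sum of ζₖ and ζᵢ.
    VW≈δ : ∀ k i → sum (λ j → V k j * W j i) ≈ δ k i
    VW≈δ k i = begin
      sum (λ j → V k j * W j i)
        ≈⟨ sum-cong-≋ {m} (λ j → trans (swap (V k j) ν _) (*-congˡ (*-∑< n (V k j) (λ a → w a * ρ a (toℕ j))))) ⟩
      sum {m} (λ j → ν * ∑< n (λ a → V k j * (w a * ρ a (toℕ j))))
        ≈⟨ *-distribˡ-sum {m} ν (λ j → ∑< n (λ a → V k j * (w a * ρ a (toℕ j)))) ⟨
      ν * sum {m} (λ j → ∑< n (λ a → V k j * (w a * ρ a (toℕ j))))
        ≈⟨ *-congˡ (∑-comm {m} {n} (λ j a → V k j * (w (toℕ a) * ρ (toℕ a) (toℕ j)))) ⟩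
      ν * ∑< n (λ a → sum {m} (λ j → V k j * (w a * ρ a (toℕ j))))
        ≈⟨ *-congˡ (∑<-cong n term) ⟩
      ν * ∑< n (λ a → ζ k ^ a * ζ i ^ (n ∸ a))
        ≈⟨ final (k Fin.≟ i) ⟩
      δ k i ∎
      where
      w : ℕ → Carrier
      w a = ζ i ^ (n ∸ a)
      swap : ∀ a b c → a * (b * c) ≈ b * (a * c)
      swap = solve 3 (λ a b c → a :* (b :* c) := b :* (a :* c)) refl
      swap′ : ∀ a b c → a * (b * c) ≈ b * (c * a)
      swap′ = solve 3 (λ a b c → a :* (b :* c) := b :* (c :* a)) refl
      term : ∀ a → a < n → sum {m} (λ j → V k j * (w a * ρ a (toℕ j))) ≈ ζ k ^ a * w a
      term a a<n = begin
        sum {m} (λ j → V k j * (w a * ρ a (toℕ j)))  ≈⟨ sum-cong-≋ {m} (λ j → swap′ (V k j) (w a) (ρ a (toℕ j))) ⟩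
        sum {m} (λ j → w a * (ρ a (toℕ j) * V k j))  ≈⟨ *-distribˡ-sum {m} (w a) (λ j → ρ a (toℕ j) * V k j) ⟨
        w a * ∑< m (λ j → ρ a j * ζ k ^ j)           ≈⟨ *-congˡ (expand k a a<n) ⟩
        w a * ζ k ^ a                                ≈⟨ *-comm _ _ ⟩
        ζ k ^ a * w a                                ∎
      final : (k≟i : Dec (k ≡ i)) → ν * ∑< n (λ a → ζ k ^ a * ζ i ^ (n ∸ a)) ≈ (if does k≟i then 1# else 0#)
      final (yes ≡.refl) = trans (*-congˡ (trans (∑<-diagonal n (ζ k) (ζ k) refl) (×-congʳ n (ζⁿ≈1 k)))) ν≈1/n
      final (no  k≢i)    = trans (*-congˡ (∑<-orthogonal n (ζ k) (ζ i) (trans (ζⁿ≈1 k) (sym (ζⁿ≈1 i))) (k≢i ∘ inj))) (zeroʳ ν)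

    -- From VW = 1 follows V (WV) = V. Column k of WV - 1 is thus a polynomial of degree below m
    -- that vanishes at the m distinct points ζᵢ.
    WV≈δ : ∀ j k → sum (λ i → W j i * V i k) ≈ δ j k
    WV≈δ j k = x∙y⁻¹≈ε⇒x≈y _ _ (eval-injective m f ζ inj f≈0 j)
      where
      WV : Fin m → Carrier
      WV j = sum (λ i → W j i * V i k)
      f : Fin m → Carrier
      f j = WV j - δ j k
      V[WV]≈V : ∀ i → sum (λ j → WV j * V i j) ≈ V i k
      V[WV]≈V i = begin
        sum (λ j → WV j * V i j)
          ≈⟨ sum-cong-≋ {m} (λ j → *-distribʳ-sum {m} (V i j) (λ l → W j l * V l k)) ⟩
        sum (λ j → sum (λ l → W j l * V l k * V i j))
          ≈⟨ ∑-comm {m} {m} (λ j l → W j l * V l k * V i j) ⟩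
        sum (λ l → sum (λ j → W j l * V l k * V i j))
          ≈⟨ sum-cong-≋ {m} (λ l → sum-cong-≋ {m} (λ j → swap (W j l) (V l k) (V i j))) ⟩
        sum (λ l → sum (λ j → V i j * W j l * V l k))
          ≈⟨ sum-cong-≋ {m} (λ l → *-distribʳ-sum {m} (V l k) (λ j → V i j * W j l)) ⟨
        sum (λ l → sum (λ j → V i j * W j l) * V l k)
          ≈⟨ sum-cong-≋ {m} (λ l → *-congʳ (trans (VW≈δ i l) (reflexive (δ-sym i l)))) ⟩
        sum (λ l → δ l i * V l k)
          ≈⟨ sum-δ i (λ l → V l k) ⟩
        V i k ∎
        where
        swap : ∀ a b c → a * b * c ≈ c * a * b
        swap = solve 3 (λ a b c → a :* b :* c := c :* a :* b) refl
      f≈0 : ∀ i → eval f (ζ i) ≈ 0#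
      f≈0 i = +-cancelʳ (V i k) _ _ (begin
        eval f (ζ i) + V i k                              ≈⟨ +-congˡ (sum-δ k (V i)) ⟨
        eval f (ζ i) + sum (λ j → δ j k * V i j)          ≈⟨ ∑-distrib-+ {m} (λ j → f j * V i j) (λ j → δ j k * V i j) ⟨
        sum (λ j → f j * V i j + δ j k * V i j)
          ≈⟨ sum-cong-≋ {m} (λ j → trans (sym (distribʳ (V i j) (f j) (δ j k))) (*-congʳ (//-rightDividesˡ (δ j k) (WV j)))) ⟩
        sum (λ j → WV j * V i j)                          ≈⟨ V[WV]≈V i ⟩
        V i k                                             ≈⟨ +-identityˡ _ ⟨
        0# + V i k                                        ∎)

-- The gaps of ⟨p, q⟩ and Euler's totient

open import Data.Nat.Base using (_+_; _*_; _^_)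

private module ℕS = Sums ℕ.+-*-commutativeSemiring
open ℕS using (∑<)

inverse-mod : ∀ {p q} → 1 < p → Coprime q p → ∃[ x ] ∃[ y ] x * q ≡ 1 + y * p
inverse-mod {p} {q} 1<p cop with coprime-Bézout cop
... | Bézout.+- x y eq = x , y , ≡.sym eq
... | Bézout.-+ x y eq = square (x * q) ≡.refl eq
  where
  regroup : ∀ x q → x * (x * q) * q ≡ (x * q) * (x * q)
  regroup = solve-∀
  expand : ∀ w → suc w * suc w ≡ 1 + w * (1 + suc w)
  expand = solve-∀
  square : ∀ w → x * q ≡ w → 1 + x * q ≡ y * p → ∃[ x ] ∃[ y ] x * q ≡ 1 + y * p
  square zero    xq≡0 1+xq≡yp = contradiction (ℕ.m*n≡1⇒n≡1 y p (≡.trans (≡.sym 1+xq≡yp) (≡.cong suc xq≡0))) (ℕ.>⇒≢ 1<p)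
  -- In this case x q is -1 modulo p, so x (x q) q is its square, 1.
  square (suc w) xq≡w 1+xq≡yp = x * (x * q) , w * y , (begin
    x * (x * q) * q        ≡⟨ regroup x q ⟩
    (x * q) * (x * q)      ≡⟨ ≡.cong (λ z → z * z) xq≡w ⟩
    suc w * suc w          ≡⟨ expand w ⟩
    1 + w * (1 + suc w)    ≡⟨ ≡.cong (λ z → 1 + w * z) (≡.trans (≡.cong suc (≡.sym xq≡w)) 1+xq≡yp) ⟩
    1 + w * (y * p)        ≡⟨ ≡.cong suc (≡.sym (ℕ.*-assoc w y p)) ⟩
    1 + w * y * p          ∎)
    where open ≡.≡-Reasoning

≡%∧<⇒+≤ : ∀ {x y} p .{{_ : NonZero p}} → x % p ≡ y % p → x < y → p + x ≤ y
≡%∧<⇒+≤ {x} {y} p x≡y x<y = begin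
  p + x                          ≡⟨ ≡.cong (p +_) (m≡m%n+[m/n]*n x p) ⟩
  p + (x % p + x / p * p)        ≡⟨ regroup p (x % p) (x / p * p) ⟩
  x % p + (p + x / p * p)        ≤⟨ ℕ.+-monoʳ-≤ (x % p) (ℕ.*-monoˡ-≤ p x/p<y/p) ⟩
  x % p + y / p * p              ≡⟨ ≡.cong (_+ y / p * p) x≡y ⟩
  y % p + y / p * p              ≡⟨ m≡m%n+[m/n]*n y p ⟨
  y                              ∎
  where
  open ℕ.≤-Reasoning
  regroup : ∀ a b c → a + (b + c) ≡ b + (a + c)
  regroup = solve-∀
  x/p<y/p : x / p < y / p
  x/p<y/p = ℕ.≰⇒> λ y/p≤x/p → ℕ.<⇒≱ x<y (begin
    y                    ≡⟨ m≡m%n+[m/n]*n y p ⟩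
    y % p + y / p * p    ≤⟨ ℕ.+-monoʳ-≤ (y % p) (ℕ.*-monoˡ-≤ p y/p≤x/p) ⟩
    y % p + x / p * p    ≡⟨ ≡.cong (_+ x / p * p) (≡.sym x≡y) ⟩
    x % p + x / p * p    ≡⟨ m≡m%n+[m/n]*n x p ⟨
    x                    ∎)

-- The gaps of the numerical semigroup ⟨p, q⟩: apery k is its least element congruent to k mod p.
gaps : ∀ {p q} x y → x * suc q ≡ 1 + y * suc p → Gaps (suc p) (suc q) (p * q)
gaps {p′} {q′} q⁻¹ y q⁻¹*q = record
  { gap = gap
  ; bounded = λ k d≤k → dec-false (k ℕ.<? apery k) λ k<a → ℕ.<⇒≱ (k<d k k<a) d≤k
  ; initial = initial
  ; multiple = λ k p+k<pq q∣p+k →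
      let a≡p+k = ≡.trans (≡.sym (apery-+ k)) (apery-multiple p+k<pq q∣p+k) in
      dec-true (k ℕ.<? apery k) (≡.subst (k <_) (≡.sym a≡p+k) (ℕ.m<n+m k z<s)) ,
      dec-false (p + k ℕ.<? apery (p + k)) (ℕ.<-irrefl (≡.sym (apery-multiple p+k<pq q∣p+k)))
  ; periodic = periodic
  }
  where
  p = suc p′
  q = suc q′
  apery : ℕ → ℕ
  apery k = q * (k * q⁻¹ % p)
  -- The semigroup elements of a class are the least one plus multiples of p, so a gap is a number
  -- below the Apéry element of its class.
  gap : ℕ → Bool
  gap k = does (k ℕ.<? apery k)

  k*q⁻¹*q%p : ∀ k → k * (q⁻¹ * q) % p ≡ k % p
  k*q⁻¹*q%p k = begin
    k * (q⁻¹ * q) % p     ≡⟨ ≡.cong (λ z → k * z % p) q⁻¹*q ⟩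
    k * (1 + y * p) % p   ≡⟨ ≡.cong (_% p) (expand k y p) ⟩
    (k + k * y * p) % p   ≡⟨ [m+kn]%n≡m%n k (k * y) p ⟩
    k % p                 ∎
    where
    open ≡.≡-Reasoning
    expand : ∀ k y p → k * (1 + y * p) ≡ k + k * y * p
    expand = solve-∀

  apery-% : ∀ k → apery k % p ≡ k % p
  apery-% k = begin
    q * (k * q⁻¹ % p) % p                ≡⟨ %-distribˡ-* q (k * q⁻¹ % p) p ⟩
    (q % p) * (k * q⁻¹ % p % p) % p      ≡⟨ ≡.cong (λ z → (q % p) * z % p) (m%n%n≡m%n (k * q⁻¹) p) ⟩
    (q % p) * (k * q⁻¹ % p) % p          ≡⟨ %-distribˡ-* q (k * q⁻¹) p ⟨
    q * (k * q⁻¹) % p                    ≡⟨ ≡.cong (_% p) (regroup q k q⁻¹) ⟩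
    k * (q⁻¹ * q) % p                    ≡⟨ k*q⁻¹*q%p k ⟩
    k % p                                ∎
    where
    open ≡.≡-Reasoning
    regroup : ∀ q k i → q * (k * i) ≡ k * (i * q)
    regroup = solve-∀

  apery-+ : ∀ k → apery (p + k) ≡ apery k
  apery-+ k = ≡.cong (q *_) (begin
    (p + k) * q⁻¹ % p        ≡⟨ ≡.cong (_% p) (expand p k q⁻¹) ⟩
    (k * q⁻¹ + q⁻¹ * p) % p  ≡⟨ [m+kn]%n≡m%n (k * q⁻¹) q⁻¹ p ⟩
    k * q⁻¹ % p              ∎)
    where
    open ≡.≡-Reasoning
    expand : ∀ p k i → (p + k) * i ≡ k * i + i * p
    expand = solve-∀

  apery-multiple : ∀ {k} → k < p * q → q ∣ k → apery k ≡ k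
  apery-multiple {k} k<pq (divides-refl j) = begin
    q * (j * q * q⁻¹ % p)     ≡⟨ ≡.cong (λ z → q * (z % p)) (regroup j q q⁻¹) ⟩
    q * (j * (q⁻¹ * q) % p)   ≡⟨ ≡.cong (q *_) (k*q⁻¹*q%p j) ⟩
    q * (j % p)               ≡⟨ ≡.cong (q *_) (m<n⇒m%n≡m (ℕ.*-cancelʳ-< q j p k<pq)) ⟩
    q * j                     ≡⟨ ℕ.*-comm q j ⟩
    j * q                     ∎
    where
    open ≡.≡-Reasoning
    regroup : ∀ j q i → j * q * i ≡ j * (i * q)
    regroup = solve-∀

  next : ∀ {k} → k < apery k → p + k ≤ apery k
  next {k} = ≡%∧<⇒+≤ p (≡.sym (apery-% k))

  apery≢ : ∀ {k} → ¬ q ∣ k → apery k ≢ k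
  apery≢ {k} q∤k eq = q∤k (≡.subst (q ∣_) eq (m∣m*n (k * q⁻¹ % p)))

  -- A gap lies at least p below an Apéry element, the largest of which is (p - 1) q. This is the
  -- Frobenius bound pq - p - q.
  k<d : ∀ k → k < apery k → k < p′ * q′
  k<d k k<a = ℕ.+-cancelˡ-≤ p′ _ _ (begin
    p′ + suc k       ≡⟨ ℕ.+-suc p′ k ⟩
    p + k            ≤⟨ next k<a ⟩
    apery k          ≤⟨ ℕ.*-monoʳ-≤ q (ℕ.≤-pred (m%n<n (k * q⁻¹) p)) ⟩
    q * p′           ≡⟨ ≡.cong (p′ +_) (ℕ.*-comm q′ p′) ⟩
    p′ + p′ * q′     ∎)
    where open ℕ.≤-Reasoning

  -- A number below p is the least of its class, so its Apéry element is at least k, with equality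
  -- exactly when q ∣ k.
  initial : ∀ k → k < p → gap k ≡ not (does (q ∣? k))
  initial k k<p = case (q ∣? k)
    where
    case : Dec (q ∣ k) → gap k ≡ not (does (q ∣? k))
    case (yes q∣k) = ≡.trans
      (dec-false (k ℕ.<? apery k) (ℕ.<-irrefl (≡.sym (apery-multiple (ℕ.<-≤-trans k<p (ℕ.m≤m*n p q)) q∣k))))
      (≡.cong not (≡.sym (dec-true (q ∣? k) q∣k)))
    case (no  q∤k) = ≡.trans
      (dec-true (k ℕ.<? apery k) (ℕ.≤∧≢⇒< (ℕ.≮⇒≥ λ a<k → ℕ.<⇒≱ k<p (ℕ.m+n≤o⇒m≤o p (≡%∧<⇒+≤ p (apery-% k) a<k))) (≡.≢-sym (apery≢ q∤k))))
      (≡.cong not (≡.sym (dec-false (q ∣? k) q∤k)))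

  -- The Apéry element is the same for k and p + k. If k is a gap, then p + k does not exceed it,
  -- and equality would make p + k a multiple of q.
  periodic : ∀ k → p + k < p * q → ¬ q ∣ p + k → gap (p + k) ≡ gap k
  periodic k _ q∤p+k = case (k ℕ.<? apery k)
    where
    case : Dec (k < apery k) → gap (p + k) ≡ gap k
    case (yes k<a) = ≡.trans
      (dec-true (p + k ℕ.<? apery (p + k)) (ℕ.≤∧≢⇒< (≡.subst (p + k ≤_) (≡.sym (apery-+ k)) (next k<a)) (≡.≢-sym (apery≢ q∤p+k))))
      (≡.sym (dec-true (k ℕ.<? apery k) k<a))
    case (no  k≮a) = ≡.trans
      (dec-false (p + k ℕ.<? apery (p + k)) λ p+k<a → k≮a (ℕ.≤-<-trans (ℕ.m≤n+m k p) (≡.subst (p + k <_) (apery-+ k) p+k<a)))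
      (≡.sym (dec-false (k ℕ.<? apery k) k≮a))

-- The totient by inclusion and exclusion, and bounds on totient and radical

length-filter : ∀ {P : Pred ℕ 0ℓ} (P? : Decidable P) f n →
                length (filter P? (applyUpTo f n)) ≡ ∑< n (λ k → ℕS.⟦ does (P? (f k)) ⟧)
length-filter P? f zero    = ≡.refl
length-filter P? f (suc n) with does (P? (f 0))
... | true  = ≡.cong suc (length-filter P? (f ∘ suc) n)
... | false = length-filter P? (f ∘ suc) n

φ-∑ : ∀ n → φ n ≡ ∑< n (λ k → ℕS.⟦ does (coprime? (suc k) n) ⟧)
φ-∑ n = ≡.trans (≡.cong (length ∘ filter (λ k → coprime? k n)) (map-upTo suc n)) (length-filter (λ k → coprime? k n) suc n)

coprime-*ʳ : ∀ {k a b} → Coprime k a → Coprime k b → Coprime k (a * b)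
coprime-*ʳ k⊥a k⊥b (d∣k , d∣ab) = k⊥b (d∣k , coprime-divisor (λ (e∣d , e∣a) → k⊥a (∣-trans e∣d d∣k , e∣a)) d∣ab)

coprime-^ʳ : ∀ {k a} r → Coprime k a → Coprime k (a ^ r)
coprime-^ʳ zero    k⊥a (_ , d∣1) = ∣1⇒≡1 d∣1
coprime-^ʳ (suc r) k⊥a = coprime-*ʳ k⊥a (coprime-^ʳ r k⊥a)

prime∤⇒coprime : ∀ {p k} → Prime p → ¬ p ∣ k → Coprime k p
prime∤⇒coprime pp p∤k (d∣k , d∣p) with prime⇒irreducible pp d∣p
... | inj₁ d≡1    = d≡1
... | inj₂ ≡.refl = contradiction d∣k p∤k

distinctPrimes⇒coprime : ∀ {p q} → Prime p → Prime q → p ≢ q → Coprime q p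
distinctPrimes⇒coprime {p} {q} pp pq p≢q = prime∤⇒coprime pp λ p∣q → p∣q⇒⊥ (prime⇒irreducible pq p∣q)
  where
  p∣q⇒⊥ : ¬ (p ≡ 1 ⊎ p ≡ q)
  p∣q⇒⊥ (inj₁ ≡.refl) = ¬prime[1] pp
  p∣q⇒⊥ (inj₂ p≡q)    = p≢q p≡q

∑<-multiplicity : ∀ b c → 0 < c → ∑< (b * c) (λ k → ℕS.⟦ does (c ∣? suc k) ⟧) ≡ b
∑<-multiplicity b c 0<c = begin
  ∑< (b * c) (λ k → ℕS.⟦ does (c ∣? suc k) ⟧)
    ≡⟨ ℕS.∑<-rotate (b * c) δ (≡.trans (≡.cong ℕS.⟦_⟧ (dec-true (c ∣? 0) (c ∣0))) (≡.sym (≡.cong ℕS.⟦_⟧ (dec-true (c ∣? (b * c)) (n∣m*n b))))) ⟩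
  ∑< (b * c) δ                                  ≡⟨ ℕS.∑<-cong (b * c) (λ k _ → ≡.sym (ℕ.*-identityʳ (δ k))) ⟩
  ∑< (b * c) (λ k → δ k * 1)                    ≡⟨ ℕS.∑<-multiples b c (λ _ → 1) 0<c ⟩
  ∑< b (λ _ → 1)                                ≡⟨ ones b ⟩
  b                                             ∎
  where
  open ≡.≡-Reasoning
  δ : ℕ → ℕ
  δ k = ℕS.⟦ does (c ∣? k) ⟧
  ones : ∀ b → ∑< b (λ _ → 1) ≡ b
  ones zero    = ≡.refl
  ones (suc b) = ≡.cong suc (ones b)

module _ {p q : ℕ} (pp : Prime p) (pq : Prime q) (p≢q : p ≢ q) (r l : ℕ) where

  private
    h = p ^ r * q ^ l
    n = p ^ suc r * q ^ suc l
    0<p = ℕ.>-nonZero⁻¹ p {{prime⇒nonZero pp}}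
    0<q = ℕ.>-nonZero⁻¹ q {{prime⇒nonZero pq}}
    δ : ℕ → ℕ → ℕ
    δ c k = ℕS.⟦ does (c ∣? suc k) ⟧

  n≡h*pq : n ≡ h * (p * q)
  n≡h*pq = regroup p q (p ^ r) (q ^ l)
    where
    regroup : ∀ p q a b → p * a * (q * b) ≡ a * b * (p * q)
    regroup = solve-∀

  pq∣ : ∀ {k} → p ∣ k → q ∣ k → p * q ∣ k
  pq∣ p∣k (divides-refl j) = ≡.subst (p * q ∣_) (ℕ.*-comm q j) (≡.subst (_∣ q * j) (ℕ.*-comm q p) (*-monoʳ-∣ q
    (coprime-divisor (Coprime.sym (distinctPrimes⇒coprime pp pq p≢q)) (≡.subst (p ∣_) (ℕ.*-comm j q) p∣k))))

  -- A number is coprime to n unless p or q divides it; having both as divisors means having pq as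
  -- one.
  inclusionExclusion : ∀ k → ℕS.⟦ does (coprime? (suc k) n) ⟧ + (δ p k + δ q k) ≡ 1 + δ (p * q) k
  inclusionExclusion k with p ∣? suc k | q ∣? suc k
  ... | yes p∣k | yes q∣k
    rewrite dec-false (coprime? (suc k) n) (λ k⊥n → ¬prime[1] (≡.subst Prime (k⊥n (p∣k , ∣m⇒∣m*n (q ^ suc l) (m∣m*n (p ^ r)))) pp))
          | dec-true (p * q ∣? suc k) (pq∣ p∣k q∣k) = ≡.refl
  ... | yes p∣k | no q∤k
    rewrite dec-false (coprime? (suc k) n) (λ k⊥n → ¬prime[1] (≡.subst Prime (k⊥n (p∣k , ∣m⇒∣m*n (q ^ suc l) (m∣m*n (p ^ r)))) pp))
          | dec-false (p * q ∣? suc k) (λ h → q∤k (∣-trans (n∣m*n p) h)) = ≡.refl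
  ... | no p∤k | yes q∣k
    rewrite dec-false (coprime? (suc k) n) (λ k⊥n → ¬prime[1] (≡.subst Prime (k⊥n (q∣k , ∣n⇒∣m*n (p ^ suc r) (m∣m*n (q ^ l)))) pq))
          | dec-false (p * q ∣? suc k) (λ h → p∤k (∣-trans (m∣m*n q) h)) = ≡.refl
  ... | no p∤k | no q∤k
    rewrite dec-true (coprime? (suc k) n) (coprime-*ʳ (coprime-^ʳ (suc r) (prime∤⇒coprime pp p∤k)) (coprime-^ʳ (suc l) (prime∤⇒coprime pq q∤k)))
          | dec-false (p * q ∣? suc k) (λ h → p∤k (∣-trans (m∣m*n q) h)) = ≡.refl

  -- Summed up to n = h p q, `inclusionExclusion` counts h q multiples of p, h p of q and h of pq.
  φ-count : φ n + (h * q + h * p) ≡ n + h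
  φ-count = begin
    φ n + (h * q + h * p)
      ≡⟨ ≡.cong₂ _+_ (φ-∑ n) (≡.sym (≡.cong₂ _+_ (∑δ (h * q) p 0<p n≡hqp) (∑δ (h * p) q 0<q n≡hpq))) ⟩
    ∑< n C + (∑< n (δ p) + ∑< n (δ q))          ≡⟨ ≡.cong (∑< n C +_) (ℕS.∑<-+ n (δ p) (δ q)) ⟨
    ∑< n C + ∑< n (λ k → δ p k + δ q k)         ≡⟨ ℕS.∑<-+ n C (λ k → δ p k + δ q k) ⟨
    ∑< n (λ k → C k + (δ p k + δ q k))          ≡⟨ ℕS.∑<-cong n (λ k _ → inclusionExclusion k) ⟩
    ∑< n (λ k → 1 + δ (p * q) k)                ≡⟨ ℕS.∑<-+ n (λ _ → 1) (δ (p * q)) ⟩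
    ∑< n (λ _ → 1) + ∑< n (δ (p * q))           ≡⟨ ≡.cong₂ _+_ ∑1 (∑δ h (p * q) (ℕ.*-mono-< 0<p 0<q) n≡h*pq) ⟩
    n + h                                       ∎
    where
    open ≡.≡-Reasoning
    C : ℕ → ℕ
    C k = ℕS.⟦ does (coprime? (suc k) n) ⟧
    n≡hqp : n ≡ h * q * p
    n≡hqp = ≡.trans n≡h*pq (≡.trans (≡.cong (h *_) (ℕ.*-comm p q)) (≡.sym (ℕ.*-assoc h q p)))
    n≡hpq : n ≡ h * p * q
    n≡hpq = ≡.trans n≡h*pq (≡.sym (ℕ.*-assoc h p q))
    ∑δ : ∀ b c → 0 < c → n ≡ b * c → ∑< n (δ c) ≡ b
    ∑δ b c 0<c n≡bc = ≡.trans (≡.cong (λ n → ∑< n (δ c)) n≡bc) (∑<-multiplicity b c 0<c)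
    ∑1 : ∑< n (λ _ → 1) ≡ n
    ∑1 = ≡.trans (ℕS.∑<-cong n (λ k _ → ≡.cong ℕS.⟦_⟧ (≡.sym (dec-true (1 ∣? suc k) (1∣ suc k)))))
                 (∑δ n 1 (s≤s z≤n) (≡.sym (ℕ.*-identityʳ n)))

φ-primePowers : ∀ {p q} → Prime (suc p) → Prime (suc q) → suc p ≢ suc q → ∀ r l →
                φ (suc p ^ suc r * suc q ^ suc l) ≡ p * q * (suc p ^ r * suc q ^ l)
φ-primePowers {p} {q} pp pq p≢q r l = ℕ.+-cancelʳ-≡ (h * suc q + h * suc p) _ _
  (≡.trans (φ-count pp pq p≢q r l) (≡.trans (≡.cong (_+ h) (n≡h*pq pp pq p≢q r l)) (expand p q h)))
  where
  h = suc p ^ r * suc q ^ l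
  expand : ∀ p q h → h * (suc p * suc q) + h ≡ p * q * h + (h * suc q + h * suc p)
  expand = solve-∀

-- Both 1 and n - 1 are coprime to n, and they differ once n ≥ 3. Since C counts from `suc k`, they
-- are the indices 0 and `suc t`.
2≤φ : ∀ n → 3 ≤ n → 2 ≤ φ n
2≤φ n@(suc (suc (suc t))) (s≤s (s≤s (s≤s _))) = ≡.subst (2 ≤_) (≡.sym (≡.trans (φ-∑ n) (≡.trans (ℕS.∑<-last (suc (suc t)) C)
  (≡.cong (_+ C (suc (suc t))) (ℕS.∑<-last (suc t) C))))) (begin
    2                                                   ≡⟨ ≡.cong₂ _+_ C₀≡1 Cₜ≡1 ⟨
    C 0 + C (suc t)                                     ≤⟨ ℕ.+-monoˡ-≤ (C (suc t)) (ℕ.m≤m+n (C 0) (∑< t (C ∘ suc))) ⟩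
    ∑< (suc t) C + C (suc t)                            ≤⟨ ℕ.m≤m+n _ (C (suc (suc t))) ⟩
    ∑< (suc t) C + C (suc t) + C (suc (suc t))          ∎)
  where
  open ℕ.≤-Reasoning
  C : ℕ → ℕ
  C k = ℕS.⟦ does (coprime? (suc k) n) ⟧
  C₀≡1 : C 0 ≡ 1
  C₀≡1 = ≡.cong ℕS.⟦_⟧ (dec-true (coprime? 1 n) (Coprime.1-coprimeTo n))
  Cₜ≡1 : C (suc t) ≡ 1
  Cₜ≡1 = ≡.cong ℕS.⟦_⟧ (dec-true (coprime? (suc (suc t)) n) λ {d} (d∣n-1 , d∣n) →
    ∣1⇒≡1 (∣m+n∣m⇒∣n (≡.subst (d ∣_) (ℕ.+-comm 1 (suc (suc t))) d∣n) d∣n-1))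

prime≤rad : ∀ {p} n → 0 < n → Prime p → p ∣ n → p ≤ rad n
prime≤rad {p} n 0<n pp p∣n = ∈⇒≤product
  (All.map (λ (pr , _) → prime⇒nonZero pr) (all-filter P? (upTo (suc n))))
  (∈-filter⁺ P? (∈-upTo⁺ (s≤s (∣⇒≤ {{ℕ.>-nonZero 0<n}} p∣n))) (pp , p∣n))
  where
  P? : Decidable (λ p → Prime p × p ∣ n)
  P? p = prime? p ×-dec p ∣? n

-- ℝ and ℂ as commutative rings without zero divisors

open ℚ-Aux
open Cauchy-Aux

-- `x ≈ʳ y` unfolds to `Null` of the difference of the sequences. The ring laws thus reduce to
-- closure properties of null sequences and pointwise identities in ℚ.
Null : (ℕ → ℚ) → Set
Null s = ∀ ε → 0ℚ ℚ.< ε → ∃[ N ] (∀ n → N ≤ n → ℚ.∣ s n ∣ ℚ.≤ ε)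

Null-resp : ∀ {s t} → (∀ n → s n ≡ t n) → Null s → Null t
Null-resp s≡t null ε 0<ε = let (N , h) = null ε 0<ε in
  N , λ n N≤n → ≡.subst (λ z → ℚ.∣ z ∣ ℚ.≤ ε) (s≡t n) (h n N≤n)

Null-0 : ∀ {s} → (∀ n → s n ≡ 0ℚ) → Null s
Null-0 s≡0 ε 0<ε = 0 , λ n _ → ≡.subst (λ z → ℚ.∣ z ∣ ℚ.≤ ε) (≡.sym (s≡0 n)) (ℚ.<⇒≤ 0<ε)

Null-+ : ∀ {s t} → Null s → Null t → Null (λ n → s n ℚ.+ t n)
Null-+ {s} {t} hs ht ε 0<ε = let (M , a) = hs (½ ℚ.* ε) (0<½* 0<ε); (N , b) = ht (½ ℚ.* ε) (0<½* 0<ε) in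
  M ℕ.⊔ N , λ n ≤n → ℚ.≤-trans (ℚ.∣p+q∣≤∣p∣+∣q∣ (s n) (t n))
    (≡.subst (ℚ.∣ s n ∣ ℚ.+ ℚ.∣ t n ∣ ℚ.≤_) (½+½ ε)
      (ℚ.+-mono-≤ (a n (ℕ.m⊔n≤o⇒m≤o M N ≤n)) (b n (ℕ.m⊔n≤o⇒n≤o M N ≤n))))

Null-neg : ∀ {s} → Null s → Null (λ n → ℚ.- s n)
Null-neg {s} hs ε 0<ε = let (N , h) = hs ε 0<ε in
  N , λ n N≤n → ≡.subst (ℚ._≤ ε) (≡.sym (ℚ.∣-p∣≡∣p∣ (s n))) (h n N≤n)

Null-* : ∀ x {s} → Null s → Null (λ n → seq x n ℚ.* s n)
Null-* x {s} hs ε 0<ε =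
  let (M , B , 0<B , hx) = bounded x
      (κ , Bκ≡1 , 0<κε)  = ratio B ε 0<B 0<ε
      (N , h)            = hs (κ ℚ.* ε) 0<κε
  in M ℕ.⊔ N , λ n ≤n → ≡.subst₂ ℚ._≤_ (≡.sym (ℚ.∣p*q∣≡∣p∣*∣q∣ (seq x n) (s n)))
       (≡.trans (≡.sym (ℚ.*-assoc B κ ε)) (≡.trans (≡.cong (ℚ._* ε) Bκ≡1) (ℚ.*-identityˡ ε)))
       (*-mono-≤-nonNeg (ℚ.0≤∣p∣ (s n)) (ℚ.<⇒≤ 0<B) (hx n (ℕ.m⊔n≤o⇒m≤o M N ≤n)) (h n (ℕ.m⊔n≤o⇒n≤o M N ≤n)))

pointwise : ∀ {x y} → (∀ n → seq x n ≡ seq y n) → x ≈ʳ y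
pointwise {x} {y} x≡y = Null-0 (λ n → ≡.trans (≡.cong (ℚ._- seq y n) (x≡y n)) (ℚ.+-inverseʳ (seq y n)))

ℝ-isCommutativeRing : IsCommutativeRing _≈ʳ_ _+ʳ_ _*ʳ_ -ʳ_ (fromℕ 0) (fromℕ 1)
ℝ-isCommutativeRing = record
  { isRing = record
    { +-isAbelianGroup = record
      { isGroup = record
        { isMonoid = record
          { isSemigroup = record
            { isMagma = record
              { isEquivalence = record
                { refl  = λ {x} → pointwise {x} {x} (λ _ → ≡.refl)
                ; sym   = λ {x} {y} h → Null-resp (λ n → solve 2 (λ a b → :- (a :- b) := b :- a) ≡.refl (seq x n) (seq y n)) (Null-neg h)
                ; trans = λ {x} {y} {z} h k → Null-resp (λ n → solve 3 (λ a b c → (a :- b) :+ (b :- c) := a :- c) ≡.refl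
                                                (seq x n) (seq y n) (seq z n)) (Null-+ h k)
                }
              ; ∙-cong = λ {x} {y} {u} {v} h k → Null-resp (λ n → ≡.sym (+-- (seq x n) (seq u n) (seq y n) (seq v n))) (Null-+ h k)
              }
            ; assoc = λ x y z → pointwise {(x +ʳ y) +ʳ z} {x +ʳ (y +ʳ z)} (λ n → ℚ.+-assoc (seq x n) (seq y n) (seq z n))
            }
          ; identity = (λ x → pointwise {fromℕ 0 +ʳ x} {x} (λ n → ℚ.+-identityˡ (seq x n)))
                     , (λ x → pointwise {x +ʳ fromℕ 0} {x} (λ n → ℚ.+-identityʳ (seq x n)))
          }
        ; inverse = (λ x → pointwise { -ʳ x +ʳ x} {fromℕ 0} (λ n → ℚ.+-inverseˡ (seq x n)))
                  , (λ x → pointwise {x +ʳ -ʳ x} {fromℕ 0} (λ n → ℚ.+-inverseʳ (seq x n)))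
        ; ⁻¹-cong = λ {x} {y} h → Null-resp (λ n → solve 2 (λ a b → :- (a :- b) := :- a :- :- b) ≡.refl (seq x n) (seq y n)) (Null-neg h)
        }
      ; comm = λ x y → pointwise {x +ʳ y} {y +ʳ x} (λ n → ℚ.+-comm (seq x n) (seq y n))
      }
    ; *-cong = λ {x} {y} {u} {v} h k → Null-resp
        (λ n → solve 4 (λ x y u v → x :* (u :- v) :+ v :* (x :- y) := x :* u :- y :* v) ≡.refl (seq x n) (seq y n) (seq u n) (seq v n))
        (Null-+ (Null-* x k) (Null-* v h))
    ; *-assoc = λ x y z → pointwise {(x *ʳ y) *ʳ z} {x *ʳ (y *ʳ z)} (λ n → ℚ.*-assoc (seq x n) (seq y n) (seq z n))
    ; *-identity = (λ x → pointwise {fromℕ 1 *ʳ x} {x} (λ n → ℚ.*-identityˡ (seq x n)))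
                 , (λ x → pointwise {x *ʳ fromℕ 1} {x} (λ n → ℚ.*-identityʳ (seq x n)))
    ; distrib = (λ x y z → pointwise {x *ʳ (y +ʳ z)} {x *ʳ y +ʳ x *ʳ z} (λ n → ℚ.*-distribˡ-+ (seq x n) (seq y n) (seq z n)))
              , (λ x y z → pointwise {(y +ʳ z) *ʳ x} {y *ʳ x +ʳ z *ʳ x} (λ n → ℚ.*-distribʳ-+ (seq x n) (seq y n) (seq z n)))
    }
  ; *-comm = λ x y → pointwise {x *ʳ y} {y *ʳ x} (λ n → ℚ.*-comm (seq x n) (seq y n))
  }
  where open +-*-Solver

ℝ-commutativeRing : CommutativeRing 0ℓ 0ℓ
ℝ-commutativeRing = record { isCommutativeRing = ℝ-isCommutativeRing }

module ℝR = CommutativeRing ℝ-commutativeRing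

infix 8 -ᶜ_

-ᶜ_ : ℂ → ℂ
-ᶜ z = (-ʳ re z) +i (-ʳ im z)

pointwiseᶜ : ∀ {z w} → (∀ n → seq (re z) n ≡ seq (re w) n) → (∀ n → seq (im z) n ≡ seq (im w) n) → z ≈ᶜ w
pointwiseᶜ {z} {w} h k = pointwise {re z} {re w} h , pointwise {im z} {im w} k

ℂ-isCommutativeRing : IsCommutativeRing _≈ᶜ_ _+ᶜ_ _*ᶜ_ -ᶜ_ 0ᶜ 1ᶜ
ℂ-isCommutativeRing = record
  { isRing = record
    { +-isAbelianGroup = record
      { isGroup = record
        { isMonoid = record
          { isSemigroup = record
            { isMagma = record
              { isEquivalence = record
                { refl  = λ {z} → ℝR.refl {re z} , ℝR.refl {im z}
                ; sym   = λ {z} {w} (h , k) → ℝR.sym {re z} {re w} h , ℝR.sym {im z} {im w} k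
                ; trans = λ {z} {w} {v} (h , k) (h′ , k′) → ℝR.trans {re z} {re w} {re v} h h′ , ℝR.trans {im z} {im w} {im v} k k′
                }
              ; ∙-cong = λ {z} {w} {u} {v} (h , k) (h′ , k′) → ℝR.+-cong {re z} {re w} {re u} {re v} h h′ , ℝR.+-cong {im z} {im w} {im u} {im v} k k′
              }
            ; assoc = λ z w v → ℝR.+-assoc (re z) (re w) (re v) , ℝR.+-assoc (im z) (im w) (im v)
            }
          ; identity = (λ z → ℝR.+-identityˡ (re z) , ℝR.+-identityˡ (im z)) , (λ z → ℝR.+-identityʳ (re z) , ℝR.+-identityʳ (im z))
          }
        ; inverse = (λ z → ℝR.-‿inverseˡ (re z) , ℝR.-‿inverseˡ (im z)) , (λ z → ℝR.-‿inverseʳ (re z) , ℝR.-‿inverseʳ (im z))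
        ; ⁻¹-cong = λ {z} {w} (h , k) → ℝR.-‿cong {re z} {re w} h , ℝR.-‿cong {im z} {im w} k
        }
      ; comm = λ z w → ℝR.+-comm (re z) (re w) , ℝR.+-comm (im z) (im w)
      }
    ; *-cong = λ {z} {w} {u} {v} (h , k) (h′ , k′) →
        ℝR.+-cong {re z *ʳ re u} {re w *ʳ re v} { -ʳ (im z *ʳ im u)} { -ʳ (im w *ʳ im v)}
          (ℝR.*-cong {re z} {re w} {re u} {re v} h h′)
          (ℝR.-‿cong {im z *ʳ im u} {im w *ʳ im v} (ℝR.*-cong {im z} {im w} {im u} {im v} k k′)) ,
        ℝR.+-cong {re z *ʳ im u} {re w *ʳ im v} {im z *ʳ re u} {im w *ʳ re v}
          (ℝR.*-cong {re z} {re w} {im u} {im v} h k′) (ℝR.*-cong {im z} {im w} {re u} {re v} k h′)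
    ; *-assoc = λ z w v → pointwiseᶜ {(z *ᶜ w) *ᶜ v} {z *ᶜ (w *ᶜ v)}
        (λ n → solve 6 (λ a b c d e f → (a :* c :- b :* d) :* e :- (a :* d :+ b :* c) :* f :=
                                        a :* (c :* e :- d :* f) :- b :* (c :* f :+ d :* e)) ≡.refl
                 (seq (re z) n) (seq (im z) n) (seq (re w) n) (seq (im w) n) (seq (re v) n) (seq (im v) n))
        (λ n → solve 6 (λ a b c d e f → (a :* c :- b :* d) :* f :+ (a :* d :+ b :* c) :* e :=
                                        a :* (c :* f :+ d :* e) :+ b :* (c :* e :- d :* f)) ≡.refl
                 (seq (re z) n) (seq (im z) n) (seq (re w) n) (seq (im w) n) (seq (re v) n) (seq (im v) n))
    ; *-identity =
        (λ z → pointwiseᶜ {1ᶜ *ᶜ z} {z}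
          (λ n → solve 2 (λ a b → con 1ℚ :* a :- con 0ℚ :* b := a) ≡.refl (seq (re z) n) (seq (im z) n))
          (λ n → solve 2 (λ a b → con 1ℚ :* b :+ con 0ℚ :* a := b) ≡.refl (seq (re z) n) (seq (im z) n)))
      , (λ z → pointwiseᶜ {z *ᶜ 1ᶜ} {z}
          (λ n → solve 2 (λ a b → a :* con 1ℚ :- b :* con 0ℚ := a) ≡.refl (seq (re z) n) (seq (im z) n))
          (λ n → solve 2 (λ a b → a :* con 0ℚ :+ b :* con 1ℚ := b) ≡.refl (seq (re z) n) (seq (im z) n)))
    ; distrib =
        (λ z w v → pointwiseᶜ {z *ᶜ (w +ᶜ v)} {z *ᶜ w +ᶜ z *ᶜ v}
          (λ n → solve 6 (λ a b c d e f → a :* (c :+ e) :- b :* (d :+ f) := (a :* c :- b :* d) :+ (a :* e :- b :* f)) ≡.refl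
                 (seq (re z) n) (seq (im z) n) (seq (re w) n) (seq (im w) n) (seq (re v) n) (seq (im v) n))
          (λ n → solve 6 (λ a b c d e f → a :* (d :+ f) :+ b :* (c :+ e) := (a :* d :+ b :* c) :+ (a :* f :+ b :* e)) ≡.refl
                 (seq (re z) n) (seq (im z) n) (seq (re w) n) (seq (im w) n) (seq (re v) n) (seq (im v) n)))
      , (λ z w v → pointwiseᶜ {(w +ᶜ v) *ᶜ z} {w *ᶜ z +ᶜ v *ᶜ z}
          (λ n → solve 6 (λ a b c d e f → (c :+ e) :* a :- (d :+ f) :* b := (c :* a :- d :* b) :+ (e :* a :- f :* b)) ≡.refl
                 (seq (re z) n) (seq (im z) n) (seq (re w) n) (seq (im w) n) (seq (re v) n) (seq (im v) n))
          (λ n → solve 6 (λ a b c d e f → (c :+ e) :* b :+ (d :+ f) :* a := (c :* b :+ d :* a) :+ (e :* b :+ f :* a)) ≡.refl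
                 (seq (re z) n) (seq (im z) n) (seq (re w) n) (seq (im w) n) (seq (re v) n) (seq (im v) n)))
    }
  ; *-comm = λ z w → pointwiseᶜ {z *ᶜ w} {w *ᶜ z}
      (λ n → solve 4 (λ a b c d → a :* c :- b :* d := c :* a :- d :* b) ≡.refl (seq (re z) n) (seq (im z) n) (seq (re w) n) (seq (im w) n))
      (λ n → solve 4 (λ a b c d → a :* d :+ b :* c := c :* b :+ d :* a) ≡.refl (seq (re z) n) (seq (im z) n) (seq (re w) n) (seq (im w) n))
  }
  where open +-*-Solver

-- Sealed copies of the complex operations, so that checking terms built from them never
-- unfolds to Cauchy sequences.
infixl 6 _⊕_
infixl 7 _⊗_
infix  8 ⊖_

opaque
  _⊕_ _⊗_ : ℂ → ℂ → ℂ
  _⊕_ = _+ᶜ_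
  _⊗_ = _*ᶜ_

  ⊖_ : ℂ → ℂ
  ⊖_ = -ᶜ_

  ⊕-unseal : ∀ z w {z′ w′} → z′ ≡ z → w′ ≡ w → z′ ⊕ w′ ≡ z +ᶜ w
  ⊕-unseal _ _ ≡.refl ≡.refl = ≡.refl

  ⊗-unseal : ∀ z w {z′ w′} → z′ ≡ z → w′ ≡ w → z′ ⊗ w′ ≡ z *ᶜ w
  ⊗-unseal _ _ ≡.refl ≡.refl = ≡.refl

  ⊖-unseal : ∀ z {z′} → z′ ≡ z → ⊖ z′ ≡ -ᶜ z
  ⊖-unseal _ ≡.refl = ≡.refl

  sealed-isCommutativeRing : IsCommutativeRing _≈ᶜ_ _⊕_ _⊗_ ⊖_ 0ᶜ 1ᶜ
  sealed-isCommutativeRing = ℂ-isCommutativeRing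

ℂ-commutativeRing : CommutativeRing 0ℓ 0ℓ
ℂ-commutativeRing = record { isCommutativeRing = sealed-isCommutativeRing }

module ℂR = CommutativeRing ℂ-commutativeRing
open import Algebra.Properties.Semiring.Exp ℂR.semiring public using () renaming (_^_ to _**_)
open import Algebra.Properties.Semiring.Sum ℂR.semiring public using () renaming (sum to sumᶜ)

rawMonoid : {A : Set} → (A → A → Set) → (A → A → A) → A → RawMonoid 0ℓ 0ℓ
rawMonoid {A} _≈_ _∙_ ε = record { Carrier = A ; _≈_ = _≈_ ; _∙_ = _∙_ ; ε = ε }

-- Stated over an abstract carrier for the same reason.
module _ {A : Set} (_≈_ : A → A → Set) (_∙_ _∘_ : A → A → A) (ε : A) (∙≡∘ : ∀ x y → x ∙ y ≡ x ∘ y) where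

  open RawMonoidDefs (rawMonoid _≈_ _∙_ ε) using () renaming (_×_ to _×∙_; sum to sum∙)
  open RawMonoidDefs (rawMonoid _≈_ _∘_ ε) using () renaming (_×_ to _×∘_; sum to sum∘)

  ×-resp-≡ : ∀ k x → k ×∙ x ≡ k ×∘ x
  ×-resp-≡ zero    x = ≡.refl
  ×-resp-≡ (suc k) x = ≡.trans (∙≡∘ x (k ×∙ x)) (≡.cong (x ∘_) (×-resp-≡ k x))

  sum-resp-≡ : ∀ {n} {f g : Fin n → A} → (∀ i → f i ≡ g i) → sum∙ f ≡ sum∘ g
  sum-resp-≡ {zero}          f≡g = ≡.refl
  sum-resp-≡ {suc n} {f} {g} f≡g = ≡.trans (∙≡∘ (f zero) _) (≡.cong₂ _∘_ (f≡g zero) (sum-resp-≡ (λ i → f≡g (suc i))))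

**≡^ᶜ : ∀ z k → z ** k ≡ z ^ᶜ k
**≡^ᶜ z k = ×-resp-≡ _≈ᶜ_ _⊗_ _*ᶜ_ 1ᶜ (λ z w → ⊗-unseal z w ≡.refl ≡.refl) k z

sumᶜ≡∑ᶜ : ∀ {n} {f g : Fin n → ℂ} → (∀ i → f i ≡ g i) → sumᶜ f ≡ ∑ᶜ g
sumᶜ≡∑ᶜ = sum-resp-≡ _≈ᶜ_ _⊕_ _+ᶜ_ 0ᶜ (λ z w → ⊕-unseal z w ≡.refl ≡.refl)

sq-cancel-≤ : ∀ {a b} → 0ℚ ℚ.≤ b → a ℚ.* a ℚ.≤ b ℚ.* b → a ℚ.≤ b
sq-cancel-≤ {a} {b} 0≤b a²≤b² = ℚ.≮⇒≥ λ b<a → ℚ.<-irrefl ≡.refl (begin-strict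
  b ℚ.* b  ≤⟨ ℚ.*-monoˡ-≤-nonNeg b {{ℚ.nonNegative 0≤b}} (ℚ.<⇒≤ b<a) ⟩
  b ℚ.* a  <⟨ ℚ.*-monoˡ-<-pos a {{ℚ.positive (ℚ.≤-<-trans 0≤b b<a)}} b<a ⟩
  a ℚ.* a  ≤⟨ a²≤b² ⟩
  b ℚ.* b  ∎)
  where open ℚ.≤-Reasoning

0≤p*p : ∀ p → 0ℚ ℚ.≤ p ℚ.* p
0≤p*p p = ≡.subst (0ℚ ℚ.≤_) ∣p∣²≡p² (0≤* (ℚ.0≤∣p∣ p) (ℚ.0≤∣p∣ p))
  where
  open +-*-Solver
  ∣p∣²≡p² : ℚ.∣ p ∣ ℚ.* ℚ.∣ p ∣ ≡ p ℚ.* p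
  ∣p∣²≡p² with ℚ.∣p∣≡p∨∣p∣≡-p p
  ... | inj₁ eq = ≡.cong₂ ℚ._*_ eq eq
  ... | inj₂ eq = ≡.trans (≡.cong₂ ℚ._*_ eq eq) (solve 1 (λ p → :- p :* :- p := p :* p) ≡.refl p)

0<* : ∀ {p q} → 0ℚ ℚ.< p → 0ℚ ℚ.< q → 0ℚ ℚ.< p ℚ.* q
0<* {p} {q} 0<p 0<q = ≡.subst (ℚ._< p ℚ.* q) (ℚ.*-zeroʳ p) (ℚ.*-monoʳ-<-pos p {{ℚ.positive 0<p}} 0<q)

Null-cancel : ∀ (s t : ℕ → ℚ) {η} N → 0ℚ ℚ.< η → (∀ n → N ≤ n → η ℚ.≤ ℚ.∣ t n ∣) → Null (λ n → s n ℚ.* t n) → Null s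
Null-cancel s t {η} N 0<η η≤t st ε 0<ε =
  let (M , h) = st (ε ℚ.* η) (0<* 0<ε 0<η) in
  M ℕ.⊔ N , λ n ≤n → ℚ.*-cancelʳ-≤-pos η {{ℚ.positive 0<η}} (begin
    ℚ.∣ s n ∣ ℚ.* η           ≤⟨ ℚ.*-monoˡ-≤-nonNeg ℚ.∣ s n ∣ {{ℚ.nonNegative (ℚ.0≤∣p∣ (s n))}} (η≤t n (ℕ.m⊔n≤o⇒n≤o M N ≤n)) ⟩
    ℚ.∣ s n ∣ ℚ.* ℚ.∣ t n ∣   ≡⟨ ℚ.∣p*q∣≡∣p∣*∣q∣ (s n) (t n) ⟨
    ℚ.∣ s n ℚ.* t n ∣         ≤⟨ h n (ℕ.m⊔n≤o⇒m≤o M N ≤n) ⟩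
    ε ℚ.* η                   ∎)
  where open ℚ.≤-Reasoning

-0ℚ : ∀ p → p ℚ.- 0ℚ ≡ p
-0ℚ = ℚ.+-identityʳ

≈0⇒Null : ∀ {x} → x ≈ʳ fromℕ 0 → Null (seq x)
≈0⇒Null = Null-resp (λ n → -0ℚ _)

Null⇒≈0 : ∀ {x} → Null (seq x) → x ≈ʳ fromℕ 0
Null⇒≈0 = Null-resp (λ n → ≡.sym (-0ℚ _))

-- Either the far terms of y are small, or they are bounded away from 0 and then x vanishes.
ℝ-noZeroDivisors : NoZeroDivisors ℝ-commutativeRing
ℝ-noZeroDivisors x y xy≈0 x≉0 = Null⇒≈0 {y} small-tail
  where
  close : ∀ a b → ℚ.∣ a ∣ ℚ.≤ ℚ.∣ b ∣ ℚ.+ ℚ.∣ a ℚ.- b ∣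
  close a b = ≡.subst (λ z → ℚ.∣ z ∣ ℚ.≤ ℚ.∣ b ∣ ℚ.+ ℚ.∣ a ℚ.- b ∣) (≡.sym (p≡q+[p-q] a b)) (ℚ.∣p+q∣≤∣p∣+∣q∣ b (a ℚ.- b))
  small-tail : Null (seq y)
  small-tail ε 0<ε = N , bound
    where
    open ℚ.≤-Reasoning
    δ = ½ ℚ.* ε
    η = ½ ℚ.* δ
    0<δ = 0<½* 0<ε
    0<η = 0<½* 0<δ
    N = proj₁ (cauchy y η 0<η)
    near : ∀ n → N ≤ n → ∀ k → N ≤ k → ℚ.∣ seq y n ∣ ℚ.≤ ℚ.∣ seq y k ∣ ℚ.+ η
    near n N≤n k N≤k = ℚ.≤-trans (close (seq y n) (seq y k)) (ℚ.+-monoʳ-≤ ℚ.∣ seq y k ∣ (proj₂ (cauchy y η 0<η) n k N≤n N≤k))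
    bound : ∀ n → N ≤ n → ℚ.∣ seq y n ∣ ℚ.≤ ε
    -- A comparison of rationals, hence decidable, made anew for every ε; whether y itself is 0 is
    -- never decided.
    bound with ℚ.∣ seq y N ∣ ℚ.≤? δ
    ... | yes yN≤δ = λ n N≤n → begin
      ℚ.∣ seq y n ∣        ≤⟨ near n N≤n N ℕ.≤-refl ⟩
      ℚ.∣ seq y N ∣ ℚ.+ η
        ≤⟨ ℚ.+-mono-≤ yN≤δ (≡.subst (η ℚ.≤_) (½+½ δ) (≡.subst (ℚ._≤ η ℚ.+ η) (ℚ.+-identityʳ η) (ℚ.+-monoʳ-≤ η (ℚ.<⇒≤ 0<η)))) ⟩
      δ ℚ.+ δ              ≡⟨ ½+½ ε ⟩
      ε                    ∎
    ... | no yN≰δ = contradiction (Null⇒≈0 {x} (Null-cancel (seq x) (seq y) N 0<η away (≈0⇒Null {x *ʳ y} xy≈0))) x≉0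
      where
      away : ∀ n → N ≤ n → η ℚ.≤ ℚ.∣ seq y n ∣
      away n N≤n = ≡.subst₂ ℚ._≤_ (cancel η) (cancel ℚ.∣ seq y n ∣) (ℚ.+-monoˡ-≤ (ℚ.- η) (begin
        η ℚ.+ η              ≡⟨ ½+½ δ ⟩
        δ                    ≤⟨ ℚ.<⇒≤ (ℚ.≰⇒> yN≰δ) ⟩
        ℚ.∣ seq y N ∣        ≤⟨ near N ℕ.≤-refl n N≤n ⟩
        ℚ.∣ seq y n ∣ ℚ.+ η  ∎))
        where
        open +-*-Solver
        cancel : ∀ a → a ℚ.+ η ℚ.- η ≡ a
        cancel a = solve 2 (λ a e → a :+ e :- e := a) ≡.refl a η

-- Dropping y² leaves x² within the tolerance ε², so x is within ε.
sumOfSquares≈0 : ∀ x y → x *ʳ x +ʳ y *ʳ y ≈ʳ fromℕ 0 → x ≈ʳ fromℕ 0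
sumOfSquares≈0 x y h = Null⇒≈0 {x} λ ε 0<ε →
  let (N , k) = ≈0⇒Null {x *ʳ x +ʳ y *ʳ y} h (ε ℚ.* ε) (0<* 0<ε 0<ε) in
  N , λ n N≤n → sq-cancel-≤ (ℚ.<⇒≤ 0<ε) (begin
    ℚ.∣ seq x n ∣ ℚ.* ℚ.∣ seq x n ∣                      ≡⟨ ℚ.∣p*q∣≡∣p∣*∣q∣ (seq x n) (seq x n) ⟨
    ℚ.∣ seq x n ℚ.* seq x n ∣                            ≡⟨ ℚ.0≤p⇒∣p∣≡p (0≤p*p (seq x n)) ⟩
    seq x n ℚ.* seq x n                                  ≡⟨ ℚ.+-identityʳ _ ⟨
    seq x n ℚ.* seq x n ℚ.+ 0ℚ                           ≤⟨ ℚ.+-monoʳ-≤ (seq x n ℚ.* seq x n) (0≤p*p (seq y n)) ⟩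
    seq x n ℚ.* seq x n ℚ.+ seq y n ℚ.* seq y n
      ≤⟨ ∣-∣⇒≤ _ 0ℚ (≡.subst (λ z → ℚ.∣ z ∣ ℚ.≤ ε ℚ.* ε) (≡.sym (-0ℚ _)) (k n N≤n)) ⟩
    0ℚ ℚ.+ ε ℚ.* ε                                       ≡⟨ ℚ.+-identityˡ _ ⟩
    ε ℚ.* ε                                              ∎)
  where open ℚ.≤-Reasoning

∣_∣² : ℂ → ℝ
∣ z ∣² = re z *ʳ re z +ʳ im z *ʳ im z

∣∣²-* : ∀ z w → ∣ z *ᶜ w ∣² ≈ʳ ∣ z ∣² *ʳ ∣ w ∣²
∣∣²-* z w = pointwise {∣ z *ᶜ w ∣²} {∣ z ∣² *ʳ ∣ w ∣²} λ n →
  solve 4 (λ a b c d → (a :* c :- b :* d) :* (a :* c :- b :* d) :+ (a :* d :+ b :* c) :* (a :* d :+ b :* c) :=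
                       (a :* a :+ b :* b) :* (c :* c :+ d :* d)) ≡.refl
    (seq (re z) n) (seq (im z) n) (seq (re w) n) (seq (im w) n)
  where open +-*-Solver

∣∣²-cong : ∀ {z w} → z ≈ᶜ w → ∣ z ∣² ≈ʳ ∣ w ∣²
∣∣²-cong {z} {w} (h , k) = ℝR.+-cong {re z *ʳ re z} {re w *ʳ re w} {im z *ʳ im z} {im w *ʳ im w}
  (ℝR.*-cong {re z} {re w} {re z} {re w} h h) (ℝR.*-cong {im z} {im w} {im z} {im w} k k)

∣∣²≈0 : ∀ z → ∣ z ∣² ≈ʳ fromℕ 0 → z ≈ᶜ 0ᶜ
∣∣²≈0 z h = sumOfSquares≈0 (re z) (im z) h
  , sumOfSquares≈0 (im z) (re z) (ℝR.trans {im z *ʳ im z +ʳ re z *ʳ re z} {∣ z ∣²} {fromℕ 0}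
      (ℝR.+-comm (im z *ʳ im z) (re z *ʳ re z)) h)

-- The squared modulus is multiplicative and vanishes only at 0, which reduces the claim to ℝ.
ℂ-noZeroDivisors : NoZeroDivisors ℂ-commutativeRing
ℂ-noZeroDivisors z w zw≈0 z≉0 = ∣∣²≈0 w (ℝ-noZeroDivisors ∣ z ∣² ∣ w ∣²
  (ℝR.trans {∣ z ∣² *ʳ ∣ w ∣²} {∣ z *ᶜ w ∣²} {fromℕ 0} (ℝR.sym {∣ z *ᶜ w ∣²} {∣ z ∣² *ʳ ∣ w ∣²} (∣∣²-* z w))
    (∣∣²-cong {z *ᶜ w} {0ᶜ} (≡.subst (_≈ᶜ 0ᶜ) (⊗-unseal z w ≡.refl ≡.refl) zw≈0)))
  (z≉0 ∘ ∣∣²≈0 z))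

-- Order and norms

open import Algebra.Properties.Semiring.Exp ℝR.semiring using () renaming (_^_ to _^ʳ_)

pointwise-≤ : ∀ {x y} → (∀ n → seq x n ℚ.≤ seq y n) → x ≤ʳ y
pointwise-≤ {x} {y} x≤y ε 0<ε = 0 , λ n _ →
  ≡.subst (ℚ._≤ seq y n ℚ.+ ε) (ℚ.+-identityʳ (seq x n)) (ℚ.+-mono-≤ (x≤y n) (ℚ.<⇒≤ 0<ε))

≈⇒≤ʳ : ∀ {x y} → x ≈ʳ y → x ≤ʳ y
≈⇒≤ʳ {x} {y} x≈y ε 0<ε = let (N , h) = x≈y ε 0<ε in N , λ n N≤n → ∣-∣⇒≤ (seq x n) (seq y n) (h n N≤n)

≤ʳ-trans : ∀ {x y z} → x ≤ʳ y → y ≤ʳ z → x ≤ʳ z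
≤ʳ-trans {x} {y} {z} x≤y y≤z ε 0<ε =
  let (M , h) = x≤y (½ ℚ.* ε) (0<½* 0<ε)
      (N , k) = y≤z (½ ℚ.* ε) (0<½* 0<ε)
  in M ℕ.⊔ N , λ n ≤n → begin
    seq x n                                   ≤⟨ h n (ℕ.m⊔n≤o⇒m≤o M N ≤n) ⟩
    seq y n ℚ.+ ½ ℚ.* ε                       ≤⟨ ℚ.+-monoˡ-≤ (½ ℚ.* ε) (k n (ℕ.m⊔n≤o⇒n≤o M N ≤n)) ⟩
    seq z n ℚ.+ ½ ℚ.* ε ℚ.+ ½ ℚ.* ε           ≡⟨ ℚ.+-assoc (seq z n) _ _ ⟩
    seq z n ℚ.+ (½ ℚ.* ε ℚ.+ ½ ℚ.* ε)         ≡⟨ ≡.cong (seq z n ℚ.+_) (½+½ ε) ⟩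
    seq z n ℚ.+ ε                             ∎
  where open ℚ.≤-Reasoning

+ʳ-mono-≤ : ∀ {x y u v} → x ≤ʳ y → u ≤ʳ v → x +ʳ u ≤ʳ y +ʳ v
+ʳ-mono-≤ {x} {y} {u} {v} x≤y u≤v ε 0<ε =
  let (M , h) = x≤y (½ ℚ.* ε) (0<½* 0<ε)
      (N , k) = u≤v (½ ℚ.* ε) (0<½* 0<ε)
  in M ℕ.⊔ N , λ n ≤n → begin
    seq x n ℚ.+ seq u n                                 ≤⟨ ℚ.+-mono-≤ (h n (ℕ.m⊔n≤o⇒m≤o M N ≤n)) (k n (ℕ.m⊔n≤o⇒n≤o M N ≤n)) ⟩
    (seq y n ℚ.+ ½ ℚ.* ε) ℚ.+ (seq v n ℚ.+ ½ ℚ.* ε)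
      ≡⟨ solve 3 (λ a b c → (a :+ c) :+ (b :+ c) := a :+ b :+ (c :+ c)) ≡.refl (seq y n) (seq v n) (½ ℚ.* ε) ⟩
    seq y n ℚ.+ seq v n ℚ.+ (½ ℚ.* ε ℚ.+ ½ ℚ.* ε)       ≡⟨ ≡.cong (seq y n ℚ.+ seq v n ℚ.+_) (½+½ ε) ⟩
    seq y n ℚ.+ seq v n ℚ.+ ε                           ∎
  where
  open ℚ.≤-Reasoning
  open +-*-Solver using (solve; _:=_; _:+_)

-- Nonnegativity of every term of the representative, stronger than `fromℕ 0 ≤ʳ x`. Squares and
-- values of `√` have it, and it lets rational inequalities be multiplied term by term.
0≤seq : ℝ → Set
0≤seq x = ∀ n → 0ℚ ℚ.≤ seq x n

*ʳ-monoʳ-≤ : ∀ x {y z} → 0≤seq x → y ≤ʳ z → x *ʳ y ≤ʳ x *ʳ z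
*ʳ-monoʳ-≤ x {y} {z} 0≤x y≤z ε 0<ε =
  let (M , B , 0<B , hx) = bounded x
      (κ , Bκ≡1 , 0<κε)  = ratio B ε 0<B 0<ε
      (N , h)            = y≤z (κ ℚ.* ε) 0<κε
  in M ℕ.⊔ N , λ n ≤n → begin
    seq x n ℚ.* seq y n
      ≤⟨ ℚ.*-monoˡ-≤-nonNeg (seq x n) {{ℚ.nonNegative (0≤x n)}} (h n (ℕ.m⊔n≤o⇒n≤o M N ≤n)) ⟩
    seq x n ℚ.* (seq z n ℚ.+ κ ℚ.* ε)              ≡⟨ ℚ.*-distribˡ-+ (seq x n) (seq z n) (κ ℚ.* ε) ⟩
    seq x n ℚ.* seq z n ℚ.+ seq x n ℚ.* (κ ℚ.* ε)
      ≤⟨ ℚ.+-monoʳ-≤ (seq x n ℚ.* seq z n) (ℚ.*-monoʳ-≤-nonNeg (κ ℚ.* ε) {{ℚ.nonNegative (ℚ.<⇒≤ 0<κε)}}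
                                                       (≡.subst (ℚ._≤ B) (ℚ.0≤p⇒∣p∣≡p (0≤x n)) (hx n (ℕ.m⊔n≤o⇒m≤o M N ≤n)))) ⟩
    seq x n ℚ.* seq z n ℚ.+ B ℚ.* (κ ℚ.* ε)
      ≡⟨ ≡.cong (seq x n ℚ.* seq z n ℚ.+_) (≡.trans (≡.sym (ℚ.*-assoc B κ ε)) (≡.trans (≡.cong (ℚ._* ε) Bκ≡1) (ℚ.*-identityˡ ε))) ⟩
    seq x n ℚ.* seq z n ℚ.+ ε                      ∎
  where open ℚ.≤-Reasoning

ι-suc-* : ∀ n c → ι (suc n) ℚ.* c ≡ c ℚ.+ ι n ℚ.* c
ι-suc-* n c = ≡.trans (≡.cong (ℚ._* c) (ι-+ 1 n)) (≡.trans (ℚ.*-distribʳ-+ c 1ℚ (ι n)) (≡.cong (ℚ._+ ι n ℚ.* c) (ℚ.*-identityˡ c)))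

∑ʳ-≤ : ∀ {n} (f : Fin n → ℝ) c → (∀ i → f i ≤ʳ fromℚ c) → ∑ʳ f ≤ʳ fromℚ (ι n ℚ.* c)
∑ʳ-≤ {zero}  f c f≤c = pointwise-≤ {fromℕ 0} {fromℚ (0ℚ ℚ.* c)} (λ _ → ℚ.≤-reflexive (≡.sym (ℚ.*-zeroˡ c)))
∑ʳ-≤ {suc n} f c f≤c = ≡.subst (λ z → f zero +ʳ ∑ʳ (f ∘ suc) ≤ʳ fromℚ z) (≡.sym (ι-suc-* n c))
  (+ʳ-mono-≤ {f zero} {fromℚ c} {∑ʳ (f ∘ suc)} {fromℚ (ι n ℚ.* c)} (f≤c zero) (∑ʳ-≤ (f ∘ suc) c (f≤c ∘ suc)))

√-≤ : ∀ x c → 0ℚ ℚ.≤ c → x ≤ʳ fromℚ (c ℚ.* c) → √ x ≤ʳ fromℚ c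
√-≤ x c 0≤c x≤c² ε 0<ε = let (N , h) = x≤c² (ε ℚ.* ε) (0<* 0<ε 0<ε) in
  N , λ n N≤n → sq-cancel-≤ 0≤c+ε (begin
    √ℚ n (seq x n) ℚ.* √ℚ n (seq x n)                                    ≤⟨ proj₁ (√ℚ-bounds n (seq x n)) ⟩
    seq x n ℚ.⊔ 0ℚ                                                       ≤⟨ ℚ.⊔-lub (h n N≤n) (0≤+ (0≤p*p c) (0≤p*p ε)) ⟩
    c ℚ.* c ℚ.+ ε ℚ.* ε                                                  ≡⟨ ℚ.+-identityʳ _ ⟨
    c ℚ.* c ℚ.+ ε ℚ.* ε ℚ.+ 0ℚ                                           ≤⟨ ℚ.+-monoʳ-≤ (c ℚ.* c ℚ.+ ε ℚ.* ε) (0≤+ 0≤cε 0≤cε) ⟩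
    c ℚ.* c ℚ.+ ε ℚ.* ε ℚ.+ (c ℚ.* ε ℚ.+ c ℚ.* ε)                        ≡⟨ sq-+ c ε ⟩
    (c ℚ.+ ε) ℚ.* (c ℚ.+ ε)                                              ∎)
  where
  open ℚ.≤-Reasoning
  0≤c+ε = 0≤+ 0≤c (ℚ.<⇒≤ 0<ε)
  0≤cε = 0≤* 0≤c (ℚ.<⇒≤ 0<ε)

infix 7 _∙_

-- The inner product of ℂ as the real plane; `z ∙ z` is `∣ z ∣²`.
_∙_ : ℂ → ℂ → ℝ
z ∙ w = re z *ʳ re w +ʳ im z *ʳ im w

-- Since z ∙ w is half of ∣z∣² + ∣w∣² - ∣z - w∣², it is at most the mean of the squared moduli. In
-- contrast to Cauchy-Schwarz this involves no square root.
∙-bound : ∀ z w c → ∣ z ∣² ≤ʳ fromℚ c → ∣ w ∣² ≤ʳ fromℚ c → z ∙ w ≤ʳ fromℚ c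
∙-bound z w c hz hw ε 0<ε = let (M , h) = hz ε 0<ε; (N , k) = hw ε 0<ε in
  M ℕ.⊔ N , λ n ≤n → amgm (seq (re z) n) (seq (im z) n) (seq (re w) n) (seq (im w) n)
    (h n (ℕ.m⊔n≤o⇒m≤o M N ≤n)) (k n (ℕ.m⊔n≤o⇒n≤o M N ≤n))
  where
  open ℚ.≤-Reasoning
  open +-*-Solver using (solve; _:=_; _:+_; _:*_; _:-_; con)
  amgm : ∀ a b x y → a ℚ.* a ℚ.+ b ℚ.* b ℚ.≤ c ℚ.+ ε → x ℚ.* x ℚ.+ y ℚ.* y ℚ.≤ c ℚ.+ ε → a ℚ.* x ℚ.+ b ℚ.* y ℚ.≤ c ℚ.+ ε
  amgm a b x y h k = begin
    a ℚ.* x ℚ.+ b ℚ.* y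
      ≡⟨ ℚ.+-identityʳ _ ⟨
    a ℚ.* x ℚ.+ b ℚ.* y ℚ.+ 0ℚ
      ≤⟨ ℚ.+-monoʳ-≤ (a ℚ.* x ℚ.+ b ℚ.* y) (0≤* {½} (ℚ.nonNegative⁻¹ ½) (0≤+ (0≤p*p (a ℚ.- x)) (0≤p*p (b ℚ.- y)))) ⟩
    a ℚ.* x ℚ.+ b ℚ.* y ℚ.+ ½ ℚ.* ((a ℚ.- x) ℚ.* (a ℚ.- x) ℚ.+ (b ℚ.- y) ℚ.* (b ℚ.- y))
      ≡⟨ solve 4 (λ a b x y → a :* x :+ b :* y :+ con ½ :* ((a :- x) :* (a :- x) :+ (b :- y) :* (b :- y)) :=
                              con ½ :* (a :* a :+ b :* b) :+ con ½ :* (x :* x :+ y :* y)) ≡.refl a b x y ⟩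
    ½ ℚ.* (a ℚ.* a ℚ.+ b ℚ.* b) ℚ.+ ½ ℚ.* (x ℚ.* x ℚ.+ y ℚ.* y)
      ≤⟨ ℚ.+-mono-≤ (ℚ.*-monoˡ-≤-nonNeg ½ h) (ℚ.*-monoˡ-≤-nonNeg ½ k) ⟩
    ½ ℚ.* (c ℚ.+ ε) ℚ.+ ½ ℚ.* (c ℚ.+ ε)
      ≡⟨ ½+½ (c ℚ.+ ε) ⟩
    c ℚ.+ ε ∎

∑ᶜ-∙ : ∀ {n} (u : Fin n → ℂ) w c → (∀ i → u i ∙ w ≤ʳ fromℚ c) → ∑ᶜ u ∙ w ≤ʳ fromℚ (ι n ℚ.* c)
∑ᶜ-∙ {zero}  u w c h = pointwise-≤ {0ᶜ ∙ w} {fromℚ (0ℚ ℚ.* c)} (λ n → ℚ.≤-reflexive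
  (solve 3 (λ a b c → con 0ℚ :* a :+ con 0ℚ :* b := con 0ℚ :* c) ≡.refl (seq (re w) n) (seq (im w) n) c))
  where open +-*-Solver using (solve; _:=_; _:+_; _:*_; con)
∑ᶜ-∙ {suc n} u w c h = ≤ʳ-trans {∑ᶜ u ∙ w} {u zero ∙ w +ʳ S ∙ w} {fromℚ (ι (suc n) ℚ.* c)}
  (pointwise-≤ {∑ᶜ u ∙ w} {u zero ∙ w +ʳ S ∙ w} (λ n → ℚ.≤-reflexive
    (solve 6 (λ a b x y s t → (a :+ x) :* s :+ (b :+ y) :* t := (a :* s :+ b :* t) :+ (x :* s :+ y :* t)) ≡.refl
      (seq (re (u zero)) n) (seq (im (u zero)) n) (seq (re S) n) (seq (im S) n) (seq (re w) n) (seq (im w) n))))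
  (≡.subst (λ z → u zero ∙ w +ʳ S ∙ w ≤ʳ fromℚ z) (≡.sym (ι-suc-* n c))
    (+ʳ-mono-≤ {u zero ∙ w} {fromℚ c} {S ∙ w} {fromℚ (ι n ℚ.* c)} (h zero) (∑ᶜ-∙ (u ∘ suc) w c (h ∘ suc))))
  where
  open +-*-Solver using (solve; _:=_; _:+_; _:*_; con)
  S = ∑ᶜ (u ∘ suc)

∙-comm : ∀ z w → z ∙ w ≤ʳ w ∙ z
∙-comm z w = pointwise-≤ {z ∙ w} {w ∙ z} (λ n → ℚ.≤-reflexive
  (≡.cong₂ ℚ._+_ (ℚ.*-comm (seq (re z) n) (seq (re w) n)) (ℚ.*-comm (seq (im z) n) (seq (im w) n))))

-- Takes the place of the triangle inequality: the squared modulus of a sum is the sum of all n²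
-- inner products of its terms.
∣∑ᶜ∣²-≤ : ∀ {n} (u : Fin n → ℂ) c → (∀ i → ∣ u i ∣² ≤ʳ fromℚ c) → ∣ ∑ᶜ u ∣² ≤ʳ fromℚ (ι n ℚ.* (ι n ℚ.* c))
∣∑ᶜ∣²-≤ {n} u c h = ∑ᶜ-∙ u (∑ᶜ u) (ι n ℚ.* c) λ i →
  ≤ʳ-trans {u i ∙ ∑ᶜ u} {∑ᶜ u ∙ u i} {fromℚ (ι n ℚ.* c)} (∙-comm (u i) (∑ᶜ u))
    (∑ᶜ-∙ u (u i) c λ j → ∙-bound (u j) (u i) c (h j) (h i))

0≤∣∣² : ∀ z → 0≤seq ∣ z ∣²
0≤∣∣² z n = 0≤+ (0≤p*p (seq (re z) n)) (0≤p*p (seq (im z) n))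

∣∣ᶜ-sq : ∀ z → ∣ z ∣ᶜ *ʳ ∣ z ∣ᶜ ≈ʳ ∣ z ∣²
∣∣ᶜ-sq z = √*√ ∣ z ∣² (pointwise-≤ {fromℕ 0} {∣ z ∣²} (0≤∣∣² z))

‖‖-≤ : ∀ {k} (A : Matrix k k) b → 0ℚ ℚ.≤ b → (∀ i j → ∣ A i j ∣² ≤ʳ fromℚ (b ℚ.* b)) → ‖ A ‖ ≤ʳ fromℚ (ι k ℚ.* b)
‖‖-≤ {k} A b 0≤b h = √-≤ X (ι k ℚ.* b) (0≤* {ι k} {b} (ι-mono-≤ {0} {k} z≤n) 0≤b)
  (≡.subst (λ z → X ≤ʳ fromℚ z) (solve 2 (λ k b → k :* (k :* (b :* b)) := (k :* b) :* (k :* b)) ≡.refl (ι k) b)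
    (∑ʳ-≤ (λ i → ∑ʳ (entry i)) (ι k ℚ.* (b ℚ.* b)) λ i → ∑ʳ-≤ (entry i) (b ℚ.* b) λ j →
      ≤ʳ-trans {entry i j} {∣ A i j ∣²} {fromℚ (b ℚ.* b)} (≈⇒≤ʳ {entry i j} {∣ A i j ∣²} (∣∣ᶜ-sq (A i j))) (h i j)))
  where
  open +-*-Solver using (solve; _:=_; _:*_)
  entry : Fin k → Fin k → ℝ
  entry i j = ∣ A i j ∣ᶜ *ʳ ∣ A i j ∣ᶜ
  X = ∑ʳ λ i → ∑ʳ (entry i)

module ℝD = Domain ℝ-commutativeRing ℝ-noZeroDivisors

0≤^ : ∀ x → 0≤seq x → ∀ k → 0≤seq (x ^ʳ k)
0≤^ x 0≤x zero    n = ℚ.nonNegative⁻¹ 1ℚ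
0≤^ x 0≤x (suc k) n = 0≤* (0≤x n) (0≤^ x 0≤x k n)

0≤∑ : ∀ {k} (f : Fin k → ℝ) → (∀ i → 0≤seq (f i)) → 0≤seq (∑ʳ f)
0≤∑ {zero}  f 0≤f n = ℚ.≤-refl
0≤∑ {suc k} f 0≤f n = 0≤+ (0≤f zero n) (0≤∑ (f ∘ suc) (0≤f ∘ suc) n)

-- With S = 1 + x + ... + xᵏ, the geometric sum gives S x = S. As S ≥ 1 for nonnegative x, S
-- cancels. Applied to squared moduli, this puts roots of unity on the unit circle.
^≈1⇒≈1 : ∀ k x → 0≤seq x → x ^ʳ suc k ≈ʳ fromℕ 1 → x ≈ʳ fromℕ 1
^≈1⇒≈1 k x 0≤x xᵏ≈1 = ℝD.*-cancelˡ S x (fromℕ 1)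
  (ℝR.trans {S *ʳ x} {S} {S *ʳ fromℕ 1} S*x≈S (ℝR.sym {S *ʳ fromℕ 1} {S} (ℝR.*-identityʳ S))) S≉0
  where
  S = ℝD.∑< (suc k) (x ^ʳ_)
  S*x≈S : S *ʳ x ≈ʳ S
  S*x≈S = +-cancelʳ (fromℕ 1) (S *ʳ x) S (ℝR.trans {S *ʳ x +ʳ fromℕ 1} {S +ʳ x ^ʳ suc k} {S +ʳ fromℕ 1}
    (ℝD.∑<-geometric (suc k) x) (ℝR.+-congˡ {S} {x ^ʳ suc k} {fromℕ 1} xᵏ≈1))
    where open import Algebra.Properties.Ring ℝR.ring using (+-cancelʳ)
  1≤S : ∀ n → 1ℚ ℚ.≤ seq S n
  1≤S n = ≡.subst (ℚ._≤ seq S n) (ℚ.+-identityʳ 1ℚ) (ℚ.+-monoʳ-≤ 1ℚ (0≤∑ {k} (λ i → x ^ʳ toℕ (suc i)) (λ i → 0≤^ x 0≤x (toℕ (suc i))) n))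
  S≉0 : ¬ S ≈ʳ fromℕ 0
  S≉0 S≈0 = let (N , h) = ≈0⇒Null {S} S≈0 ½ (ℚ.positive⁻¹ ½) in
    ℚ.<-irrefl ≡.refl (ℚ.<-≤-trans ½<1 (ℚ.≤-trans (1≤S N) (ℚ.≤-trans (p≤∣p∣ (seq S N)) (h N ℕ.≤-refl))))
    where
    ½<1 : ½ ℚ.< 1ℚ
    ½<1 = toWitness {a? = ½ ℚ.<? 1ℚ} _
    p≤∣p∣ : ∀ p → p ℚ.≤ ℚ.∣ p ∣
    p≤∣p∣ p = ≡.subst (p ℚ.≤_) (ℚ.+-identityˡ _) (∣-∣⇒≤ p 0ℚ (ℚ.≤-reflexive (≡.cong ℚ.∣_∣ (-0ℚ p))))

∣∣²-^ : ∀ z k → ∣ z ^ᶜ k ∣² ≈ʳ ∣ z ∣² ^ʳ k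
∣∣²-^ z zero    = ℝR.refl {fromℕ 1}
∣∣²-^ z (suc k) = ℝR.trans {∣ z *ᶜ z ^ᶜ k ∣²} {∣ z ∣² *ʳ ∣ z ^ᶜ k ∣²} {∣ z ∣² *ʳ ∣ z ∣² ^ʳ k}
  (∣∣²-* z (z ^ᶜ k)) (ℝR.*-congˡ {∣ z ∣²} {∣ z ^ᶜ k ∣²} {∣ z ∣² ^ʳ k} (∣∣²-^ z k))

rootOfUnity-∣∣² : ∀ n z → 0 < n → z ^ᶜ n ≈ᶜ 1ᶜ → ∣ z ∣² ≈ʳ fromℕ 1
rootOfUnity-∣∣² (suc n) z _ zⁿ≈1 = ^≈1⇒≈1 n ∣ z ∣² (0≤∣∣² z)
  (ℝR.trans {∣ z ∣² ^ʳ suc n} {∣ z ^ᶜ suc n ∣²} {fromℕ 1} (ℝR.sym {∣ z ^ᶜ suc n ∣²} {∣ z ∣² ^ʳ suc n} (∣∣²-^ z (suc n)))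
    (∣∣²-cong {z ^ᶜ suc n} {1ᶜ} zⁿ≈1))

^-∣∣² : ∀ z k → ∣ z ∣² ≈ʳ fromℕ 1 → ∣ z ^ᶜ k ∣² ≈ʳ fromℕ 1
^-∣∣² z zero    h = ℝR.refl {fromℕ 1}
^-∣∣² z (suc k) h = ℝR.trans {∣ z *ᶜ z ^ᶜ k ∣²} {∣ z ∣² *ʳ ∣ z ^ᶜ k ∣²} {fromℕ 1} (∣∣²-* z (z ^ᶜ k))
  (ℝR.trans {∣ z ∣² *ʳ ∣ z ^ᶜ k ∣²} {fromℕ 1 *ʳ fromℕ 1} {fromℕ 1}
    (ℝR.*-cong {∣ z ∣²} {fromℕ 1} {∣ z ^ᶜ k ∣²} {fromℕ 1} h (^-∣∣² z k h)) (ℝR.*-identityˡ (fromℕ 1)))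

-- Bounds on the coefficients, on the inverse and on the condition number

open import Algebra.Properties.Semiring.Mult ℂR.semiring using () renaming (_×_ to infixr 8 _·_)

module ℂD = Domain ℂ-commutativeRing ℂ-noZeroDivisors
module ℂI = Inverse ℂ-commutativeRing ℂ-noZeroDivisors

∣∣²-≤-const : ∀ z a b → (∀ n → seq (re z) n ≡ a) → (∀ n → seq (im z) n ≡ b) → ∀ c → a ℚ.* a ℚ.+ b ℚ.* b ℚ.≤ c → ∣ z ∣² ≤ʳ fromℚ c
∣∣²-≤-const z a b re≡ im≡ c h = pointwise-≤ {∣ z ∣²} {fromℚ c} λ n →
  ≡.subst₂ (λ x y → x ℚ.* x ℚ.+ y ℚ.* y ℚ.≤ c) (≡.sym (re≡ n)) (≡.sym (im≡ n)) h

∣⟦⟧∣²≤1 : ∀ b → ∣ ℂD.⟦ b ⟧ ∣² ≤ʳ fromℚ 1ℚ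
∣⟦⟧∣²≤1 true  = ∣∣²-≤-const 1ᶜ 1ℚ 0ℚ (λ _ → ≡.refl) (λ _ → ≡.refl) 1ℚ ℚ.≤-refl
∣⟦⟧∣²≤1 false = ∣∣²-≤-const 0ᶜ 0ℚ 0ℚ (λ _ → ≡.refl) (λ _ → ≡.refl) 1ℚ (ℚ.nonNegative⁻¹ 1ℚ)

∣neg∣² : ∀ z c → ∣ z ∣² ≤ʳ fromℚ c → ∣ -ᶜ z ∣² ≤ʳ fromℚ c
∣neg∣² z c = ≤ʳ-trans { ∣ -ᶜ z ∣² } {∣ z ∣²} {fromℚ c} (pointwise-≤ { ∣ -ᶜ z ∣² } {∣ z ∣²} λ n → ℚ.≤-reflexive
  (solve 2 (λ a b → :- a :* :- a :+ :- b :* :- b := a :* a :+ b :* b) ≡.refl (seq (re z) n) (seq (im z) n)))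
  where open +-*-Solver

-- As a sum of four terms of squared modulus at most 1, with the sign moved onto c and d, the bound
-- is 4 · 4 · 1.
∣a+b-[c+d]∣²≤16 : ∀ {a b c d} → ∣ a ∣² ≤ʳ fromℚ 1ℚ → ∣ b ∣² ≤ʳ fromℚ 1ℚ → ∣ c ∣² ≤ʳ fromℚ 1ℚ → ∣ d ∣² ≤ʳ fromℚ 1ℚ →
                  ∣ (a ⊕ b) ⊕ ⊖ (c ⊕ d) ∣² ≤ʳ fromℚ (ι 16)
∣a+b-[c+d]∣²≤16 {a} {b} {c} {d} ha hb hc hd = ≡.subst (λ z → ∣ z ∣² ≤ʳ fromℚ (ι 16)) (≡.sym unseal) (≤ʳ-trans {∣ x ∣²} {∣ ∑ᶜ u ∣²} {fromℚ (ι 16)}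
  (≈⇒≤ʳ {∣ x ∣²} {∣ ∑ᶜ u ∣²} (∣∣²-cong {x} {∑ᶜ u} (pointwiseᶜ {x} {∑ᶜ u}
    (λ n → regroup (seq (re a) n) (seq (re b) n) (seq (re c) n) (seq (re d) n))
    (λ n → regroup (seq (im a) n) (seq (im b) n) (seq (im c) n) (seq (im d) n)))))
  (∣∑ᶜ∣²-≤ u 1ℚ bound))
  where
  open +-*-Solver
  x = (a +ᶜ b) +ᶜ -ᶜ (c +ᶜ d)
  unseal : (a ⊕ b) ⊕ ⊖ (c ⊕ d) ≡ x
  unseal = ⊕-unseal (a +ᶜ b) (-ᶜ (c +ᶜ d)) (⊕-unseal a b ≡.refl ≡.refl) (⊖-unseal (c +ᶜ d) (⊕-unseal c d ≡.refl ≡.refl))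
  u : Fin 4 → ℂ
  u zero                   = a
  u (suc zero)             = b
  u (suc (suc zero))       = -ᶜ c
  u (suc (suc (suc zero))) = -ᶜ d
  bound : ∀ i → ∣ u i ∣² ≤ʳ fromℚ 1ℚ
  bound zero                   = ha
  bound (suc zero)             = hb
  bound (suc (suc zero))       = ∣neg∣² c 1ℚ hc
  bound (suc (suc (suc zero))) = ∣neg∣² d 1ℚ hd
  regroup : ∀ a b c d → (a ℚ.+ b) ℚ.+ ℚ.- (c ℚ.+ d) ≡ a ℚ.+ (b ℚ.+ (ℚ.- c ℚ.+ (ℚ.- d ℚ.+ 0ℚ)))
  regroup = solve 4 (λ a b c d → (a :+ b) :+ :- (c :+ d) := a :+ (b :+ (:- c :+ (:- d :+ con 0ℚ)))) ≡.refl

module _ {p q d : ℕ} (G : Gaps p q d) where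

  open ℂD.Reduction G

  ∣blockCoeff∣²≤16 : ∀ h .{{_ : NonZero h}} a j → ∣ blockCoeff h a j ∣² ≤ʳ fromℚ (ι 16)
  ∣blockCoeff∣²≤16 = blockCoeff-elim (λ z → ∣ z ∣² ≤ʳ fromℚ (ι 16))
    (λ b → ≤ʳ-trans {∣ ℂD.⟦ b ⟧ ∣²} {fromℚ 1ℚ} {fromℚ (ι 16)} (∣⟦⟧∣²≤1 b)
      (pointwise-≤ {fromℚ 1ℚ} {fromℚ (ι 16)} (λ _ → ι-mono-≤ {1} {16} (s≤s z≤n))))
    (λ b₁ b₂ b₃ b₄ → ∣a+b-[c+d]∣²≤16 {ℂD.⟦ b₁ ⟧} {ℂD.⟦ b₂ ⟧} {ℂD.⟦ b₃ ⟧} {ℂD.⟦ b₄ ⟧}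
      (∣⟦⟧∣²≤1 b₁) (∣⟦⟧∣²≤1 b₂) (∣⟦⟧∣²≤1 b₃) (∣⟦⟧∣²≤1 b₄))

-- The reciprocal of n + 1, the shift making the denominator nonzero.
ν : ℕ → ℂ
ν n = fromℚ (ℤ.+ 1 ℚ./ suc n) +i fromℕ 0

n·1≡ : ∀ n → n · 1ᶜ ≈ᶜ fromℕ n +i fromℕ 0
n·1≡ zero    = ℂR.refl {0ᶜ}
n·1≡ (suc n) = ℂR.trans {1ᶜ ⊕ n · 1ᶜ} {1ᶜ ⊕ w} {fromℕ (suc n) +i fromℕ 0} (ℂR.+-congˡ {1ᶜ} {n · 1ᶜ} {w} (n·1≡ n))
  (≡.subst (_≈ᶜ fromℕ (suc n) +i fromℕ 0) (≡.sym (⊕-unseal 1ᶜ w ≡.refl ≡.refl))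
    (pointwiseᶜ {1ᶜ +ᶜ w} {fromℕ (suc n) +i fromℕ 0} (λ _ → ≡.sym (ι-+ 1 n)) (λ _ → ℚ.+-identityˡ 0ℚ)))
  where w = fromℕ n +i fromℕ 0

ν-inverse : ∀ n → ν n ⊗ (suc n · 1ᶜ) ≈ᶜ 1ᶜ
ν-inverse n = ℂR.trans {ν n ⊗ (suc n · 1ᶜ)} {ν n ⊗ w} {1ᶜ} (ℂR.*-congˡ {ν n} {suc n · 1ᶜ} {w} (n·1≡ (suc n)))
  (≡.subst (_≈ᶜ 1ᶜ) (≡.sym (⊗-unseal (ν n) w ≡.refl ≡.refl)) (pointwiseᶜ {ν n *ᶜ w} {1ᶜ}
    (λ _ → ≡.trans (≡.cong₂ ℚ._-_ (/-* 1 n) (ℚ.*-zeroˡ 0ℚ)) (ℚ.+-identityʳ 1ℚ))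
    (λ _ → ≡.trans (≡.cong₂ ℚ._+_ (ℚ.*-zeroʳ x) (ℚ.*-zeroˡ (ι (suc n)))) (ℚ.+-identityˡ 0ℚ))))
  where
  w = fromℕ (suc n) +i fromℕ 0
  x = ℤ.+ 1 ℚ./ suc n

∣⊗∣²-≤ : ∀ u z c → ∣ u ∣² ≈ʳ fromℕ 1 → ∣ z ∣² ≤ʳ fromℚ c → ∣ u ⊗ z ∣² ≤ʳ fromℚ c
∣⊗∣²-≤ u z c ∣u∣²≈1 ∣z∣²≤c = ≡.subst (λ w → ∣ w ∣² ≤ʳ fromℚ c) (≡.sym (⊗-unseal u z ≡.refl ≡.refl))
  (≤ʳ-trans {∣ u *ᶜ z ∣²} {∣ z ∣²} {fromℚ c} (≈⇒≤ʳ {∣ u *ᶜ z ∣²} {∣ z ∣²}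
    (ℝR.trans {∣ u *ᶜ z ∣²} {∣ u ∣² *ʳ ∣ z ∣²} {∣ z ∣²} (∣∣²-* u z)
      (ℝR.trans {∣ u ∣² *ʳ ∣ z ∣²} {fromℕ 1 *ʳ ∣ z ∣²} {∣ z ∣²}
        (ℝR.*-congʳ {∣ z ∣²} {∣ u ∣²} {fromℕ 1} ∣u∣²≈1) (ℝR.*-identityˡ ∣ z ∣²)))) ∣z∣²≤c)

-- A mean of n + 1 numbers: the factor (n + 1)² of the squared sum cancels against the squared
-- modulus of `ν n`.
average-bound : ∀ n (f : Fin (suc n) → ℂ) → (∀ a → ∣ f a ∣² ≤ʳ fromℚ (ι 16)) →
                ∣ ν n ⊗ sumᶜ f ∣² ≤ʳ fromℚ (ι 4 ℚ.* ι 4)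
average-bound n f ∣f∣²≤16 = ≡.subst (λ w → ∣ w ∣² ≤ʳ fromℚ C) (≡.sym (⊗-unseal (ν n) S ≡.refl (sumᶜ≡∑ᶜ {f = f} {f} (λ _ → ≡.refl))))
  (≤ʳ-trans {∣ ν n *ᶜ S ∣²} {∣ ν n ∣² *ʳ ∣ S ∣²} {fromℚ C} (≈⇒≤ʳ {∣ ν n *ᶜ S ∣²} {∣ ν n ∣² *ʳ ∣ S ∣²} (∣∣²-* (ν n) S))
    (≤ʳ-trans {∣ ν n ∣² *ʳ ∣ S ∣²} {∣ ν n ∣² *ʳ fromℚ B} {fromℚ C}
      (*ʳ-monoʳ-≤ ∣ ν n ∣² {∣ S ∣²} {fromℚ B} (0≤∣∣² (ν n)) (∣∑ᶜ∣²-≤ f (ι 16) ∣f∣²≤16))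
      (pointwise-≤ {∣ ν n ∣² *ʳ fromℚ B} {fromℚ C} (λ _ → ℚ.≤-reflexive scaled))))
  where
  N = ι (suc n)
  x = ℤ.+ 1 ℚ./ suc n
  B = N ℚ.* (N ℚ.* ι 16)
  C = ι 4 ℚ.* ι 4
  S = ∑ᶜ f
  regroup : ∀ x N c → (x ℚ.* x ℚ.+ 0ℚ ℚ.* 0ℚ) ℚ.* (N ℚ.* (N ℚ.* c)) ≡ (x ℚ.* N) ℚ.* (x ℚ.* N) ℚ.* c
  regroup = solve 3 (λ x N c → (x :* x :+ con 0ℚ :* con 0ℚ) :* (N :* (N :* c)) := (x :* N) :* (x :* N) :* c) ≡.refl
    where open +-*-Solver
  scaled : (x ℚ.* x ℚ.+ 0ℚ ℚ.* 0ℚ) ℚ.* B ≡ C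
  scaled = ≡.trans (regroup x N (ι 16)) (≡.cong (λ y → y ℚ.* y ℚ.* ι 16) (/-* 1 n))

isInverse-unseal : ∀ {m} (A A′ B : Matrix m m) → (∀ i j → A′ i j ≡ A i j) →
                   (∀ i j → sumᶜ (λ k → A′ i k ⊗ B k j) ≈ᶜ 1ᴹ i j) →
                   (∀ i j → sumᶜ (λ k → B i k ⊗ A′ k j) ≈ᶜ 1ᴹ i j) → IsInverse A B
isInverse-unseal A A′ B A′≡A AB≈1 BA≈1 =
  (λ i j → ≡.subst (_≈ᶜ 1ᴹ i j)
    (sumᶜ≡∑ᶜ {f = λ k → A′ i k ⊗ B k j} {λ k → A i k *ᶜ B k j} (λ k → ⊗-unseal (A i k) (B k j) (A′≡A i k) ≡.refl)) (AB≈1 i j)) ,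
  (λ i j → ≡.subst (_≈ᶜ 1ᴹ i j)
    (sumᶜ≡∑ᶜ {f = λ k → B i k ⊗ A′ k j} {λ k → B i k *ᶜ A k j} (λ k → ⊗-unseal (B i k) (A k j) ≡.refl (A′≡A k j))) (BA≈1 i j))

0≤seq-√ : ∀ x → 0≤seq (√ x)
0≤seq-√ x n = 0≤√ℚ n (seq x n)

*ʳ-≤-const : ∀ x y a b → 0≤seq x → 0ℚ ℚ.≤ b → x ≤ʳ fromℚ a → y ≤ʳ fromℚ b → x *ʳ y ≤ʳ fromℚ (b ℚ.* a)
*ʳ-≤-const x y a b 0≤x 0≤b x≤a y≤b =
  ≤ʳ-trans {x *ʳ y} {x *ʳ fromℚ b} {fromℚ (b ℚ.* a)} (*ʳ-monoʳ-≤ x {y} {fromℚ b} 0≤x y≤b)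
    (≤ʳ-trans {x *ʳ fromℚ b} {fromℚ b *ʳ x} {fromℚ (b ℚ.* a)} (≈⇒≤ʳ {x *ʳ fromℚ b} {fromℚ b *ʳ x} (ℝR.*-comm x (fromℚ b)))
      (≤ʳ-trans {fromℚ b *ʳ x} {fromℚ b *ʳ fromℚ a} {fromℚ (b ℚ.* a)} (*ʳ-monoʳ-≤ (fromℚ b) {x} {fromℚ a} (λ _ → 0≤b) x≤a)
        (pointwise-≤ {fromℚ b *ʳ fromℚ a} {fromℚ (b ℚ.* a)} (λ _ → ℚ.≤-refl))))

Cond-≤ : ∀ {m} (A : Matrix m m) (inv : Invertible A) c → 2 ≤ c → (∀ i j → ∣ A i j ∣² ≤ʳ fromℚ (1ℚ ℚ.* 1ℚ)) →
         (∀ i j → ∣ proj₁ inv i j ∣² ≤ʳ fromℚ (ι 4 ℚ.* ι 4)) → Cond A inv ≤ʳ fromℕ (2 * c * m ^ 2)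
Cond-≤ {m} A (B , _) c 2≤c hA hB = ≤ʳ-trans {‖ A ‖ *ʳ ‖ B ‖} {fromℚ ((ι m ℚ.* ι 4) ℚ.* (ι m ℚ.* 1ℚ))} {fromℕ (2 * c * m ^ 2)}
  (*ʳ-≤-const ‖ A ‖ ‖ B ‖ (ι m ℚ.* 1ℚ) (ι m ℚ.* ι 4) (0≤seq-√ (∑ʳ λ i → ∑ʳ λ j → ∣ A i j ∣ᶜ *ʳ ∣ A i j ∣ᶜ))
    (0≤* {ι m} {ι 4} (ι-mono-≤ {0} {m} z≤n) (ι-mono-≤ {0} {4} z≤n))
    (‖‖-≤ A 1ℚ (ι-mono-≤ {0} {1} z≤n) hA) (‖‖-≤ B (ι 4) (ι-mono-≤ {0} {4} z≤n) hB))
  (pointwise-≤ {fromℚ ((ι m ℚ.* ι 4) ℚ.* (ι m ℚ.* 1ℚ))} {fromℕ (2 * c * m ^ 2)} (λ _ → bound))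
  where
  open ℚ.≤-Reasoning
  regroup : ∀ m → m * 4 * (m * 1) ≡ 2 * 2 * (m * (m * 1))
  regroup = solve-∀
  bound : (ι m ℚ.* ι 4) ℚ.* (ι m ℚ.* 1ℚ) ℚ.≤ ι (2 * c * m ^ 2)
  bound = begin
    (ι m ℚ.* ι 4) ℚ.* (ι m ℚ.* 1ℚ)   ≡⟨ ≡.cong₂ ℚ._*_ (ι-* m 4) (ι-* m 1) ⟨
    ι (m * 4) ℚ.* ι (m * 1)          ≡⟨ ι-* (m * 4) (m * 1) ⟨
    ι (m * 4 * (m * 1))
      ≤⟨ ι-mono-≤ (ℕ.≤-trans (ℕ.≤-reflexive (regroup m)) (ℕ.*-monoˡ-≤ (m ^ 2) (ℕ.*-monoʳ-≤ 2 2≤c))) ⟩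
    ι (2 * c * m ^ 2)                ∎

module _ {m n : ℕ} (ζ : Fin m → ℂ) (inj : ∀ {i j} → ζ i ≈ᶜ ζ j → i ≡ j) (ζⁿ≈1 : ∀ i → ζ i ** suc n ≈ᶜ 1ᶜ)
         (ρ : ℕ → ℕ → ℂ) (expand : ∀ i a → a < suc n → ℂD.∑< m (λ j → ρ a j ⊗ ζ i ** j) ≈ᶜ ζ i ** a)
         (∣ρ∣²≤16 : ∀ a j → ∣ ρ a j ∣² ≤ʳ fromℚ (ι 16)) where

  W : Matrix m m
  W = ℂI.W {m} {suc n} ζ inj (ν n) (ν-inverse n) ζⁿ≈1 ρ expand

  invertible : Invertible (Vandermonde ζ)
  invertible = W , isInverse-unseal (Vandermonde ζ) (λ i j → ζ i ** toℕ j) W (λ i j → **≡^ᶜ (ζ i) (toℕ j))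
    (ℂI.VW≈δ {m} {suc n} ζ inj (ν n) (ν-inverse n) ζⁿ≈1 ρ expand)
    (ℂI.WV≈δ {m} {suc n} ζ inj (ν n) (ν-inverse n) ζⁿ≈1 ρ expand)

  ∣ζᵏ∣²≈1 : ∀ i k → ∣ ζ i ** k ∣² ≈ʳ fromℕ 1
  ∣ζᵏ∣²≈1 i k = ≡.subst (λ z → ∣ z ∣² ≈ʳ fromℕ 1) (≡.sym (**≡^ᶜ (ζ i) k))
    (^-∣∣² (ζ i) k (rootOfUnity-∣∣² (suc n) (ζ i) z<s (≡.subst (_≈ᶜ 1ᶜ) (**≡^ᶜ (ζ i) (suc n)) (ζⁿ≈1 i))))

  ∣V∣²≤1 : ∀ i j → ∣ Vandermonde ζ i j ∣² ≤ʳ fromℚ (1ℚ ℚ.* 1ℚ)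
  ∣V∣²≤1 i j = ≡.subst (λ z → ∣ z ∣² ≤ʳ fromℚ (1ℚ ℚ.* 1ℚ)) (**≡^ᶜ (ζ i) (toℕ j))
    (≈⇒≤ʳ {∣ ζ i ** toℕ j ∣²} {fromℕ 1} (∣ζᵏ∣²≈1 i (toℕ j)))

  ∣W∣²≤16 : ∀ j i → ∣ proj₁ invertible j i ∣² ≤ʳ fromℚ (ι 4 ℚ.* ι 4)
  ∣W∣²≤16 j i = average-bound n (λ a → ζ i ** (suc n ∸ toℕ a) ⊗ ρ (toℕ a) (toℕ j)) λ a →
    ∣⊗∣²-≤ (ζ i ** (suc n ∸ toℕ a)) (ρ (toℕ a) (toℕ j)) (ι 16) (∣ζᵏ∣²≈1 i (suc n ∸ toℕ a)) (∣ρ∣²≤16 (toℕ a) (toℕ j))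

  Cond-Vandermonde-≤ : ∀ c → 2 ≤ c → Σ[ inv ∈ Invertible (Vandermonde ζ) ] (Cond (Vandermonde ζ) inv ≤ʳ fromℕ (2 * c * m ^ 2))
  Cond-Vandermonde-≤ c 2≤c = invertible , Cond-≤ (Vandermonde ζ) invertible c 2≤c ∣V∣²≤1 ∣W∣²≤16

primitive⇒**≈1 : ∀ n z → IsPrimitiveRoot n z → z ** n ≈ᶜ 1ᶜ
primitive⇒**≈1 n z (zⁿ≈1 , _) = ≡.subst (_≈ᶜ 1ᶜ) (≡.sym (**≡^ᶜ z n)) zⁿ≈1

primitive⇒**≉1 : ∀ n z k → IsPrimitiveRoot n z → 0 < k → k < n → ¬ z ** k ≈ᶜ 1ᶜ
primitive⇒**≉1 n z k (_ , zᵏ≉1) 0<k k<n zᵏ≈1 = zᵏ≉1 k 0<k k<n (≡.subst (_≈ᶜ 1ᶜ) (**≡^ᶜ z k) zᵏ≈1)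

Cond-rootsOfUnity-≤ : ∀ {m} n (ζ : Fin m → ℂ) → (∀ {i j} → ζ i ≈ᶜ ζ j → i ≡ j) → 0 < n → (∀ i → ζ i ** n ≈ᶜ 1ᶜ) →
  (ρ : ℕ → ℕ → ℂ) → (∀ i a → a < n → ℂD.∑< m (λ j → ρ a j ⊗ ζ i ** j) ≈ᶜ ζ i ** a) → (∀ a j → ∣ ρ a j ∣² ≤ʳ fromℚ (ι 16)) →
  ∀ c → 2 ≤ c → Σ[ inv ∈ Invertible (Vandermonde ζ) ] (Cond (Vandermonde ζ) inv ≤ʳ fromℕ (2 * c * m ^ 2))
Cond-rootsOfUnity-≤ {m} (suc n) ζ inj _ ζⁿ≈1 ρ expand bound c 2≤c =
  Cond-Vandermonde-≤ {m} {n} ζ inj ζⁿ≈1 ρ expand bound c 2≤c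

-- From here p and q are the primes minus one, so that p q h is the totient of n and p q the degree
-- d.
module _ {p q m n h : ℕ} (G : Gaps (suc p) (suc q) (p * q)) (0<p : 0 < p) (0<q : 0 < q) (0<h : 0 < h)
         (m≡ : m ≡ p * q * h) (n≡ : n ≡ h * (suc p * suc q))
         (ζ : Fin m → ℂ) (inj : ∀ {i j} → ζ i ≈ᶜ ζ j → i ≡ j) (isPrimitive : ∀ i → IsPrimitiveRoot n (ζ i)) where

  private instance
    h≢0 : NonZero h
    h≢0 = ℕ.>-nonZero 0<h

  ρ : ℕ → ℕ → ℂ
  ρ = ℂD.Reduction.blockCoeff G h

  -- The exponent h k stays below n, where primitivity applies. Taking for k either prime gives y^p
  -- ≠ 1 and y^q ≠ 1 for y = ζᵢʰ.
  power≉1 : ∀ i k → 0 < k → k < suc p * suc q → ¬ ζ i ** (h * k) ≈ᶜ 1ᶜ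
  power≉1 i k 0<k k<pq = primitive⇒**≉1 n (ζ i) (h * k) (isPrimitive i) (ℕ.*-mono-< 0<h 0<k)
    (≡.subst (h * k <_) (≡.sym n≡) (ℕ.*-monoʳ-< h k<pq))

  expand : ∀ i a → a < n → ℂD.∑< m (λ j → ρ a j ⊗ ζ i ** j) ≈ᶜ ζ i ** a
  expand i a a<n = ≡.subst (λ k → ℂD.∑< k (λ j → ρ a j ⊗ ζ i ** j) ≈ᶜ ζ i ** a) (≡.sym m≡)
    (ℂD.Reduction.block-expansion G h (ζ i) z<s z<s (expand-pq p q)
      (power≉1 i (suc p) z<s (ℕ.m<m*n (suc p) (suc q) (s<s 0<q)))
      (power≉1 i (suc q) z<s (≡.subst (suc q <_) (ℕ.*-comm (suc q) (suc p)) (ℕ.m<m*n (suc q) (suc p) (s<s 0<p))))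
      (≡.subst (λ k → ζ i ** k ≈ᶜ 1ᶜ) n≡ (primitive⇒**≈1 n (ζ i) (isPrimitive i))) a (≡.subst (a <_) n≡ a<n))
    where
    expand-pq : ∀ p q → suc p ℕ.+ suc q ℕ.+ p * q ≡ suc (suc p * suc q)
    expand-pq = solve-∀

  Cond-primitiveRoots-≤ : ∀ c → 2 ≤ c → Σ[ inv ∈ Invertible (Vandermonde ζ) ] (Cond (Vandermonde ζ) inv ≤ʳ fromℕ (2 * c * m ^ 2))
  Cond-primitiveRoots-≤ = Cond-rootsOfUnity-≤ n ζ inj (≡.subst (0 <_) (≡.sym n≡) (ℕ.*-mono-< {0} {h} 0<h z<s))
    (λ i → primitive⇒**≈1 n (ζ i) (isPrimitive i)) ρ expand (∣blockCoeff∣²≤16 G h)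

-- Oddness enters through this bound: it makes rad n at least 3, and hence φ(rad n) at least 2.
odd⇒3≤ : ∀ {p} → Prime p → ¬ 2 ∣ p → 3 ≤ p
odd⇒3≤ {0}                 pp _   = contradiction pp ¬prime[0]
odd⇒3≤ {1}                 pp _   = contradiction pp ¬prime[1]
odd⇒3≤ {2}                 _  2∤2 = contradiction ∣-refl 2∤2
odd⇒3≤ {suc (suc (suc _))} _  _   = s≤s (s≤s (s≤s z≤n))

Cond-cyclotomic-≤ : ∀ p q r l n → Prime (suc p) → Prime (suc q) → ¬ 2 ∣ suc p → ¬ 2 ∣ suc q → suc p ≢ suc q →
  n ≡ suc p ^ suc r * suc q ^ suc l → (ζ : Fin (φ n) → ℂ) → EnumeratesPrimitiveRoots n ζ →
  Σ[ inv ∈ Invertible (Vandermonde ζ) ] (Cond (Vandermonde ζ) inv ≤ʳ fromℕ (2 * φ (rad n) * φ n ^ 2))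
Cond-cyclotomic-≤ p q r l n pp pq 2∤p 2∤q p≢q n≡ ζ (isPrimitive , inj , _) =
  Cond-primitiveRoots-≤ G 0<p 0<q 0<h (≡.trans (≡.cong φ n≡) (φ-primePowers pp pq p≢q r l))
    (≡.trans n≡ (n≡h*pq pp pq p≢q r l)) ζ inj isPrimitive (φ (rad n)) 2≤φrad
  where
  positive : ∀ r l → 0 < suc p ^ r * suc q ^ l
  positive r l = ℕ.*-mono-< (ℕ.m^n>0 (suc p) r) (ℕ.m^n>0 (suc q) l)
  0<h = positive r l
  0<p : 0 < p
  0<p = ℕ.≤-pred (ℕ.<⇒≤ (odd⇒3≤ pp 2∤p))
  0<q : 0 < q
  0<q = ℕ.≤-pred (ℕ.<⇒≤ (odd⇒3≤ pq 2∤q))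
  q⁻¹ = inverse-mod (s<s 0<p) (distinctPrimes⇒coprime pp pq p≢q)
  G : Gaps (suc p) (suc q) (p * q)
  G = gaps (proj₁ q⁻¹) (proj₁ (proj₂ q⁻¹)) (proj₂ (proj₂ q⁻¹))
  2≤φrad : 2 ≤ φ (rad n)
  2≤φrad = 2≤φ (rad n) (ℕ.≤-trans (odd⇒3≤ pp 2∤p)
    (prime≤rad n (≡.subst (0 <_) (≡.sym n≡) (positive (suc r) (suc l))) pp
      (≡.subst (suc p ∣_) (≡.sym n≡) (∣m⇒∣m*n (suc q ^ suc l) (m∣m*n (suc p ^ r))))))

theorem4p3 : ∀ (p q r l : ℕ) → Prime p → Prime q → ¬ (2 ∣ p) → ¬ (2 ∣ q) → p ≢ q →
    1 ≤ r → 1 ≤ l →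
    let n = p ^ r * q ^ l
        m = φ n
    in (ζ : Fin m → ℂ) → EnumeratesPrimitiveRoots n ζ →
       Σ[ inv ∈ Invertible (Vandermonde ζ) ]
         (Cond (Vandermonde ζ) inv ≤ʳ fromℕ (2 * φ (rad n) * m ^ 2))
theorem4p3 zero    q       r       l       pp pq _   _   _   _ _ = contradiction pp ¬prime[0]
theorem4p3 (suc p) zero    r       l       pp pq _   _   _   _ _ = contradiction pq ¬prime[0]
theorem4p3 (suc p) (suc q) (suc r) (suc l) pp pq 2∤p 2∤q p≢q _ _ =
  Cond-cyclotomic-≤ p q r l (suc p ^ suc r * suc q ^ suc l) pp pq 2∤p 2∤q p≢q ≡.refl
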